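{- For every countable limit ordinal $\lambda$ there is a countable linear ordering whose Scott sentence complexity is $\Sigma^{\mathrm{in}}_{\lambda+3}$.
   Context: Infinitary formulas: $\Sigma^{\mathrm{in}}_0=\Pi^{\mathrm{in}}_0$ are the finitary quantifier-free formulas; for $\alpha\ge1$, a $\Sigma^{\mathrm{in}}_\alpha$ formula is a countable disjunction of formulas $\exists\bar x\,\varphi$ with $\varphi\in\Pi^{\mathrm{in}}_\beta$, $\beta<\alpha$, and $\Pi^{\mathrm{in}}_\alpha$ is dual; $d\text{ - }\Sigma^{\mathrm{in}}_\alpha$ formulas are conjunctions of a $\Sigma^{\mathrm{in}}_\alpha$ and a $\Pi^{\mathrm{in}}_\alpha$ formula. A Scott sentence of a countable structure is an $L_{\omega_1\omega}$ sentence whose countable models are exactly its isomorphic copies. The Scott sentence complexity of a structure is the least class among $\Pi^{\mathrm{in}}_\alpha,\Sigma^{\mathrm{in}}_\alpha,d\text{ - }\Sigma^{\mathrm{in}}_\alpha$ ($\alpha\ge1$) in which it has a Scott sentence, classes ordered by inclusion up to equivalence ($\Pi_\alpha,\Sigma_\alpha\subseteq d\text{ - }\Sigma_\alpha\subseteq \Sigma_{\alpha+1}\cap\Pi_{\alpha+1}$). -}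

module Defs where

open import Level using (0ℓ)
open import Data.Nat using (ℕ; _+_)
open import Data.Fin using (Fin)
open import Data.Maybe using (Maybe; just; nothing)
open import Data.Product using (Σ; _×_; _,_; ∃)
open import Data.Sum using (_⊎_)
open import Data.Unit using (⊤)
open import Data.Empty using (⊥)
open import Relation.Nullary using (¬_)
open import Relation.Binary.PropositionalEquality using (_≡_)
open import Relation.Binary.Structures using (IsStrictTotalOrder)
open import Data.Vec.Functional using (Vector; _++_)
open import Function.Bundles using (_↔_; Inverse)

data Ord : Set where
  zero : Ord
  suc  : Ord → Ord
  lim  : (ℕ → Ord) → Ord

-- the order induced by the interpretation zero ↦ 0, suc ↦ +1, lim ↦ sup
data _≤o_ : Ord → Ord → Set where
  ≤-zero     : ∀ {x} → zero ≤o x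
  ≤-refl     : ∀ {x} → x ≤o x
  ≤-trans    : ∀ {x y z} → x ≤o y → y ≤o z → x ≤o z
  ≤-suc-mono : ∀ {x y} → x ≤o y → suc x ≤o suc y
  ≤-suc      : ∀ {x} → x ≤o suc x
  ≤-cocone   : ∀ {x f} (k : ℕ) → x ≤o f k → x ≤o lim f
  ≤-limiting : ∀ {x f} → (∀ k → f k ≤o x) → lim f ≤o x

_<o_ : Ord → Ord → Set
x <o y = suc x ≤o y

IsLimit : Ord → Set
IsLimit l = (zero <o l) × (∀ β → β <o l → suc β <o l)

record Structure : Set₁ where
  field
    Carrier : Set
    _≺_     : Carrier → Carrier → Set
open Structure public

-- countable (and nonempty, as usual for L_{ω₁ω}-structures): image of ℕ
Countable : Structure → Set
Countable M = Σ (ℕ → Carrier M) λ e → ∀ c → ∃ λ n → e n ≡ c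

_≅_ : Structure → Structure → Set
M ≅ N = Σ (Carrier M ↔ Carrier N) λ f →
          ∀ x y → ((_≺_ M x y → _≺_ N (Inverse.to f x) (Inverse.to f y))
                 × (_≺_ N (Inverse.to f x) (Inverse.to f y) → _≺_ M x y))

IsLinearOrdering : Structure → Set
IsLinearOrdering M = IsStrictTotalOrder (_≡_ {A = Carrier M}) (_≺_ M)

data QF (n : ℕ) : Set where
  lt eq  : Fin n → Fin n → QF n
  tt ff  : QF n
  neg    : QF n → QF n
  and or : QF n → QF n → QF n

satQF : (M : Structure) {n : ℕ} → QF n → Vector (Carrier M) n → Set
satQF M (lt i j) ρ = _≺_ M (ρ i) (ρ j)
satQF M (eq i j) ρ = ρ i ≡ ρ j
satQF M tt ρ = ⊤
satQF M ff ρ = ⊥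
satQF M (neg φ) ρ = ¬ satQF M φ ρ
satQF M (and φ ψ) ρ = satQF M φ ρ × satQF M ψ ρ
satQF M (or φ ψ) ρ = satQF M φ ρ ⊎ satQF M ψ ρ

-- Σ^in_α and Π^in_α formulas with n free variables.
-- Σ_0 = Π_0 = QF (only at index zero).  For α ≥ 1 a Σ_α formula is a
-- countable disjunction (family ℕ → Maybe _, `nothing` = omitted,
-- so finite/empty families are allowed) of ∃x̄ φ (x̄ of length k)
-- with φ ∈ Π_β, β < α; Π_α dually.

mutual
  data SigmaF (α : Ord) (n : ℕ) : Set where
    qfΣ   : α ≡ zero → QF n → SigmaF α n
    bigOr : (ℕ → Maybe (ExPart α n)) → SigmaF α n

  data ExPart (α : Ord) (n : ℕ) : Set where
    ex : (β : Ord) → β <o α → (k : ℕ) → PiF β (k + n) → ExPart α n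

  data PiF (α : Ord) (n : ℕ) : Set where
    qfΠ    : α ≡ zero → QF n → PiF α n
    bigAnd : (ℕ → Maybe (AllPart α n)) → PiF α n

  data AllPart (α : Ord) (n : ℕ) : Set where
    all : (β : Ord) → β <o α → (k : ℕ) → SigmaF β (k + n) → AllPart α n

mutual
  satΣ : (M : Structure) {α : Ord} {n : ℕ} → SigmaF α n → Vector (Carrier M) n → Set
  satΣ M (qfΣ _ φ) ρ = satQF M φ ρ
  satΣ M (bigOr fam) ρ = Σ ℕ λ i → satMEx M (fam i) ρ

  satMEx : (M : Structure) {α : Ord} {n : ℕ} → Maybe (ExPart α n) → Vector (Carrier M) n → Set
  satMEx M nothing ρ = ⊥
  satMEx M (just (ex β _ k φ)) ρ = Σ (Vector (Carrier M) k) λ σ → satΠ M φ (σ ++ ρ)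

  satΠ : (M : Structure) {α : Ord} {n : ℕ} → PiF α n → Vector (Carrier M) n → Set
  satΠ M (qfΠ _ φ) ρ = satQF M φ ρ
  satΠ M (bigAnd fam) ρ = (i : ℕ) → satMAll M (fam i) ρ

  satMAll : (M : Structure) {α : Ord} {n : ℕ} → Maybe (AllPart α n) → Vector (Carrier M) n → Set
  satMAll M nothing ρ = ⊤
  satMAll M (just (all β _ k φ)) ρ = (σ : Vector (Carrier M) k) → satΣ M φ (σ ++ ρ)

ε : {A : Set} → Vector A 0
ε ()

IsScottSentence : (sat : Structure → Set) → Structure → Set₁
IsScottSentence sat A = (M : Structure) → Countable M → (sat M → M ≅ A) × (M ≅ A → sat M)

HasΣScott : Ord → Structure → Set₁
HasΣScott α A = Σ (SigmaF α 0) λ φ → IsScottSentence (λ M → satΣ M φ ε) A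

HasΠScott : Ord → Structure → Set₁
HasΠScott α A = Σ (PiF α 0) λ φ → IsScottSentence (λ M → satΠ M φ ε) A

HasDΣScott : Ord → Structure → Set₁
HasDΣScott α A = Σ (SigmaF α 0 × PiF α 0) λ { (φ , ψ) →
  IsScottSentence (λ M → satΣ M φ ε × satΠ M ψ ε) A }

-- Scott sentence complexity is Σ_α: Σ_α is the least class containing a Scott
-- sentence, i.e. there is a Σ_α one, none in Π_α, and none in any class of
-- index < α (all of which are contained in d-Σ_β for some β < α).
ScottComplexityΣ : Ord → Structure → Set₁
ScottComplexityΣ α A =
  HasΣScott α A × (¬ HasΠScott α A) × (∀ β → β <o α → ¬ HasDΣScott β A)

{-# OPTIONS --safe #-}
module Submission where

-- Let Sh(C) be the shuffle of the orders in C, each occurring densely.  The ordering is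
-- A = Sh(ω^v : v ≤ l) + ω^v₀ + Sh(ω^v : v < l), with the start of the block ω^v₀ as parameter.
-- Over it every orbit is Σ_{l+1}-definable: block starts are Π_l-definable as the points divisible by
-- all ω^v with v < l, and their exponents by asking which ω^v fit in.  Hence a Σ_{l+3} Scott sentence.
-- Conversely every Π_{l+3} sentence true in A is true in M = Sh(ω^v : v ≤ l) + Sh(ω^v : v < l), which is
-- not isomorphic to A.  To compare the two, first move the middle block of A to a block ω^v₀ of the right
-- shuffle of M; then the blocks left of that one can be moved into the left shuffle, because ω^v and ω^w
-- agree on Π_δ formulas for v, w ≥ δ, so the two shuffles agree below level l.

open import Defs
open import Level using (0ℓ)
open import Axiom.ExcludedMiddle using (ExcludedMiddle)
open import Data.Bool using (Bool; true; false; T)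
open import Data.Bool.Properties using (T-irrelevant)
open import Data.Empty using (⊥; ⊥-elim)
open import Data.Fin using (Fin; zero; suc; splitAt; _↑ʳ_)
open import Data.Fin.Properties using (splitAt-↑ʳ)
open import Data.List as List using (List; []; _∷_; length; map; replicate; tabulate)
open import Data.List.Membership.Propositional using (_∈_)
open import Data.List.Membership.Propositional.Properties using (∈-map⁺; ∈-map⁻; ∈-tabulate⁺)
open import Data.List.Properties using (++-assoc; ++-identityʳ)
open import Data.List.Relation.Binary.Pointwise as PW using (Pointwise; []; _∷_)
open import Data.List.Relation.Unary.All as All using (All; []; _∷_)
open import Data.List.Relation.Unary.All.Properties using (tabulate⁺)
open import Data.List.Relation.Unary.Any using (here; there)
open import Data.Maybe using (Maybe; just; nothing)
open import Data.Nat as ℕ using (ℕ; zero; suc; _+_; s≤s)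
import Data.Nat.Properties as ℕₚ
open import Data.Product using (Σ; _×_; _,_; proj₁; proj₂; ∃; swap)
open import Data.Sum using (_⊎_; inj₁; inj₂)
open import Data.Unit using (⊤; tt)
open import Data.Vec.Functional as Vector using (Vector; _++_)
open import Function using (_∘_; id)
open import Function.Bundles using (Inverse; mk↔ₛ′)
open import Induction.WellFounded using (Acc; acc)
open import Relation.Binary.Definitions using (Tri; tri<; tri≈; tri>)
open import Relation.Binary.PropositionalEquality using (_≡_; refl; sym; trans; cong; cong₂; subst; subst₂; isEquivalence)
open import Relation.Nullary using (¬_; Dec; yes; no)
open import Relation.Nullary.Decidable using (True; toWitness; fromWitness; recompute)

-- The exponent l occurs only in the left shuffle, and a formula of level δ below l does not
-- distinguish it from the other exponents from δ on. So the two shuffles differ at level l only,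
-- and the cut between them can be recognised only as the supremum of the blocks of exponent l.
-- `Block true` has a point there, its rival `Block false` has none. The three levels above l are
-- the three moves needed to hide this. A tuple of `Block false` is also a tuple of `Block true`.
-- The block standing in for the missing point is chosen only when a tuple of `Block true` is known,
-- so it can lie left of everything this tuple has in the right shuffle. Only one more tuple of
-- `Block false` can enter the gap between the cut and the stand-in, and at levels up to l it is no
-- longer visible that this gap lacks the exponent l. That l is a limit enters on both sides: below
-- l there is always room for finitely many more quantifiers and for one more exponent.

-- Enumerations

Enumeration : Set → Set
Enumeration X = Σ (ℕ → X) λ e → ∀ x → ∃ λ n → e n ≡ x

private
  diagonalStep : ℕ × ℕ → ℕ × ℕ
  diagonalStep (a , zero)  = zero , suc a
  diagonalStep (a , suc b) = suc a , b

unpair : ℕ → ℕ × ℕ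
unpair zero    = zero , zero
unpair (suc n) = diagonalStep (unpair n)

unpair-surjective : ∀ p → ∃ λ n → unpair n ≡ p
unpair-surjective (a , b) = go (a + b) a b refl
  where
  go : ∀ s a b → a + b ≡ s → ∃ λ n → unpair n ≡ (a , b)
  go s zero zero _ = 0 , refl
  go s (suc a) b e with go s a (suc b) (trans (ℕₚ.+-suc a b) e)
  ... | n , p = suc n , cong diagonalStep p
  go (suc s) zero (suc b) e with go s b zero (trans (ℕₚ.+-identityʳ b) (ℕₚ.suc-injective e))
  ... | n , p = suc n , cong diagonalStep p

enum-× : ∀ {X Y} → Enumeration X → Enumeration Y → Enumeration (X × Y)
enum-× (e , s) (f , t) = (λ n → e (proj₁ (unpair n)) , f (proj₂ (unpair n))) , surj
  where
  surj : ∀ p → _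
  surj (x , y) with s x | t y
  ... | a , refl | b , refl with unpair-surjective (a , b)
  ...   | n , p = n , cong (λ q → e (proj₁ q) , f (proj₂ q)) p

enum-List : ∀ {X} → Enumeration X → Enumeration (List X)
enum-List {X} (e , s) = (λ n → decode (proj₁ (unpair n)) (proj₂ (unpair n))) , surj
  where
  decode : ℕ → ℕ → List X
  decode zero    m = []
  decode (suc k) m = e (proj₁ (unpair m)) ∷ decode k (proj₂ (unpair m))
  decode-surj : ∀ xs → ∃ λ m → decode (length xs) m ≡ xs
  decode-surj [] = 0 , refl
  decode-surj (x ∷ xs) with s x | decode-surj xs
  ... | a , p | b , q with unpair-surjective (a , b)
  ...   | m , r = m , cong₂ _∷_ (trans (cong (e ∘ proj₁) r) p)
                                (trans (cong (decode (length xs) ∘ proj₂) r) q)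
  surj : ∀ xs → _
  surj xs with decode-surj xs
  ... | m , p with unpair-surjective (length xs , m)
  ...   | n , r = n , trans (cong (λ q → decode (proj₁ q) (proj₂ q)) r) p

enum-Bool : Enumeration Bool
enum-Bool = (λ { zero → false ; (suc _) → true }) , λ { false → 0 , refl ; true → 1 , refl }

-- Ordinal notations, and the exponents drawn from them

-- ≤o has transitivity as a constructor; this equivalent order computes, so it can be inverted.
_⊑_ : Ord → Ord → Set
zero  ⊑ y     = ⊤
suc x ⊑ zero  = ⊥
suc x ⊑ suc y = x ⊑ y
suc x ⊑ lim f = Σ ℕ λ k → suc x ⊑ f k
lim f ⊑ y     = ∀ k → f k ⊑ y

⊑-cocone : ∀ x {f} k → x ⊑ f k → x ⊑ lim f
⊑-cocone zero    k p = tt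
⊑-cocone (suc x) k p = k , p
⊑-cocone (lim g) k p = λ j → ⊑-cocone (g j) k (p j)

⊑-refl : ∀ x → x ⊑ x
⊑-refl zero    = tt
⊑-refl (suc x) = ⊑-refl x
⊑-refl (lim f) = λ k → ⊑-cocone (f k) k (⊑-refl (f k))

mutual
  ⊑-suc : ∀ x y → x ⊑ y → x ⊑ suc y
  ⊑-suc zero    y p = tt
  ⊑-suc (suc x) y p = ⊑-pred x y p
  ⊑-suc (lim f) y p = λ k → ⊑-suc (f k) y (p k)

  ⊑-pred : ∀ x y → suc x ⊑ y → x ⊑ y
  ⊑-pred x (suc y) p       = ⊑-suc x y p
  ⊑-pred x (lim f) (k , p) = ⊑-cocone x k (⊑-pred x (f k) p)

⊑-trans : ∀ x y z → x ⊑ y → y ⊑ z → x ⊑ z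
⊑-trans zero    y       z       p       q       = tt
⊑-trans (lim f) y       z       p       q       = λ k → ⊑-trans (f k) y z (p k) q
⊑-trans (suc x) (suc y) (suc z) p       q       = ⊑-trans x y z p q
⊑-trans (suc x) (suc y) (lim f) p       (k , q) = k , ⊑-trans (suc x) (suc y) (f k) p q
⊑-trans (suc x) (lim g) z       (k , p) q       = ⊑-trans (suc x) (g k) z p (q k)

≤⇒⊑ : ∀ {x y} → x ≤o y → x ⊑ y
≤⇒⊑ ≤-zero                     = tt
≤⇒⊑ (≤-refl {x})               = ⊑-refl x
≤⇒⊑ (≤-trans {x} {y} {z} p q)  = ⊑-trans x y z (≤⇒⊑ p) (≤⇒⊑ q)
≤⇒⊑ (≤-suc-mono p)             = ≤⇒⊑ p
≤⇒⊑ (≤-suc {x})                = ⊑-suc x x (⊑-refl x)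
≤⇒⊑ (≤-cocone {x} k p)         = ⊑-cocone x k (≤⇒⊑ p)
≤⇒⊑ (≤-limiting h)             = λ k → ≤⇒⊑ (h k)

⊑⇒≤ : ∀ x y → x ⊑ y → x ≤o y
⊑⇒≤ zero    y       p       = ≤-zero
⊑⇒≤ (suc x) (suc y) p       = ≤-suc-mono (⊑⇒≤ x y p)
⊑⇒≤ (suc x) (lim f) (k , p) = ≤-cocone k (⊑⇒≤ (suc x) (f k) p)
⊑⇒≤ (lim f) y       p       = ≤-limiting λ k → ⊑⇒≤ (f k) y (p k)

suc-inj-≤ : ∀ {x y} → suc x ≤o suc y → x ≤o y
suc-inj-≤ {x} {y} p = ⊑⇒≤ x y (≤⇒⊑ p)

<lim-inv : ∀ {x f} → x <o lim f → Σ ℕ λ k → x <o f k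
<lim-inv {x} {f} p with ≤⇒⊑ p
... | k , q = k , ⊑⇒≤ (suc x) (f k) q

≮zero : ∀ {x} → ¬ x <o zero
≮zero p = ≤⇒⊑ p

<⇒≤ : ∀ {x y} → x <o y → x ≤o y
<⇒≤ p = ≤-trans ≤-suc p

<-Acc : ∀ x → Acc _<o_ x
<-Acc x = acc (below x)
  where
  below : ∀ x {y} → y <o x → Acc _<o_ y
  below zero    p = ⊥-elim (≮zero p)
  below (suc x) p = acc λ q → below x (≤-trans q (suc-inj-≤ p))
  below (lim f) p with <lim-inv p
  ... | k , q = below (f k) q

<-irrefl : ∀ {x} → ¬ x <o x
<-irrefl {x} = go (<-Acc x)
  where
  go : ∀ {x} → Acc _<o_ x → ¬ x <o x
  go (acc rs) p = go (rs p) p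

_≈o_ : Ord → Ord → Set
x ≈o y = (x ≤o y) × (y ≤o x)

-- The index is a path into the notation: zero stops, and at a limit the rest of the index codes the
-- branch to take. By `subterm-surjective` the subterms of l exhaust the ordinals up to l, which
-- makes the set of exponents countable.
subterm : Ord → ℕ → Ord
subterm zero    n       = zero
subterm (suc x) zero    = suc x
subterm (suc x) (suc n) = subterm x n
subterm (lim f) zero    = lim f
subterm (lim f) (suc n) = subterm (f (proj₁ (unpair n))) (proj₂ (unpair n))

subterm-0 : ∀ x → subterm x 0 ≡ x
subterm-0 zero    = refl
subterm-0 (suc x) = refl
subterm-0 (lim f) = refl

subterm-≤ : ∀ x n → subterm x n ≤o x
subterm-≤ zero    n       = ≤-refl
subterm-≤ (suc x) zero    = ≤-refl
subterm-≤ (suc x) (suc n) = ≤-trans (subterm-≤ x n) ≤-suc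
subterm-≤ (lim f) zero    = ≤-refl
subterm-≤ (lim f) (suc n) = ≤-cocone _ (subterm-≤ (f (proj₁ (unpair n))) _)

_⊕ₙ_ : Ord → ℕ → Ord
x ⊕ₙ zero  = x
x ⊕ₙ suc n = suc (x ⊕ₙ n)

⊕ₙ-mono : ∀ n {x y} → x ≤o y → (x ⊕ₙ n) ≤o (y ⊕ₙ n)
⊕ₙ-mono zero    p = p
⊕ₙ-mono (suc n) p = ≤-suc-mono (⊕ₙ-mono n p)

⊕ₙ-<limit : ∀ n {x μ} → IsLimit μ → x <o μ → (x ⊕ₙ n) <o μ
⊕ₙ-<limit zero    lμ p = p
⊕ₙ-<limit (suc n) lμ p = proj₂ lμ _ (⊕ₙ-<limit n lμ p)

-- Twelve levels per successor leave room for the quantifiers of one step of the formula Lim below.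
stretch : Ord → Ord
stretch zero    = zero
stretch (suc x) = stretch x ⊕ₙ 12
stretch (lim f) = lim (stretch ∘ f)

module Classical (em : ExcludedMiddle 0ℓ) where

  byContradiction : {P : Set} → ¬ ¬ P → P
  byContradiction {P} h with em {P}
  ... | yes p = p
  ... | no ¬p = ⊥-elim (h ¬p)

  ¬∀⇒∃¬ : {X : Set} {P : X → Set} → ¬ (∀ x → P x) → Σ X λ x → ¬ P x
  ¬∀⇒∃¬ h = byContradiction λ k → h λ x → byContradiction λ np → k (x , np)

  ≤-or-> : ∀ x y → (x ≤o y) ⊎ (y <o x)
  ≤-or-> zero y = inj₁ ≤-zero
  ≤-or-> (lim f) y with em {∀ k → f k ≤o y}
  ... | yes h = inj₁ (≤-limiting h)
  ... | no ¬h with ¬∀⇒∃¬ ¬h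
  ...   | k , ¬p with ≤-or-> (f k) y
  ...     | inj₁ p = ⊥-elim (¬p p)
  ...     | inj₂ q = inj₂ (≤-cocone k q)
  ≤-or-> (suc x) zero = inj₂ (≤-suc-mono ≤-zero)
  ≤-or-> (suc x) (suc y) with ≤-or-> x y
  ... | inj₁ p = inj₁ (≤-suc-mono p)
  ... | inj₂ q = inj₂ (≤-suc-mono q)
  ≤-or-> (suc x) (lim g) with em {Σ ℕ λ k → suc x ≤o g k}
  ... | yes (k , p) = inj₁ (≤-cocone k p)
  ... | no ¬h = inj₂ (≤-suc-mono (≤-limiting λ k → small k))
    where
    small : ∀ k → g k ≤o x
    small k with ≤-or-> (suc x) (g k)
    ... | inj₁ p = ⊥-elim (¬h (k , p))
    ... | inj₂ q = suc-inj-≤ q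

  ≰⇒> : ∀ {x y} → ¬ x ≤o y → y <o x
  ≰⇒> {x} {y} h with ≤-or-> x y
  ... | inj₁ p = ⊥-elim (h p)
  ... | inj₂ q = q

  ≮⇒≥ : ∀ {x y} → ¬ x <o y → y ≤o x
  ≮⇒≥ {x} {y} h with ≤-or-> y x
  ... | inj₁ p = p
  ... | inj₂ q = ⊥-elim (h q)

  -- Descend for as long as possible: a y that is at most `suc x` but not at most x is equivalent to
  -- `suc x`, and a y strictly below a limit is below one of its branches.
  subterm-surjective : ∀ x y → y ≤o x → Σ ℕ λ n → subterm x n ≈o y
  subterm-surjective zero    y p = 0 , (≤-zero , p)
  subterm-surjective (suc x) y p with ≤-or-> y x
  ... | inj₁ q = let (n , r) = subterm-surjective x y q in suc n , r
  ... | inj₂ q = 0 , (q , p)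
  subterm-surjective (lim f) y p with ≤-or-> (lim f) y
  ... | inj₁ q = 0 , (q , p)
  ... | inj₂ q with <lim-inv q
  ...   | k , r with subterm-surjective (f k) y (<⇒≤ r)
  ...     | n , s with unpair-surjective (k , n)
  ...       | m , e = suc m , subst (λ p → subterm (f (proj₁ p)) (proj₂ p) ≈o y) (sym e) s

  leastWitness : (P : ℕ → Set) → ∀ n → P n → Σ ℕ λ m → P m × (∀ k → k ℕ.< m → ¬ P k)
  leastWitness P n p = go n 0 (subst P (sym (ℕₚ.+-identityʳ n)) p) (λ k ())
    where
    go : ∀ fuel m → P (fuel + m) → (∀ k → k ℕ.< m → ¬ P k) → Σ ℕ λ m → P m × (∀ k → k ℕ.< m → ¬ P k)
    go zero m p h = m , p , h
    go (suc f) m p h with em {P m}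
    ... | yes q = m , q , h
    ... | no ¬q = go f (suc m) (subst P (sym (ℕₚ.+-suc f m)) p) h′
      where
      h′ : ∀ k → k ℕ.< suc m → ¬ P k
      h′ k (s≤s k≤m) with ℕₚ.m≤n⇒m<n∨m≡n k≤m
      ... | inj₁ k<m = h k k<m
      ... | inj₂ refl = ¬q

  stretch-mono : ∀ x y → x ⊑ y → stretch x ≤o stretch y
  stretch-mono zero    y p = ≤-zero
  stretch-mono (suc x) (suc y) p = ⊕ₙ-mono 12 (stretch-mono x y p)
  stretch-mono (suc x) (lim f) (k , p) = ≤-cocone k (stretch-mono (suc x) (f k) p)
  stretch-mono (lim f) y p = ≤-limiting λ k → stretch-mono (f k) y (p k)

  -- For x = lim f either some f k already attains x, or x is itself a limit and bounds all stretch (f k).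
  stretch-<limit : ∀ x μ → IsLimit μ → x <o μ → stretch x <o μ
  stretch-<limit zero    μ (pos , _)  p = pos
  stretch-<limit (suc x) μ lμ p = ⊕ₙ-<limit 12 lμ (stretch-<limit x μ lμ (<⇒≤ p))
  stretch-<limit (lim f) μ lμ p with em {Σ ℕ λ k → lim f ≤o f k}
  ... | yes (k , q) = ≤-trans (≤-suc-mono (stretch-mono (lim f) (f k) (≤⇒⊑ q)))
                              (stretch-<limit (f k) μ lμ (≤-trans (≤-suc-mono (≤-cocone k ≤-refl)) p))
  ... | no h = ≤-trans (≤-suc-mono (≤-limiting λ k → <⇒≤ (stretch-<limit (f k) (lim f) limit (unattained k)))) p
    where
    unattained : ∀ k → f k <o lim f
    unattained k = ≰⇒> λ q → h (k , q)
    limit : IsLimit (lim f)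
    limit = ≤-trans (≤-suc-mono ≤-zero) (unattained 0)
          , λ β q → let (k , r) = <lim-inv q in ≤-trans (≤-suc-mono r) (unattained k)

-- Different notations may denote the same ordinal, whereas entries of Cantor normal forms are to be
-- compared by `_≡_`; hence a type with exactly one element for each ordinal up to l.
record Exponents (l : Ord) : Set₁ where
  field
    V            : Set
    r            : V → Ord
    r-injective  : ∀ v w → r v ≈o r w → v ≡ w
    r-surjective : ∀ x → x ≤o l → Σ V λ v → r v ≈o x
    rank-≤l      : ∀ v → r v ≤o l
    top          : V
    r-top        : r top ≡ l
    enumV        : Enumeration V

-- Each ordinal ≤ l is represented by the first index at which it occurs among the subterms of l.
exponents : ExcludedMiddle 0ℓ → ∀ l → Exponents l
exponents em l = record
  { V = V ; r = r ; r-injective = r-injective ; r-surjective = r-surjective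
  ; rank-≤l = λ { (n , _) → subterm-≤ l n }
  ; top = mkV 0 (λ m ()) ; r-top = subterm-0 l ; enumV = e , surj }
  where
  open Classical em

  Canonical : ℕ → Set
  Canonical n = ∀ m → m ℕ.< n → ¬ (subterm l m ≈o subterm l n)

  V : Set
  V = Σ ℕ λ n → True (em {Canonical n})

  r : V → Ord
  r (n , _) = subterm l n

  mkV : ∀ n → Canonical n → V
  mkV n c = n , fromWitness c

  canonical : (v : V) → Canonical (proj₁ v)
  canonical (n , t) = toWitness t

  V-≡ : ∀ {v w : V} → proj₁ v ≡ proj₁ w → v ≡ w
  V-≡ {n , s} {_ , t} refl = cong (n ,_) (T-irrelevant s t)

  r-injective : ∀ v w → r v ≈o r w → v ≡ w
  r-injective v w (p , q) with ℕₚ.<-cmp (proj₁ v) (proj₁ w)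
  ... | tri< a _ _ = ⊥-elim (canonical w _ a (p , q))
  ... | tri≈ _ e _ = V-≡ e
  ... | tri> _ _ a = ⊥-elim (canonical v _ a (q , p))

  r-surjective : ∀ x → x ≤o l → Σ V λ v → r v ≈o x
  r-surjective x p with subterm-surjective l x p
  ... | n , n≈ with leastWitness (λ m → subterm l m ≈o x) n n≈
  ...   | m , m≈ , least = mkV m c , m≈
    where
    c : Canonical m
    c k k<m (a , b) = least k k<m (≤-trans a (proj₁ m≈) , ≤-trans (proj₂ m≈) b)

  e : ℕ → V
  e n with em {Canonical n}
  ... | yes c = mkV n c
  ... | no  _ = mkV 0 λ m ()

  surj : ∀ v → ∃ λ n → e n ≡ v
  surj v = proj₁ v , eq′
    where
    eq′ : e (proj₁ v) ≡ v
    eq′ with em {Canonical (proj₁ v)}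
    ... | yes c = V-≡ refl
    ... | no ¬c = ⊥-elim (¬c (canonical v))

-- The index order: nodes of the full binary tree in in-order (left subtree < node < right subtree)

Node : Set
Node = List Bool

infix 4 _<ᴵ_
_<ᴵ_ : Node → Node → Set
[]          <ᴵ []          = ⊥
[]          <ᴵ (true ∷ _)  = ⊤
[]          <ᴵ (false ∷ _) = ⊥
(true ∷ _)  <ᴵ []          = ⊥
(false ∷ _) <ᴵ []          = ⊤
(false ∷ u) <ᴵ (true ∷ v)  = ⊤
(true ∷ u)  <ᴵ (false ∷ v) = ⊥
(false ∷ u) <ᴵ (false ∷ v) = u <ᴵ v
(true ∷ u)  <ᴵ (true ∷ v)  = u <ᴵ v

<ᴵ-irrefl : ∀ u → ¬ u <ᴵ u
<ᴵ-irrefl (true ∷ u)  p = <ᴵ-irrefl u p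
<ᴵ-irrefl (false ∷ u) p = <ᴵ-irrefl u p

<ᴵ-trans : ∀ u v w → u <ᴵ v → v <ᴵ w → u <ᴵ w
<ᴵ-trans []          (true ∷ v)  (true ∷ w)  p q = tt
<ᴵ-trans (false ∷ u) []          (true ∷ w)  p q = tt
<ᴵ-trans (false ∷ u) (false ∷ v) []          p q = tt
<ᴵ-trans (false ∷ u) (true ∷ v)  (true ∷ w)  p q = tt
<ᴵ-trans (false ∷ u) (false ∷ v) (true ∷ w)  p q = tt
<ᴵ-trans (false ∷ u) (false ∷ v) (false ∷ w) p q = <ᴵ-trans u v w p q
<ᴵ-trans (true ∷ u)  (true ∷ v)  (true ∷ w)  p q = <ᴵ-trans u v w p q

cmpᴵ : ∀ u v → Tri (u <ᴵ v) (u ≡ v) (v <ᴵ u)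
cmpᴵ []          []          = tri≈ (λ ()) refl (λ ())
cmpᴵ []          (true ∷ v)  = tri< tt (λ ()) (λ ())
cmpᴵ []          (false ∷ v) = tri> (λ ()) (λ ()) tt
cmpᴵ (true ∷ u)  []          = tri> (λ ()) (λ ()) tt
cmpᴵ (false ∷ u) []          = tri< tt (λ ()) (λ ())
cmpᴵ (false ∷ u) (true ∷ v)  = tri< tt (λ ()) (λ ())
cmpᴵ (true ∷ u)  (false ∷ v) = tri> (λ ()) (λ ()) tt
cmpᴵ (true ∷ u)  (true ∷ v)  with cmpᴵ u v
... | tri< a b c    = tri< a (λ { refl → b refl }) c
... | tri≈ a refl c = tri≈ a refl c
... | tri> a b c    = tri> a (λ { refl → b refl }) c
cmpᴵ (false ∷ u) (false ∷ v) with cmpᴵ u v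
... | tri< a b c    = tri< a (λ { refl → b refl }) c
... | tri≈ a refl c = tri≈ a refl c
... | tri> a b c    = tri> a (λ { refl → b refl }) c

left-< : ∀ u x → u List.++ false ∷ x <ᴵ u
left-< []          x = tt
left-< (true ∷ u)  x = left-< u x
left-< (false ∷ u) x = left-< u x

right-> : ∀ u x → u <ᴵ u List.++ true ∷ x
right-> []          x = tt
right-> (true ∷ u)  x = right-> u x
right-> (false ∷ u) x = right-> u x

-- A single node in the gap would give density but not a shuffle: nodes of every exponent are needed
-- there, and these are found in any full subtree.
subtree-between : ∀ u v → u <ᴵ v → Σ Node λ w → ∀ x → (u <ᴵ w List.++ x) × (w List.++ x <ᴵ v)
subtree-between []          (true ∷ v)  p = true ∷ v List.++ false ∷ [] ,
  λ x → tt , subst (_<ᴵ v) (sym (++-assoc v _ x)) (left-< v x)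
subtree-between (false ∷ u) []          p = false ∷ u List.++ true ∷ [] ,
  λ x → subst (u <ᴵ_) (sym (++-assoc u _ x)) (right-> u x) , tt
subtree-between (false ∷ u) (true ∷ v)  p = false ∷ u List.++ true ∷ [] ,
  λ x → subst (u <ᴵ_) (sym (++-assoc u _ x)) (right-> u x) , tt
subtree-between (false ∷ u) (false ∷ v) p = let (w , h) = subtree-between u v p in false ∷ w , h
subtree-between (true ∷ u)  (true ∷ v)  p = let (w , h) = subtree-between u v p in true ∷ w , h

_≻lo_ : Node → Maybe Node → Set
q ≻lo nothing = ⊤
q ≻lo just u  = u <ᴵ q

_≺hi_ : Node → Maybe Node → Set
q ≺hi nothing = ⊤
q ≺hi just v  = q <ᴵ v

Gap : Maybe Node → Maybe Node → Set
Gap (just u) (just v) = u <ᴵ v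
Gap _        _        = ⊤

subtree-in-gap : ∀ lo hi → Gap lo hi → Σ Node λ w → ∀ x → ((w List.++ x) ≻lo lo) × ((w List.++ x) ≺hi hi)
subtree-in-gap nothing  nothing  g = [] , λ x → tt , tt
subtree-in-gap nothing  (just v) g = v List.++ false ∷ [] , λ x → tt , subst (_<ᴵ v) (sym (++-assoc v _ x)) (left-< v x)
subtree-in-gap (just u) nothing  g = u List.++ true ∷ [] , λ x → subst (u <ᴵ_) (sym (++-assoc u _ x)) (right-> u x) , tt
subtree-in-gap (just u) (just v) g = subtree-between u v g

-- Exponents are read off the number of final steps to the right, so each of them occurs in every subtree.
trailing : ℕ → Node → ℕ
trailing n []          = n
trailing n (true ∷ u)  = trailing (suc n) u
trailing n (false ∷ u) = trailing 0 u

trailing-rights : ∀ n k → trailing n (replicate k true) ≡ k + n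
trailing-rights n zero    = refl
trailing-rights n (suc k) = trans (trailing-rights (suc n) k) (ℕₚ.+-suc k n)

trailing-++ : ∀ n w u → trailing n (w List.++ false ∷ u) ≡ trailing 0 u
trailing-++ n []          u = refl
trailing-++ n (true ∷ w)  u = trailing-++ (suc n) w u
trailing-++ n (false ∷ w) u = trailing-++ 0 w u

-- Equal atomic types, bounds for nodes, and invariance under isomorphism

infix 1 _⇔′_
_⇔′_ : Set → Set → Set
P ⇔′ Q = (P → Q) × (Q → P)

++-rel : ∀ {X Y : Set} (P : X → Y → Set) {k n} {σ : Vector X k} {σ′ : Vector Y k} {ρ : Vector X n} {ρ′ : Vector Y n} →
         (∀ i → P (σ i) (σ′ i)) → (∀ i → P (ρ i) (ρ′ i)) → ∀ i → P ((σ ++ ρ) i) ((σ′ ++ ρ′) i)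
++-rel P {k} h h′ i with splitAt k i
... | inj₁ j = h j
... | inj₂ j = h′ j

SameAtoms : (M N : Structure) → ∀ {n} → Vector (Carrier M) n → Vector (Carrier N) n → Set
SameAtoms M N ρ ρ′ = ∀ i j → (_≺_ M (ρ i) (ρ j) ⇔′ _≺_ N (ρ′ i) (ρ′ j)) × ((ρ i ≡ ρ j) ⇔′ (ρ′ i ≡ ρ′ j))

satQF-⇔ : ∀ M N {n} {ρ : Vector (Carrier M) n} {ρ′ : Vector (Carrier N) n} → SameAtoms M N ρ ρ′ →
          ∀ φ → satQF M φ ρ ⇔′ satQF N φ ρ′
satQF-⇔ M N h (lt i j)  = proj₁ (h i j)
satQF-⇔ M N h (eq i j)  = proj₂ (h i j)
satQF-⇔ M N h tt        = id , id
satQF-⇔ M N h ff        = id , id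
satQF-⇔ M N h (neg φ)   = let (f , g) = satQF-⇔ M N h φ in (λ k → k ∘ g) , (λ k → k ∘ f)
satQF-⇔ M N h (and φ ψ) = let (f , g) = satQF-⇔ M N h φ ; (f′ , g′) = satQF-⇔ M N h ψ in
  (λ { (a , b) → f a , f′ b }) , (λ { (a , b) → g a , g′ b })
satQF-⇔ M N h (or φ ψ)  = let (f , g) = satQF-⇔ M N h φ ; (f′ , g′) = satQF-⇔ M N h ψ in
  (λ { (inj₁ a) → inj₁ (f a) ; (inj₂ b) → inj₂ (f′ b) }) , (λ { (inj₁ a) → inj₁ (g a) ; (inj₂ b) → inj₂ (g′ b) })

++-mono-<ᴵ : ∀ p {u v} → u <ᴵ v → p List.++ u <ᴵ p List.++ v
++-mono-<ᴵ []          q = q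
++-mono-<ᴵ (true ∷ p)  q = ++-mono-<ᴵ p q
++-mono-<ᴵ (false ∷ p) q = ++-mono-<ᴵ p q

short-<-rights : ∀ w N x → length w ℕ.< N → w <ᴵ replicate N true List.++ x
short-<-rights []          (suc N) x p       = tt
short-<-rights (false ∷ w) (suc N) x p       = tt
short-<-rights (true ∷ w)  (suc N) x (s≤s p) = short-<-rights w N x p

lefts-<-short : ∀ w N x → length w ℕ.< N → replicate N false List.++ x <ᴵ w
lefts-<-short []          (suc N) x p       = tt
lefts-<-short (true ∷ w)  (suc N) x p       = tt
lefts-<-short (false ∷ w) (suc N) x (s≤s p) = lefts-<-short w N x p

finite-bound : ∀ {n} (f : Fin n → ℕ) → Σ ℕ λ N → ∀ i → f i ℕ.< N
finite-bound {zero}  f = 0 , λ ()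
finite-bound {suc n} f with finite-bound (f ∘ suc)
... | N , h = suc (f zero) + N , λ { zero → ℕₚ.m≤m+n _ N ; (suc i) → ℕₚ.≤-trans (h i) (ℕₚ.m≤n+m N _) }

≅-refl : ∀ M → M ≅ M
≅-refl M = mk↔ₛ′ id id (λ _ → refl) (λ _ → refl) , λ x y → id , id

module Isomorphic (M N : Structure) (M≅N : M ≅ N) where

  f : Carrier M → Carrier N
  f = Inverse.to (proj₁ M≅N)

  g : Carrier N → Carrier M
  g = Inverse.from (proj₁ M≅N)

  f∘g : ∀ y → f (g y) ≡ y
  f∘g = Inverse.strictlyInverseˡ (proj₁ M≅N)

  g∘f : ∀ x → g (f x) ≡ x
  g∘f = Inverse.strictlyInverseʳ (proj₁ M≅N)

  Along : ∀ {n} → Vector (Carrier M) n → Vector (Carrier N) n → Set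
  Along ρ ρ′ = ∀ i → f (ρ i) ≡ ρ′ i

  Along⇒SameAtoms : ∀ {n} {ρ : Vector (Carrier M) n} {ρ′} → Along ρ ρ′ → SameAtoms M N ρ ρ′
  Along⇒SameAtoms {ρ = ρ} h i j =
    ((λ a → subst₂ (_≺_ N) (h i) (h j) (proj₁ (proj₂ M≅N (ρ i) (ρ j)) a)) ,
     (λ a → proj₂ (proj₂ M≅N (ρ i) (ρ j)) (subst₂ (_≺_ N) (sym (h i)) (sym (h j)) a))) ,
    ((λ p → trans (sym (h i)) (trans (cong f p) (h j))) ,
     (λ p → trans (sym (g∘f (ρ i))) (trans (cong g (trans (h i) (trans p (sym (h j))))) (g∘f (ρ j)))))

  Along-++ : ∀ {n k} {ρ : Vector (Carrier M) n} {ρ′} → Along ρ ρ′ → (σ : Vector (Carrier M) k) → Along (σ ++ ρ) (f ∘ σ ++ ρ′)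
  Along-++ h σ = ++-rel (λ x y → f x ≡ y) (λ _ → refl) h

  Along-++ˡ : ∀ {n k} {ρ : Vector (Carrier M) n} {ρ′} → Along ρ ρ′ → (σ : Vector (Carrier N) k) → Along (g ∘ σ ++ ρ) (σ ++ ρ′)
  Along-++ˡ h σ = ++-rel (λ x y → f x ≡ y) (λ i → f∘g (σ i)) h

  mutual
    satΣ-≅ : ∀ {n α} (φ : SigmaF α n) ρ ρ′ → Along ρ ρ′ → satΣ M φ ρ ⇔′ satΣ N φ ρ′
    satΣ-≅ (qfΣ _ φ)   ρ ρ′ h = satQF-⇔ M N (Along⇒SameAtoms h) φ
    satΣ-≅ (bigOr fam) ρ ρ′ h = (λ { (i , s) → i , proj₁ (satEx-≅ (fam i) ρ ρ′ h) s }) ,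
                                (λ { (i , s) → i , proj₂ (satEx-≅ (fam i) ρ ρ′ h) s })

    satEx-≅ : ∀ {n α} (φ : Maybe (ExPart α n)) ρ ρ′ → Along ρ ρ′ → satMEx M φ ρ ⇔′ satMEx N φ ρ′
    satEx-≅ nothing ρ ρ′ h = id , id
    satEx-≅ (just (ex β _ k π)) ρ ρ′ h =
      (λ { (σ , s) → f ∘ σ , proj₁ (satΠ-≅ π (σ ++ ρ) (f ∘ σ ++ ρ′) (Along-++ h σ)) s }) ,
      (λ { (σ , s) → g ∘ σ , proj₂ (satΠ-≅ π (g ∘ σ ++ ρ) (σ ++ ρ′) (Along-++ˡ h σ)) s })

    satΠ-≅ : ∀ {n α} (φ : PiF α n) ρ ρ′ → Along ρ ρ′ → satΠ M φ ρ ⇔′ satΠ N φ ρ′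
    satΠ-≅ (qfΠ _ φ)    ρ ρ′ h = satQF-⇔ M N (Along⇒SameAtoms h) φ
    satΠ-≅ (bigAnd fam) ρ ρ′ h = (λ s i → proj₁ (satAll-≅ (fam i) ρ ρ′ h) (s i)) ,
                                 (λ s i → proj₂ (satAll-≅ (fam i) ρ ρ′ h) (s i))

    satAll-≅ : ∀ {n α} (φ : Maybe (AllPart α n)) ρ ρ′ → Along ρ ρ′ → satMAll M φ ρ ⇔′ satMAll N φ ρ′
    satAll-≅ nothing ρ ρ′ h = id , id
    satAll-≅ (just (all β _ k ψ)) ρ ρ′ h =
      (λ s σ → proj₁ (satΣ-≅ ψ (g ∘ σ ++ ρ) (σ ++ ρ′) (Along-++ˡ h σ)) (s (g ∘ σ))) ,
      (λ s σ → proj₂ (satΣ-≅ ψ (σ ++ ρ) (f ∘ σ ++ ρ′) (Along-++ h σ)) (s (f ∘ σ)))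

-- Unstratified formulas and their translation

-- Infinitary formulas without the stratification; tr places φ in Σ^in at level rank φ.
data Fm (n : ℕ) : Set where
  atom : QF n → Fm n
  neg  : Fm n → Fm n
  con  : (ℕ → Fm n) → Fm n
  exi  : Fm (suc n) → Fm n

Sat : (M : Structure) {n : ℕ} → Fm n → Vector (Carrier M) n → Set
Sat M (atom q) ρ = satQF M q ρ
Sat M (neg φ)  ρ = ¬ Sat M φ ρ
Sat M (con f)  ρ = ∀ i → Sat M (f i) ρ
Sat M (exi φ)  ρ = Σ (Carrier M) λ x → Sat M φ (x Vector.∷ ρ)

-- A Σ formula has only disjunctions and existential quantifiers in front of a Π formula. A
-- conjunction, and likewise a Σ matrix under a quantifier, must therefore be wrapped in a Π formula
-- one level up and in a Σ formula above that, which costs two levels. Such finite losses are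
-- harmless below a limit.
rank : ∀ {n} → Fm n → Ord
rank (atom q) = zero
rank (neg φ)  = suc (rank φ)
rank (con f)  = suc (suc (lim λ i → rank (f i)))
rank (exi φ)  = suc (suc (rank φ))

module _ (M N : Structure) (M≅N : M ≅ N) where
  open Isomorphic M N M≅N

  Sat-≅ : ∀ {n} (φ : Fm n) ρ ρ′ → Along ρ ρ′ → Sat M φ ρ ⇔′ Sat N φ ρ′
  Sat-≅ (atom q) ρ ρ′ h = satQF-⇔ M N (Along⇒SameAtoms h) q
  Sat-≅ (neg φ)  ρ ρ′ h = let (a , b) = Sat-≅ φ ρ ρ′ h in (λ k → k ∘ b) , (λ k → k ∘ a)
  Sat-≅ (con c)  ρ ρ′ h = (λ s i → proj₁ (Sat-≅ (c i) ρ ρ′ h) (s i)) , (λ s i → proj₂ (Sat-≅ (c i) ρ ρ′ h) (s i))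
  Sat-≅ (exi φ)  ρ ρ′ h =
    (λ { (x , s) → f x , proj₁ (Sat-≅ φ (x Vector.∷ ρ) (f x Vector.∷ ρ′) λ { zero → refl ; (suc i) → h i }) s }) ,
    (λ { (y , s) → g y , proj₂ (Sat-≅ φ (g y Vector.∷ ρ) (y Vector.∷ ρ′) λ { zero → f∘g y ; (suc i) → h i }) s })

Sat-ext : ∀ {M n} (φ : Fm n) {ρ ρ′ : Vector (Carrier M) n} → (∀ i → ρ i ≡ ρ′ i) → Sat M φ ρ ⇔′ Sat M φ ρ′
Sat-ext {M} φ h = Sat-≅ M M (≅-refl M) φ _ _ h

lift : ∀ {n m} → (Fin n → Fin m) → Fin (suc n) → Fin (suc m)
lift r zero    = zero
lift r (suc i) = suc (r i)

renQF : ∀ {n m} → (Fin n → Fin m) → QF n → QF m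
renQF r (lt i j)  = lt (r i) (r j)
renQF r (eq i j)  = eq (r i) (r j)
renQF r tt        = tt
renQF r ff        = ff
renQF r (neg φ)   = neg (renQF r φ)
renQF r (and φ ψ) = and (renQF r φ) (renQF r ψ)
renQF r (or φ ψ)  = or (renQF r φ) (renQF r ψ)

ren : ∀ {n m} → (Fin n → Fin m) → Fm n → Fm m
ren r (atom q) = atom (renQF r q)
ren r (neg φ)  = neg (ren r φ)
ren r (con f)  = con λ i → ren r (f i)
ren r (exi φ)  = exi (ren (lift r) φ)

satQF-ren : ∀ {M n m} (r : Fin n → Fin m) φ {ρ : Vector (Carrier M) m} → satQF M (renQF r φ) ρ ≡ satQF M φ (ρ ∘ r)
satQF-ren r (lt i j)  = refl
satQF-ren r (eq i j)  = refl
satQF-ren r tt        = refl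
satQF-ren r ff        = refl
satQF-ren r (neg φ)   = cong ¬_ (satQF-ren r φ)
satQF-ren r (and φ ψ) = cong₂ _×_ (satQF-ren r φ) (satQF-ren r ψ)
satQF-ren r (or φ ψ)  = cong₂ _⊎_ (satQF-ren r φ) (satQF-ren r ψ)

Sat-ren : ∀ {M n m} (r : Fin n → Fin m) φ {ρ : Vector (Carrier M) m} → Sat M (ren r φ) ρ ⇔′ Sat M φ (ρ ∘ r)
Sat-ren {M} r (atom q) {ρ} = subst id (satQF-ren {M} r q) , subst id (sym (satQF-ren {M} r q))
Sat-ren r (neg φ) = let (a , b) = Sat-ren r φ in (λ k → k ∘ b) , (λ k → k ∘ a)
Sat-ren r (con f) = (λ s i → proj₁ (Sat-ren r (f i)) (s i)) , (λ s i → proj₂ (Sat-ren r (f i)) (s i))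
Sat-ren {M} r (exi φ) {ρ} =
  (λ { (x , s) → x , proj₁ (Sat-ext {M} φ λ { zero → refl ; (suc i) → refl }) (proj₁ (Sat-ren (lift r) φ) s) }) ,
  (λ { (x , s) → x , proj₂ (Sat-ren (lift r) φ) (proj₁ (Sat-ext {M} φ λ { zero → refl ; (suc i) → refl }) s) })

rank-ren : ∀ {n m} (r : Fin n → Fin m) φ → rank (ren r φ) ≤o rank φ
rank-ren r (atom q) = ≤-refl
rank-ren r (neg φ)  = ≤-suc-mono (rank-ren r φ)
rank-ren r (con f)  = ≤-suc-mono (≤-suc-mono (≤-limiting λ k → ≤-cocone k (rank-ren r (f k))))
rank-ren r (exi φ)  = ≤-suc-mono (≤-suc-mono (rank-ren (lift r) φ))

two : {X : Set} → X → X → ℕ → X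
two x y zero    = x
two x y (suc _) = y

infixr 6 _∧_
_∧_ : ∀ {n} → Fm n → Fm n → Fm n
φ ∧ ψ = con (two φ ψ)

rank-∧ : ∀ {n x} {φ ψ : Fm n} → rank φ ≤o x → rank ψ ≤o x → rank (φ ∧ ψ) ≤o suc (suc x)
rank-∧ p q = ≤-suc-mono (≤-suc-mono (≤-limiting λ { zero → p ; (suc _) → q }))

⋀ : ∀ {k n} → (Fin k → Fm n) → Fm n
⋀ {zero}  f = atom tt
⋀ {suc k} f = f zero ∧ ⋀ (f ∘ suc)

Sat-⋀ : ∀ {M k n} (f : Fin k → Fm n) {ρ : Vector (Carrier M) n} → Sat M (⋀ f) ρ ⇔′ (∀ i → Sat M (f i) ρ)
Sat-⋀ {k = zero}  f = (λ _ ()) , λ _ → tt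
Sat-⋀ {k = suc k} f =
  (λ s → λ { zero → s 0 ; (suc i) → proj₁ (Sat-⋀ (f ∘ suc)) (s 1) i }) ,
  (λ s → λ { zero → s zero ; (suc _) → proj₂ (Sat-⋀ (f ∘ suc)) (s ∘ suc) })

mutual
  negΣ : ∀ {α n} → SigmaF α n → PiF α n
  negΣ (qfΣ p φ)   = qfΠ p (neg φ)
  negΣ (bigOr fam) = bigAnd λ i → negEx (fam i)

  negEx : ∀ {α n} → Maybe (ExPart α n) → Maybe (AllPart α n)
  negEx nothing              = nothing
  negEx (just (ex β p k π))  = just (all β p k (negΠ π))

  negΠ : ∀ {α n} → PiF α n → SigmaF α n
  negΠ (qfΠ p φ)    = qfΣ p (neg φ)
  negΠ (bigAnd fam) = bigOr λ i → negAll (fam i)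

  negAll : ∀ {α n} → Maybe (AllPart α n) → Maybe (ExPart α n)
  negAll nothing              = nothing
  negAll (just (all β p k ψ)) = just (ex β p k (negΣ ψ))

tr : ∀ {n} (φ : Fm n) → SigmaF (rank φ) n
tr (atom q) = qfΣ refl q
tr (neg φ)  = bigOr λ _ → just (ex _ ≤-refl 0 (negΣ (tr φ)))
tr (con f)  = bigOr λ _ → just (ex _ ≤-refl 0
                (bigAnd λ i → just (all _ (≤-suc-mono (≤-cocone i ≤-refl)) 0 (tr (f i)))))
tr (exi φ)  = bigOr λ _ → just (ex _ ≤-refl 1 (bigAnd λ i → just (all _ ≤-refl 0 (tr φ))))

module Translation (em : ExcludedMiddle 0ℓ) where
  open Classical em

  mutual
    sat-negΣ : ∀ {M α n} (φ : SigmaF α n) (ρ : Vector (Carrier M) n) → satΠ M (negΣ φ) ρ ⇔′ (¬ satΣ M φ ρ)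
    sat-negΣ (qfΣ p φ)   ρ = id , id
    sat-negΣ (bigOr fam) ρ = (λ { s (i , t) → proj₁ (sat-negEx (fam i) ρ) (s i) t }) ,
                             (λ s i → proj₂ (sat-negEx (fam i) ρ) λ t → s (i , t))

    sat-negEx : ∀ {M α n} (φ : Maybe (ExPart α n)) (ρ : Vector (Carrier M) n) → satMAll M (negEx φ) ρ ⇔′ (¬ satMEx M φ ρ)
    sat-negEx nothing ρ = (λ _ ()) , (λ _ → tt)
    sat-negEx (just (ex β p k π)) ρ = (λ { s (σ , t) → proj₁ (sat-negΠ π (σ ++ ρ)) (s σ) t }) ,
                                      (λ s σ → proj₂ (sat-negΠ π (σ ++ ρ)) λ t → s (σ , t))

    sat-negΠ : ∀ {M α n} (φ : PiF α n) (ρ : Vector (Carrier M) n) → satΣ M (negΠ φ) ρ ⇔′ (¬ satΠ M φ ρ)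
    sat-negΠ (qfΠ p φ)    ρ = id , id
    sat-negΠ (bigAnd fam) ρ =
      (λ { (i , s) t → proj₁ (sat-negAll (fam i) ρ) s (t i) }) ,
      (λ s → let (i , t) = ¬∀⇒∃¬ s in i , proj₂ (sat-negAll (fam i) ρ) t)

    sat-negAll : ∀ {M α n} (φ : Maybe (AllPart α n)) (ρ : Vector (Carrier M) n) → satMEx M (negAll φ) ρ ⇔′ (¬ satMAll M φ ρ)
    sat-negAll nothing ρ = (λ ()) , (λ s → s tt)
    sat-negAll (just (all β p k ψ)) ρ =
      (λ { (σ , s) t → proj₁ (sat-negΣ ψ (σ ++ ρ)) s (t σ) }) ,
      (λ s → let (σ , t) = ¬∀⇒∃¬ s in σ , proj₂ (sat-negΣ ψ (σ ++ ρ)) t)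

  sat-tr : ∀ {M n} (φ : Fm n) (ρ : Vector (Carrier M) n) → satΣ M (tr φ) ρ ⇔′ Sat M φ ρ
  sat-tr (atom q) ρ = id , id
  sat-tr (neg φ) ρ =
    (λ { (_ , σ , s) t → proj₁ (sat-negΣ (tr φ) ρ) s (proj₂ (sat-tr φ ρ) t) }) ,
    (λ s → 0 , ε , proj₂ (sat-negΣ (tr φ) ρ) λ t → s (proj₁ (sat-tr φ ρ) t))
  sat-tr (con f) ρ =
    (λ { (_ , σ , s) i → proj₁ (sat-tr (f i) ρ) (s i ε) }) ,
    (λ s → 0 , ε , λ i _ → proj₂ (sat-tr (f i) ρ) (s i))
  sat-tr {M} (exi φ) ρ =
    (λ { (_ , σ , s) → σ zero ,
         proj₁ (Sat-ext φ λ { zero → refl ; (suc i) → refl }) (proj₁ (sat-tr φ (σ ++ ρ)) (s 0 ε)) }) ,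
    (λ { (x , s) → 0 , (λ _ → x) , λ _ _ → proj₂ (sat-tr φ ((λ _ → x) ++ ρ))
         (proj₁ (Sat-ext φ λ { zero → refl ; (suc i) → refl }) s) })

pick : ∀ {n} → Fin n → Fin n → Fin 2 → Fin n
pick i j zero    = i
pick i j (suc _) = j

-- Isomorphism of countable structures from a back-and-forth relation

module BackAndForth (A M : Structure) (enumA : Enumeration (Carrier A)) (enumM : Enumeration (Carrier M))
  (R : List (Carrier A × Carrier M) → Set) (R[] : R [])
  (forth : ∀ {L} → R L → ∀ a → Σ (Carrier M) λ m → R ((a , m) ∷ L))
  (back : ∀ {L} → R L → ∀ m → Σ (Carrier A) λ a → R ((a , m) ∷ L))
  (atoms : ∀ {L} → R L → ∀ {a m a′ m′} → (a , m) ∈ L → (a′ , m′) ∈ L →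
           (_≺_ A a a′ ⇔′ _≺_ M m m′) × ((a ≡ a′) ⇔′ (m ≡ m′))) where

  stage : ℕ → Σ (List (Carrier A × Carrier M)) R
  stage zero    = [] , R[]
  stage (suc n) = _ , proj₂ (back (proj₂ (forth (proj₂ (stage n)) (proj₁ enumA n))) (proj₁ enumM n))

  stage-+ : ∀ k {n p} → p ∈ proj₁ (stage n) → p ∈ proj₁ (stage (k + n))
  stage-+ zero    m = m
  stage-+ (suc k) m = there (there (stage-+ k m))

  Met : Carrier A → Carrier M → Set
  Met a m = Σ ℕ λ n → (a , m) ∈ proj₁ (stage n)

  image : ∀ a → Σ (Carrier M) (Met a)
  image a with proj₂ enumA a
  ... | n , refl = _ , suc n , there (here refl)

  preimage : ∀ m → Σ (Carrier A) λ a → Met a m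
  preimage m with proj₂ enumM m
  ... | n , refl = _ , suc n , here refl

  coherent : ∀ {a m a′ m′} → Met a m → Met a′ m′ →
             (_≺_ A a a′ ⇔′ _≺_ M m m′) × ((a ≡ a′) ⇔′ (m ≡ m′))
  -- Stages only grow, so both pairs are present at stage `n + n′`.
  coherent {a} {m} (n , p) (n′ , q) = atoms (proj₂ (stage (n + n′)))
    (subst (λ k → (a , m) ∈ proj₁ (stage k)) (ℕₚ.+-comm n′ n) (stage-+ n′ p)) (stage-+ n q)

  isomorphism : M ≅ A
  isomorphism =
    mk↔ₛ′ (proj₁ ∘ preimage) (proj₁ ∘ image)
      (λ a → proj₂ (proj₂ (coherent (proj₂ (preimage (proj₁ (image a)))) (proj₂ (image a)))) refl)
      (λ m → proj₁ (proj₂ (coherent (proj₂ (image (proj₁ (preimage m)))) (proj₂ (preimage m)))) refl) ,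
    λ x y → swap (proj₁ (coherent (proj₂ (preimage x)) (proj₂ (preimage y))))

++-tail : ∀ {X : Set} {k n} (σ : Vector X (suc k)) (ρ : Vector X n) i → (σ ++ ρ) (suc i) ≡ (σ ∘ suc ++ ρ) i
++-tail {k = k} σ ρ i with splitAt k i
... | inj₁ _ = refl
... | inj₂ _ = refl

shift₂ : ∀ {n} → Fin n → Fin (suc (suc n))
shift₂ i = suc (suc i)

++-last : ∀ {X : Set} {k} (τ : Vector X k) (ρ : Vector X 1) → (τ ++ ρ) (k ↑ʳ zero) ≡ ρ zero
++-last {k = k} τ ρ rewrite splitAt-↑ʳ k 1 zero = refl

module Construction (em : ExcludedMiddle 0ℓ) (l : Ord) (isLimit : IsLimit l) (E : Exponents l) where
  open Classical em
  open Translation em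
  open Exponents E

  -- Comparison of exponents

  infix 4 _<ᵥ_ _≮ᵥ_
  _<ᵥ_ _≮ᵥ_ : V → V → Set
  v <ᵥ w = r v <o r w
  v ≮ᵥ w = ¬ v <ᵥ w

  cmpᵥ : ∀ v w → Tri (v <ᵥ w) (v ≡ w) (w <ᵥ v)
  cmpᵥ v w with ≤-or-> (r v) (r w) | ≤-or-> (r w) (r v)
  ... | inj₂ q | _      = tri> (λ p → <-irrefl (≤-trans p (<⇒≤ q))) (λ { refl → <-irrefl q }) q
  ... | inj₁ p | inj₂ q = tri< q (λ { refl → <-irrefl q }) (λ p′ → <-irrefl (≤-trans p′ p))
  ... | inj₁ p | inj₁ q = tri≈ (λ a → <-irrefl (≤-trans a q)) (r-injective v w (p , q))
                               (λ a → <-irrefl (≤-trans a p))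

  <ᵥ-trans : ∀ {u v w} → u <ᵥ v → v <ᵥ w → u <ᵥ w
  <ᵥ-trans p q = ≤-trans p (<⇒≤ q)

  <ᵥ-irrefl : ∀ {v} → v ≮ᵥ v
  <ᵥ-irrefl = <-irrefl

  ≤-<ᵥ : ∀ {u v w} → v ≮ᵥ u → v <ᵥ w → u <ᵥ w
  ≤-<ᵥ p q = ≤-trans (≤-suc-mono (≮⇒≥ p)) q

  <-≤ᵥ : ∀ {u v w} → u <ᵥ v → w ≮ᵥ v → u <ᵥ w
  <-≤ᵥ p q = ≤-trans p (≮⇒≥ q)

  ≮ᵥ-trans : ∀ {u v w} → u ≮ᵥ v → v ≮ᵥ w → u ≮ᵥ w
  ≮ᵥ-trans p q a = p (<-≤ᵥ a q)

  v₀ : V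
  v₀ = proj₁ (r-surjective zero ≤-zero)

  <top⇒<l : ∀ {v} → v <ᵥ top → r v <o l
  <top⇒<l {v} = subst (r v <o_) r-top

  <l⇒<top : ∀ {v} → r v <o l → v <ᵥ top
  <l⇒<top {v} = subst (r v <o_) (sym r-top)

  v₀<top : v₀ <ᵥ top
  v₀<top = <l⇒<top (≤-trans (≤-suc-mono (proj₁ (proj₂ (r-surjective zero ≤-zero)))) (proj₁ isLimit))

  top-maximal : ∀ {v} → top ≮ᵥ v
  top-maximal {v} p = <-irrefl (≤-trans (subst (_<o r v) r-top p) (rank-≤l v))

  next : ∀ {v} → v <ᵥ top → Σ V λ w → v <ᵥ w × w <ᵥ top
  next {v} p = w , proj₂ w≈ , <l⇒<top (≤-trans (≤-suc-mono (proj₁ w≈)) sv<l)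
    where
    sv<l = proj₂ isLimit _ (<top⇒<l p)
    w  = proj₁ (r-surjective (suc (r v)) (<⇒≤ sv<l))
    w≈ = proj₂ (r-surjective (suc (r v)) (<⇒≤ sv<l))

  -- Ordinals in Cantor normal form

  -- A list v₁ ≥ v₂ ≥ … stands for the ordinal ω^v₁ + ω^v₂ + … in Cantor normal form.

  CNF : Set
  CNF = List V

  -- These words are the ordinals below ω^(b+1); those satisfying `Below e` are the ordinals below
  -- ω^e, that is, the points of a block of exponent e.
  Desc : V → CNF → Set
  Desc b []      = ⊤
  Desc b (x ∷ c) = (b ≮ᵥ x) × Desc x c

  Below : V → CNF → Set
  Below e []      = ⊤
  Below e (x ∷ c) = (x <ᵥ e) × Desc x c

  Desc-weaken : ∀ {b b′} c → b′ ≮ᵥ b → Desc b c → Desc b′ c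
  Desc-weaken []      p q       = tt
  Desc-weaken (x ∷ c) p (q , s) = ≮ᵥ-trans p q , s

  Below⇒Desc : ∀ {e} c → Below e c → Desc e c
  Below⇒Desc []      p       = tt
  Below⇒Desc (x ∷ c) (p , q) = (λ a → <ᵥ-irrefl (<ᵥ-trans p a)) , q

  Below-weaken : ∀ {b b′} c → b′ <ᵥ b ⊎ b ≡ b′ → Below b′ c → Below b c
  Below-weaken []      p           q       = tt
  Below-weaken (x ∷ c) (inj₁ p)    (q , s) = <ᵥ-trans q p , s
  Below-weaken (x ∷ c) (inj₂ refl) q       = q

  Desc⇒Below : ∀ {x e} c → x <ᵥ e → Desc x c → Below e c
  Desc⇒Below []      p q       = tt
  Desc⇒Below (y ∷ c) p (q , s) = ≤-<ᵥ q p , s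

  infix 4 _<ᴸ_
  _<ᴸ_ : CNF → CNF → Set
  []      <ᴸ []      = ⊥
  []      <ᴸ (y ∷ d) = ⊤
  (x ∷ c) <ᴸ []      = ⊥
  (x ∷ c) <ᴸ (y ∷ d) = (x <ᵥ y) ⊎ ((x ≡ y) × (c <ᴸ d))

  <ᴸ-irrefl : ∀ c → ¬ c <ᴸ c
  <ᴸ-irrefl (x ∷ c) (inj₁ p)       = <ᵥ-irrefl p
  <ᴸ-irrefl (x ∷ c) (inj₂ (_ , p)) = <ᴸ-irrefl c p

  <ᴸ-trans : ∀ a b c → a <ᴸ b → b <ᴸ c → a <ᴸ c
  <ᴸ-trans []      (y ∷ b) (z ∷ c) p                 q                 = tt
  <ᴸ-trans (x ∷ a) (y ∷ b) (z ∷ c) (inj₁ p)          (inj₁ q)          = inj₁ (<ᵥ-trans p q)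
  <ᴸ-trans (x ∷ a) (y ∷ b) (z ∷ c) (inj₁ p)          (inj₂ (refl , q)) = inj₁ p
  <ᴸ-trans (x ∷ a) (y ∷ b) (z ∷ c) (inj₂ (refl , p)) (inj₁ q)          = inj₁ q
  <ᴸ-trans (x ∷ a) (y ∷ b) (z ∷ c) (inj₂ (refl , p)) (inj₂ (refl , q)) = inj₂ (refl , <ᴸ-trans a b c p q)

  cmpᴸ : ∀ c d → Tri (c <ᴸ d) (c ≡ d) (d <ᴸ c)
  cmpᴸ []      []      = tri≈ (λ ()) refl (λ ())
  cmpᴸ []      (y ∷ d) = tri< tt (λ ()) (λ ())
  cmpᴸ (x ∷ c) []      = tri> (λ ()) (λ ()) tt
  cmpᴸ (x ∷ c) (y ∷ d) with cmpᵥ x y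
  ... | tri< a ¬b ¬c = tri< (inj₁ a) (λ { refl → ¬b refl }) λ { (inj₁ q) → ¬c q ; (inj₂ (refl , _)) → ¬b refl }
  ... | tri> ¬a ¬b c = tri> (λ { (inj₁ q) → ¬a q ; (inj₂ (refl , _)) → ¬b refl }) (λ { refl → ¬b refl }) (inj₁ c)
  ... | tri≈ ¬a refl ¬c with cmpᴸ c d
  ...   | tri< a ¬b ¬d = tri< (inj₂ (refl , a)) (λ { refl → ¬b refl })
                              λ { (inj₁ q) → ¬c q ; (inj₂ (_ , q)) → ¬d q }
  ...   | tri≈ _ refl _ = tri≈ (<ᴸ-irrefl _) refl (<ᴸ-irrefl _)
  ...   | tri> ¬d ¬b a = tri> (λ { (inj₁ q) → ¬a q ; (inj₂ (_ , q)) → ¬d q }) (λ { refl → ¬b refl })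
                              (inj₂ (refl , a))

  -- Ordinal addition: ω^x is absorbed by a following larger ω^y.
  infixl 6 _⊕_
  _⊕_ : CNF → CNF → CNF
  c       ⊕ []      = c
  []      ⊕ (y ∷ t) = y ∷ t
  (x ∷ c) ⊕ (y ∷ t) with em {x <ᵥ y}
  ... | yes _ = y ∷ t
  ... | no  _ = x ∷ (c ⊕ (y ∷ t))

  ⊕-absorb : ∀ {x y} c t → x <ᵥ y → (x ∷ c) ⊕ (y ∷ t) ≡ y ∷ t
  ⊕-absorb {x} {y} c t p with em {x <ᵥ y}
  ... | yes _ = refl
  ... | no ¬p = ⊥-elim (¬p p)

  ⊕-keep : ∀ {x y} c t → x ≮ᵥ y → (x ∷ c) ⊕ (y ∷ t) ≡ x ∷ (c ⊕ (y ∷ t))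
  ⊕-keep {x} {y} c t ¬p with em {x <ᵥ y}
  ... | yes p = ⊥-elim (¬p p)
  ... | no _  = refl

  ⊕-identityˡ : ∀ t → [] ⊕ t ≡ t
  ⊕-identityˡ []      = refl
  ⊕-identityˡ (_ ∷ _) = refl

  ⊕-keep′ : ∀ {x} c t → Desc x t → (x ∷ c) ⊕ t ≡ x ∷ (c ⊕ t)
  ⊕-keep′ c []      p       = refl
  ⊕-keep′ c (y ∷ t) (p , _) = ⊕-keep c t p

  ⊕-Desc : ∀ {b} c t → Desc b c → Desc b t → Desc b (c ⊕ t)
  ⊕-Desc c       []      p       q = p
  ⊕-Desc []      (y ∷ t) p       q = q
  ⊕-Desc (x ∷ c) (y ∷ t) (p , s) q with em {x <ᵥ y}
  ... | yes _ = q
  ... | no ¬a = p , ⊕-Desc c (y ∷ t) s (¬a , proj₂ q)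

  ⊕-Below : ∀ {e} c t → Below e c → Below e t → Below e (c ⊕ t)
  ⊕-Below c       []      p       q = p
  ⊕-Below []      (y ∷ t) p       q = q
  ⊕-Below (x ∷ c) (y ∷ t) (p , s) q with em {x <ᵥ y}
  ... | yes _ = q
  ... | no ¬a = p , ⊕-Desc c (y ∷ t) s (¬a , proj₂ q)

  ⊕-Allʳ : ∀ {P : V → Set} c t → All P (c ⊕ t) → All P t
  ⊕-Allʳ c       []      p = []
  ⊕-Allʳ []      (y ∷ t) p = p
  ⊕-Allʳ (x ∷ c) (y ∷ t) p with em {x <ᵥ y} | p
  ... | yes _ | q     = q
  ... | no _  | _ ∷ q = ⊕-Allʳ c (y ∷ t) q

  ⊕-single-All : ∀ {γ b} c → Desc b c → All (_≮ᵥ γ) (c ⊕ (γ ∷ []))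
  ⊕-single-All []      p = <ᵥ-irrefl ∷ []
  ⊕-single-All {γ} (x ∷ c) (_ , s) with em {x <ᵥ γ}
  ... | yes _ = <ᵥ-irrefl ∷ []
  ... | no ¬a = ¬a ∷ ⊕-single-All c s

  ⊕-mono : ∀ p u t → u <ᴸ t → p ⊕ u <ᴸ p ⊕ t
  ⊕-mono []      []      (b ∷ t) q = tt
  ⊕-mono []      (a ∷ u) (b ∷ t) q = q
  ⊕-mono (x ∷ p) []      (b ∷ t) q with em {x <ᵥ b}
  ... | yes a = inj₁ a
  ... | no _  = inj₂ (refl , ⊕-mono p [] (b ∷ t) q)
  ⊕-mono (x ∷ p) (a ∷ u) (b ∷ t) q with em {x <ᵥ a} | em {x <ᵥ b}
  ... | yes _  | yes _  = q
  ... | no _   | yes xb = inj₁ xb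
  ... | no _   | no _   = inj₂ (refl , ⊕-mono p (a ∷ u) (b ∷ t) q)
  ... | yes xa | no ¬xb with q
  ...   | inj₁ ab         = ⊥-elim (¬xb (<ᵥ-trans xa ab))
  ...   | inj₂ (refl , _) = ⊥-elim (¬xb xa)

  ⊕-cancel-< : ∀ p u t → p ⊕ u <ᴸ p ⊕ t → u <ᴸ t
  ⊕-cancel-< p u t q with cmpᴸ u t
  ... | tri< a _ _    = a
  ... | tri≈ _ refl _ = ⊥-elim (<ᴸ-irrefl _ q)
  ... | tri> _ _ a    = ⊥-elim (<ᴸ-irrefl _ (<ᴸ-trans _ _ _ q (⊕-mono p t u a)))

  -- Left subtraction. Past the common prefix, the first larger entry of c′ absorbs all that is left
  -- of c, so the rest of c′ is the difference.
  subtract : ∀ {b} c c′ → c <ᴸ c′ → Desc b c′ → Σ CNF λ t → ([] <ᴸ t) × Desc b t × (c′ ≡ c ⊕ t)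
  subtract []      (y ∷ c′) p        d = y ∷ c′ , tt , d , refl
  subtract (x ∷ c) (y ∷ c′) (inj₁ p) d = y ∷ c′ , tt , d , sym (⊕-absorb c c′ p)
  subtract (x ∷ c) (y ∷ c′) (inj₂ (refl , p)) (d , d′) with subtract c c′ p d′
  ... | t , n , dt , refl = t , n , Desc-weaken t d dt , sym (⊕-keep′ c t dt)

  subtract-Below : ∀ {e} c c′ → c <ᴸ c′ → Below e c′ → Σ CNF λ t → ([] <ᴸ t) × Below e t × (c′ ≡ c ⊕ t)
  subtract-Below []      (y ∷ c′) p        d = y ∷ c′ , tt , d , refl
  subtract-Below (x ∷ c) (y ∷ c′) (inj₁ p) d = y ∷ c′ , tt , d , sym (⊕-absorb c c′ p)
  subtract-Below (x ∷ c) (y ∷ c′) (inj₂ (refl , p)) (d , d′) with subtract c c′ p d′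
  ... | t , n , dt , refl = t , n , Desc⇒Below t d dt , sym (⊕-keep′ c t dt)

  Desc-prefix : ∀ {b} g h → Desc b (g List.++ h) → Desc b g
  Desc-prefix []      h d       = tt
  Desc-prefix (x ∷ g) h (p , d) = p , Desc-prefix g h d

  Below-prefix : ∀ {b} g h → Below b (g List.++ h) → Below b g
  Below-prefix []      h d       = tt
  Below-prefix (x ∷ g) h (p , d) = p , Desc-prefix g h d

  Desc-++ : ∀ {b} g y v → Desc b (g List.++ y ∷ v) → b ≮ᵥ y
  Desc-++ []      y v (p , _) = p
  Desc-++ (x ∷ g) y v (p , d) = ≮ᵥ-trans p (Desc-++ g y v d)

  Desc-replace : ∀ {b} g y v s → Desc b (g List.++ y ∷ v) → Below y s → Desc b (g List.++ s)
  Desc-replace []      y v s (p , _) q = Desc-weaken s p (Below⇒Desc s q)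
  Desc-replace (x ∷ g) y v s (p , d) q = p , Desc-replace g y v s d q

  Below-replace : ∀ {b} g y v s → Below b (g List.++ y ∷ v) → Below y s → Below b (g List.++ s)
  Below-replace []      y v s (p , _) q = Below-weaken s (inj₁ p) q
  Below-replace (x ∷ g) y v s (p , d) q = p , Desc-replace g y v s d q

  Desc-suffix : ∀ {b} g y v → Desc b (g List.++ y ∷ v) → Desc y v
  Desc-suffix []      y v (_ , d) = d
  Desc-suffix (x ∷ g) y v (_ , d) = Desc-suffix g y v d

  Below-suffix : ∀ {b} g y v → Below b (g List.++ y ∷ v) → Below b (y ∷ v)
  Below-suffix []      y v d       = d
  Below-suffix (x ∷ g) y v (p , d) = ≤-<ᵥ (Desc-++ g y v d) p , Desc-suffix g y v d

  -- An interval of length t cut at u. As `pivot` exceeds everything that u has after the common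
  -- part, `t ≡ u ⊕ (pivot ∷ tailₜ)`: the second piece is literally a suffix of t.
  record Split (u t : CNF) : Set where
    constructor split
    field
      common tailᵤ : CNF
      pivot        : V
      tailₜ        : CNF
      u≡           : u ≡ common List.++ tailᵤ
      t≡           : t ≡ common List.++ pivot ∷ tailₜ
      below        : Below pivot tailᵤ

  <ᴸ⇒Split : ∀ {b} u t → u <ᴸ t → Desc b u → Split u t
  <ᴸ⇒Split []      (y ∷ t) p        d       = split [] [] y t refl refl tt
  <ᴸ⇒Split (x ∷ u) (y ∷ t) (inj₁ p) (_ , d) = split [] (x ∷ u) y t refl refl (p , d)
  <ᴸ⇒Split (x ∷ u) (y ∷ t) (inj₂ (refl , p)) (_ , d) with <ᴸ⇒Split u t p d
  ... | split g s z v refl refl q = split (x ∷ g) s z v refl refl q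

  ++-⊕ : ∀ {b} g s y v → Desc b (g List.++ y ∷ v) → Below y s → (g List.++ s) ⊕ (y ∷ v) ≡ g List.++ y ∷ v
  ++-⊕ []      []      y v d       q       = refl
  ++-⊕ []      (a ∷ s) y v d       (q , _) = ⊕-absorb s v q
  ++-⊕ (x ∷ g) s       y v (_ , d) q       =
    trans (⊕-keep (g List.++ s) v (Desc-++ g y v d)) (cong (x ∷_) (++-⊕ g s y v d q))

  -- Associativity of `_⊕_` for a difference cut as in `Split`: by `++-⊕`, the word `g ++ y ∷ v` is
  -- `(g ++ s) ⊕ (y ∷ v)`.
  ⊕-assoc-split : ∀ {b} p g s y v → Desc b (g List.++ y ∷ v) → Below y s →
                  (p ⊕ (g List.++ s)) ⊕ (y ∷ v) ≡ p ⊕ (g List.++ y ∷ v)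
  ⊕-assoc-split []      g s y v d q
    rewrite ⊕-identityˡ (g List.++ s) | ⊕-identityˡ (g List.++ y ∷ v) = ++-⊕ g s y v d q
  ⊕-assoc-split (x ∷ p) [] [] y v d q = refl
  ⊕-assoc-split (x ∷ p) [] (a ∷ s) y v d (q , q′) with em {x <ᵥ a}
  ... | yes xa = trans (⊕-absorb s v q) (sym (⊕-absorb p v (<ᵥ-trans xa q)))
  ... | no ¬xa with cmpᵥ x y
  ...   | tri< xy _ _    = trans (⊕-absorb (p ⊕ (a ∷ s)) v xy) (sym (⊕-absorb p v xy))
  ...   | tri≈ ¬xy _ _   = trans (⊕-keep (p ⊕ (a ∷ s)) v ¬xy)
                             (trans (cong (x ∷_) (⊕-assoc-split p [] (a ∷ s) y v d (q , q′))) (sym (⊕-keep p v ¬xy)))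
  ...   | tri> ¬xy _ _   = trans (⊕-keep (p ⊕ (a ∷ s)) v ¬xy)
                             (trans (cong (x ∷_) (⊕-assoc-split p [] (a ∷ s) y v d (q , q′))) (sym (⊕-keep p v ¬xy)))
  ⊕-assoc-split (x ∷ p) (h ∷ g) s y v d q with em {x <ᵥ h}
  ... | yes xh = ++-⊕ (h ∷ g) s y v d q
  ... | no ¬xh = trans (⊕-keep (p ⊕ (h ∷ g List.++ s)) v λ xy → ¬xh (<-≤ᵥ xy (Desc-++ g y v (proj₂ d))))
                   (cong (x ∷_) (⊕-assoc-split p (h ∷ g) s y v d q))

  -- Exponents up to a level, and truncation

  -- Π_δ formulas do not tell exponents ≥ δ apart.
  _~[_]_ : V → Ord → V → Set
  v ~[ δ ] w = (v ≡ w) ⊎ ((δ ≤o r v) × (δ ≤o r w))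

  ~-refl : ∀ {δ v} → v ~[ δ ] v
  ~-refl = inj₁ refl

  ~-sym : ∀ {δ v w} → v ~[ δ ] w → w ~[ δ ] v
  ~-sym (inj₁ e)       = inj₁ (sym e)
  ~-sym (inj₂ (p , q)) = inj₂ (q , p)

  ~-weaken : ∀ {δ δ′ v w} → δ′ ≤o δ → v ~[ δ ] w → v ~[ δ′ ] w
  ~-weaken p (inj₁ e)       = inj₁ e
  ~-weaken p (inj₂ (a , b)) = inj₂ (≤-trans p a , ≤-trans p b)

  -- Truncation of an exponent at d. With d of rank δ it changes a word in a way that is invisible
  -- at level δ and makes it fit below every exponent of rank above δ.
  min : V → V → V
  min d x with em {x <ᵥ d}
  ... | yes _ = x
  ... | no  _ = d

  min-mono : ∀ d {x y} → x ≮ᵥ y → min d x ≮ᵥ min d y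
  min-mono d {x} {y} p with em {x <ᵥ d} | em {y <ᵥ d}
  ... | yes _  | yes _ = p
  ... | yes xd | no ¬yd = λ a → p (<-≤ᵥ xd ¬yd)
  ... | no ¬xd | yes yd = λ a → <ᵥ-irrefl (<ᵥ-trans a yd)
  ... | no _   | no _   = <ᵥ-irrefl

  min-Desc : ∀ d {b} c → Desc b c → Desc (min d b) (map (min d) c)
  min-Desc d []      p       = tt
  min-Desc d (x ∷ c) (p , q) = min-mono d p , min-Desc d c q

  min-Below : ∀ d {e e′} c → (∀ x → x <ᵥ e′ → min d x <ᵥ e) → Below e′ c → Below e (map (min d) c)
  min-Below d []      h p       = tt
  min-Below d (x ∷ c) h (p , q) = h x p , min-Desc d c q

  min-~ : ∀ {δ} d x → δ ≤o r d → min d x ~[ δ ] x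
  min-~ d x p with em {x <ᵥ d}
  ... | yes _ = inj₁ refl
  ... | no ¬a = inj₂ (p , ≤-trans p (≮⇒≥ ¬a))

  map-min-~ : ∀ {δ} d c → δ ≤o r d → Pointwise (_~[ δ ]_) (map (min d) c) c
  map-min-~ d []      p = []
  map-min-~ d (x ∷ c) p = min-~ d x p ∷ map-min-~ d c p

  -- Either the bounds are the same and truncation only lowers x, or h has rank above δ and so
  -- exceeds d. The second case is what costs one level per move of the game.
  min-< : ∀ {δ h h′} d → r d ≤o δ → h ~[ suc δ ] h′ → ∀ x → x <ᵥ h′ → min d x <ᵥ h
  min-< d p m x q with em {x <ᵥ d} | m
  ... | yes _  | inj₁ refl    = q
  ... | no ¬xd | inj₁ refl    = ≤-<ᵥ ¬xd q
  ... | yes xd | inj₂ (a , _) = ≤-trans xd (≤-trans p (≤-trans ≤-suc a))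
  ... | no _   | inj₂ (a , _) = ≤-trans (≤-suc-mono p) a

  -- The coloured tree and the two orderings

  e : Node → V
  e []      = v₀
  -- The first step is not counted: both halves of the tree are coloured alike, so a node can change
  -- halves without changing its colour.
  e (b ∷ u) = proj₁ enumV (trailing 0 u)

  coloured : ∀ w v → Σ Node λ x → (e (w List.++ x) ≡ v) × ¬ (w List.++ x ≡ [])
  coloured w v with proj₂ enumV v
  -- The step `false` restarts the count, or is itself the uncounted first step; the n steps to the
  -- right after it then select the n-th exponent.
  ... | n , p = false ∷ replicate n true , eq′ w , nonroot w
    where
    eq′ : ∀ w → e (w List.++ false ∷ replicate n true) ≡ v
    eq′ []      = trans (cong (proj₁ enumV) (trans (trailing-rights 0 n) (ℕₚ.+-identityʳ n))) p
    eq′ (b ∷ w) = trans (cong (proj₁ enumV) (trans (trailing-++ 0 w _) (trans (trailing-rights 0 n) (ℕₚ.+-identityʳ n)))) p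
    nonroot : ∀ w → ¬ (w List.++ false ∷ replicate n true ≡ [])
    nonroot [] ()
    nonroot (_ ∷ _) ()

  -- The left half of the tree carries the shuffle of all exponents, the right half the one without
  -- `top`. The block of the root lies at the cut between them; having exponent v₀ of rank zero, it
  -- is a single point.
  Valid : Bool → Node → Set
  Valid full []          = T full
  Valid full (false ∷ u) = ⊤
  Valid full (true ∷ u)  = e (true ∷ u) <ᵥ top

  valid : ∀ full q → ¬ (q ≡ []) → e q <ᵥ top ⊎ q <ᴵ [] → Valid full q
  valid full []          n p        = ⊥-elim (n refl)
  valid full (false ∷ q) n p        = tt
  valid full (true ∷ q)  n (inj₁ p) = p

  dense : ∀ lo hi v → Gap lo hi → Σ Node λ q → (q ≻lo lo) × (q ≺hi hi) × (e q ≡ v) × ¬ (q ≡ [])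
  dense lo hi v g with subtree-in-gap lo hi g
  ... | w , h with coloured w v
  ...   | x , c , n = w List.++ x , proj₁ (h x) , proj₂ (h x) , c , n

  dense-valid : ∀ full lo hi v → Gap lo hi → v <ᵥ top →
                Σ Node λ q → (q ≻lo lo) × (q ≺hi hi) × (e q ≡ v) × Valid full q
  dense-valid full lo hi v g p with dense lo hi v g
  ... | q , a , b , refl , n = q , a , b , refl , valid full q n (inj₁ p)

  -- Block full is Σ_{q valid} ω^(e q): the linear order of the theorem is Block true, and Block false omits the block of the root.
  record Elem (full : Bool) : Set where
    constructor elem
    field
      node : Node
      cnf  : CNF
      .node-valid : Valid full node
      .cnf-below  : Below (e node) cnf
  open Elem public using (node; cnf)

  Elem-≡ : ∀ {full} {x y : Elem full} → node x ≡ node y → cnf x ≡ cnf y → x ≡ y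
  Elem-≡ {x = elem _ _ _ _} {elem _ _ _ _} refl refl = refl

  node-ok : ∀ {full} (x : Elem full) → Valid full (node x)
  node-ok (elem _ _ v _) = recompute em v

  cnf-ok : ∀ {full} (x : Elem full) → Below (e (node x)) (cnf x)
  cnf-ok (elem _ _ _ b) = recompute em b

  infix 4 _<ᴱ_
  _<ᴱ_ : ∀ {full} → Elem full → Elem full → Set
  x <ᴱ y = (node x <ᴵ node y) ⊎ ((node x ≡ node y) × (cnf x <ᴸ cnf y))

  <ᴱ-irrefl : ∀ {full} (x : Elem full) → ¬ x <ᴱ x
  <ᴱ-irrefl x (inj₁ p)       = <ᴵ-irrefl (node x) p
  <ᴱ-irrefl x (inj₂ (_ , p)) = <ᴸ-irrefl _ p

  <ᴱ-trans : ∀ {full} {x y z : Elem full} → x <ᴱ y → y <ᴱ z → x <ᴱ z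
  <ᴱ-trans {x = x} {y} {z} (inj₁ p) (inj₁ q) = inj₁ (<ᴵ-trans (node x) (node y) (node z) p q)
  <ᴱ-trans {x = x} {y} {z} (inj₁ p) (inj₂ (q , _)) = inj₁ (subst (node x <ᴵ_) q p)
  <ᴱ-trans {x = x} {y} {z} (inj₂ (p , _)) (inj₁ q) = inj₁ (subst (_<ᴵ node z) (sym p) q)
  <ᴱ-trans {x = x} {y} {z} (inj₂ (p , a)) (inj₂ (q , b)) =
    inj₂ (trans p q , <ᴸ-trans (cnf x) (cnf y) (cnf z) a b)

  cmpᴱ : ∀ {full} (x y : Elem full) → Tri (x <ᴱ y) (x ≡ y) (y <ᴱ x)
  cmpᴱ x y with cmpᴵ (node x) (node y)
  ... | tri< a b c = tri< (inj₁ a) (b ∘ cong node) λ { (inj₁ p) → c p ; (inj₂ (p , _)) → b (sym p) }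
  ... | tri> a b c = tri> (λ { (inj₁ p) → a p ; (inj₂ (p , _)) → b p }) (b ∘ cong node) (inj₁ c)
  ... | tri≈ a b c with cmpᴸ (cnf x) (cnf y)
  ...   | tri< a′ b′ c′ = tri< (inj₂ (b , a′)) (b′ ∘ cong cnf) λ { (inj₁ p) → c p ; (inj₂ (_ , p)) → c′ p }
  ...   | tri≈ a′ b′ c′ = tri≈ (λ { (inj₁ p) → a p ; (inj₂ (_ , p)) → a′ p }) (Elem-≡ b b′)
                               λ { (inj₁ p) → c p ; (inj₂ (_ , p)) → c′ p }
  ...   | tri> a′ b′ c′ = tri> (λ { (inj₁ p) → a p ; (inj₂ (_ , p)) → a′ p }) (b′ ∘ cong cnf) (inj₂ (sym b , c′))

  Block : Bool → Structure
  Block full = record { Carrier = Elem full ; _≺_ = _<ᴱ_ }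

  Block-linear : ∀ full → IsLinearOrdering (Block full)
  Block-linear full = record
    { isStrictPartialOrder = record
      { isEquivalence = isEquivalence
      ; irrefl        = λ { {x} refl → <ᴱ-irrefl x }
      ; trans         = λ {x} {y} {z} → <ᴱ-trans {full} {x} {y} {z}
      ; <-resp-≈      = (λ { refl p → p }) , (λ { refl p → p }) }
    ; compare = cmpᴱ }

  Block-countable : ∀ full → Countable (Block full)
  Block-countable full = enum , surj
    where
    raw : Enumeration (Node × CNF)
    raw = enum-× (enum-List enum-Bool) (enum-List enumV)
    build : Node × CNF → Elem full
    build (q , c) with em {Valid full q × Below (e q) c}
    ... | yes (v , b) = elem q c v b
    ... | no _        = elem (false ∷ []) [] tt tt
    build-self : ∀ x → build (node x , cnf x) ≡ x
    build-self x with em {Valid full (node x) × Below (e (node x)) (cnf x)}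
    ... | yes _ = refl
    ... | no ¬p = ⊥-elim (¬p (node-ok x , cnf-ok x))
    enum : ℕ → Elem full
    enum n = build (proj₁ raw n)
    surj : ∀ x → ∃ λ n → enum n ≡ x
    surj x with proj₂ raw (node x , cnf x)
    ... | n , p = n , trans (cong build p) (build-self x)

  -- The back-and-forth game below level l

  Pair : Bool → Bool → Set
  Pair f f′ = Elem f × Elem f′

  node¹ : ∀ {f f′} → Maybe (Pair f f′) → Maybe Node
  node¹ nothing        = nothing
  node¹ (just (x , _)) = just (node x)

  node² : ∀ {f f′} → Maybe (Pair f f′) → Maybe Node
  node² nothing        = nothing
  node² (just (_ , y)) = just (node y)

  _~*[_]_ : CNF → Ord → CNF → Set
  c ~*[ δ ] d = Pointwise (_~[ δ ]_) c d

  Colour : ∀ {f f′} → Ord → Pair f f′ → Set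
  Colour δ (x , x′) = e (node x) ~[ δ ] e (node x′)

  -- The intervals from the previous pair to this one look alike with δ levels left.
  data Edge {f f′} (δ : Ord) : Maybe (Pair f f′) → Pair f f′ → Set where
    new  : ∀ {prev x x′} → node x ≻lo node¹ prev → node x′ ≻lo node² prev →
           cnf x ~*[ δ ] cnf x′ → Edge δ prev (x , x′)
    same : ∀ {p p′ x x′} t t′ → node p ≡ node x → node p′ ≡ node x′ → [] <ᴸ t → [] <ᴸ t′ →
           Below (e (node x)) t → Below (e (node x′)) t′ →
           cnf x ≡ cnf p ⊕ t → cnf x′ ≡ cnf p′ ⊕ t′ → t ~*[ δ ] t′ → Edge δ (just (p , p′)) (x , x′)

  Link : ∀ {f f′} → Ord → Maybe (Pair f f′) → Maybe (Pair f f′) → Set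
  Link δ prev nothing  = ⊤
  Link δ prev (just x) = Edge δ prev x × Colour δ x

  PrevColour : ∀ {f f′} → Ord → Maybe (Pair f f′) → Set
  PrevColour δ nothing  = ⊤
  PrevColour δ (just p) = Colour δ p

  -- A partial isomorphism as an increasing list of pairs, each compared with its predecessor only,
  -- so that a new pair disturbs just two links. Nothing is required of the blocks between two
  -- different blocks, or after the last pair: exponents below `top` recur in every gap, and `top`
  -- itself can be replaced below level l.
  data Chain {f f′} (δ : Ord) : Maybe (Pair f f′) → List (Pair f f′) → Set where
    []  : ∀ {prev} → Chain δ prev []
    _∷_ : ∀ {prev x L} → Link δ prev (just x) → Chain δ (just x) L → Chain δ prev (x ∷ L)

  After : ∀ {f f′} → Maybe (Pair f f′) → Elem f′ → Set
  After nothing        y = ⊤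
  After (just (_ , p)) y = p <ᴱ y

  Before : ∀ {f f′} → Elem f′ → Maybe (Pair f f′) → Set
  Before y nothing        = ⊤
  Before y (just (_ , x)) = y <ᴱ x

  ~*-weaken : ∀ {δ δ′ c d} → δ′ ≤o δ → c ~*[ δ ] d → c ~*[ δ′ ] d
  ~*-weaken p = PW.map (~-weaken p)

  Edge-weaken : ∀ {f f′ δ δ′ prev} {x : Pair f f′} → δ′ ≤o δ → Edge δ prev x → Edge δ′ prev x
  Edge-weaken p (new a b c) = new a b (~*-weaken p c)
  Edge-weaken p (same t t′ a b c d g h i j k) = same t t′ a b c d g h i j (~*-weaken p k)

  Chain-weaken : ∀ {f f′ δ δ′ prev} {L : List (Pair f f′)} → δ′ ≤o δ → Chain δ prev L → Chain δ′ prev L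
  Chain-weaken p []            = []
  Chain-weaken p ((a , b) ∷ c) = (Edge-weaken p a , ~-weaken p b) ∷ Chain-weaken p c

  swapᴹ : ∀ {f f′} → Maybe (Pair f f′) → Maybe (Pair f′ f)
  swapᴹ nothing  = nothing
  swapᴹ (just p) = just (swap p)

  Edge-swap : ∀ {f f′ δ prev} {x : Pair f f′} → Edge δ prev x → Edge δ (swapᴹ prev) (swap x)
  Edge-swap {prev = nothing} (new a b c) = new b a (PW.symmetric ~-sym c)
  Edge-swap {prev = just _}  (new a b c) = new b a (PW.symmetric ~-sym c)
  Edge-swap (same t t′ a b c d g h i j k) = same t′ t b a d c h g j i (PW.symmetric ~-sym k)

  Chain-swap : ∀ {f f′ δ prev} {L : List (Pair f f′)} → Chain δ prev L → Chain δ (swapᴹ prev) (map swap L)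
  Chain-swap []            = []
  Chain-swap ((a , b) ∷ c) = (Edge-swap a , ~-sym b) ∷ Chain-swap c

  ~*-split : ∀ {δ} t g′ h′ v′ → t ~*[ δ ] (g′ List.++ h′ ∷ v′) →
             Σ CNF λ g → Σ V λ h → Σ CNF λ v →
               (t ≡ g List.++ h ∷ v) × (g ~*[ δ ] g′) × (h ~[ δ ] h′) × (v ~*[ δ ] v′)
  ~*-split (h ∷ v) []       h′ v′ (a ∷ b) = [] , h , v , refl , [] , a , b
  ~*-split (x ∷ t) (y ∷ g′) h′ v′ (a ∷ b) with ~*-split t g′ h′ v′ b
  ... | g , h , v , refl , p , q , s = x ∷ g , h , v , refl , a ∷ p , q , s

  ~*-nonempty : ∀ {δ t t′} → t ~*[ δ ] t′ → [] <ᴸ t′ → [] <ᴸ t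
  ~*-nonempty (_ ∷ _) p = tt

  module _ (δ : Ord) (δ<l : suc δ <o l) where

    cut : V
    cut = proj₁ (r-surjective δ (≤-trans ≤-suc (<⇒≤ δ<l)))

    cut≤ : r cut ≤o δ
    cut≤ = proj₁ (proj₂ (r-surjective δ (≤-trans ≤-suc (<⇒≤ δ<l))))

    cut≥ : δ ≤o r cut
    cut≥ = proj₂ (proj₂ (r-surjective δ (≤-trans ≤-suc (<⇒≤ δ<l))))

    -- The exponent `top` is missing in the right half of the tree. An exponent of rank δ + 1 stands
    -- in for it; it lies below `top` since δ + 1 is below l.
    matchingColour : ∀ v → Σ V λ w → (w ~[ suc δ ] v) × (w <ᵥ top)
    matchingColour v with cmpᵥ v top
    ... | tri< a _ _    = v , inj₁ refl , a
    ... | tri> _ _ a    = ⊥-elim (top-maximal a)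
    ... | tri≈ _ refl _ = w , inj₂ (proj₂ w≈ , subst (suc δ ≤o_) (sym r-top) (<⇒≤ δ<l)) ,
                          <l⇒<top (≤-trans (≤-suc-mono (proj₁ w≈)) δ<l)
      where
      w  = proj₁ (r-surjective (suc δ) (<⇒≤ δ<l))
      w≈ = proj₂ (r-surjective (suc δ) (<⇒≤ δ<l))

    -- The two sides are treated differently. Truncation affects only the piece before the reply;
    -- the piece after it is a suffix of an old word, or an unchanged entry into a later block, and
    -- keeps its level. Thus several points can be inserted from left to right at the cost of one
    -- level in all.
    Reply : ∀ {f f′} → Maybe (Pair f f′) → Maybe (Pair f f′) → Elem f′ → Set
    Reply {f} prev nxt y′ = Σ (Elem f) λ y →
      Colour (suc δ) (y , y′) × Edge δ prev (y , y′) × Link (suc δ) (just (y , y′)) nxt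

    -- The part of the word common with the pivot is copied, the lower rest is truncated at δ.
    split-reply : ∀ {b b′} t g′ s′ h′ v′ → Below b t → Below b′ (g′ List.++ h′ ∷ v′) → Below h′ s′ →
                  t ~*[ suc δ ] (g′ List.++ h′ ∷ v′) →
                  Σ CNF λ u → Σ V λ h → Σ CNF λ v → Below b u × (u ~*[ δ ] (g′ List.++ s′)) ×
                  Below b (h ∷ v) × ((h ∷ v) ~*[ suc δ ] (h′ ∷ v′)) × (∀ p → p ⊕ t ≡ (p ⊕ u) ⊕ (h ∷ v))
    split-reply {b} t g′ s′ h′ v′ bt bt′ bs m with ~*-split t g′ h′ v′ m
    ... | g , h , v , refl , mg , mh , mv =
      g List.++ s , h , v , Below-replace g h v s bt bs′
      , PW.++⁺ (~*-weaken ≤-suc mg) (map-min-~ cut s′ cut≥)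
      , Below-suffix g h v bt , mh ∷ mv
      , λ p → sym (⊕-assoc-split p g s h v (Below⇒Desc (g List.++ h ∷ v) bt) bs′)
      where
      s   = map (min cut) s′
      bs′ = min-Below cut s′ (min-< cut cut≤ mh) bs

    module _ {f f′ : Bool} where

      -- Here `t′` is the distance from p′ to x′; the way y′ cuts it is transferred to the matching
      -- distance `t`.
      reply-same : ∀ p (p′ : Elem f′) x x′ → Edge {f} (suc δ) (just (p , p′)) (x , x′) → Colour (suc δ) (x , x′) →
                   node p′ ≡ node x′ → ∀ y′ → p′ <ᴱ y′ → y′ <ᴱ x′ → Reply (just (p , p′)) (just (x , x′)) y′
      reply-same p p′ x x′ (new a b c) col eq′ y′ lo hi = ⊥-elim (<ᴵ-irrefl (node p′) (subst (node p′ <ᴵ_) (sym eq′) b))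
      reply-same p p′ x x′ (same t t′ n n′ ne ne′ bt bt′ ct ct′ m) col _ y′ lo hi = result
        where
        between : p′ <ᴱ y′ → y′ <ᴱ x′ → (node p′ ≡ node y′) × (cnf p′ <ᴸ cnf y′) × (cnf y′ <ᴸ cnf x′)
        between (inj₁ a) (inj₁ b)       = ⊥-elim (<ᴵ-irrefl (node p′)
                                               (<ᴵ-trans (node p′) (node y′) (node p′) a (subst (node y′ <ᴵ_) (sym n′) b)))
        between (inj₁ a) (inj₂ (b , _)) = ⊥-elim (<ᴵ-irrefl (node p′) (subst (node p′ <ᴵ_) (trans b (sym n′)) a))
        between (inj₂ (a , _)) (inj₁ b) = ⊥-elim (<ᴵ-irrefl (node y′)
                                               (subst (node y′ <ᴵ_) (trans (sym n′) a) b))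
        between (inj₂ (a , b)) (inj₂ (_ , c)) = a , b , c
        middle = between lo hi
        py = proj₁ middle
        sub = subtract-Below (cnf p′) (cnf y′) (proj₁ (proj₂ middle)) (cnf-ok y′)
        u′ = proj₁ sub
        cy′ : cnf y′ ≡ cnf p′ ⊕ u′
        cy′ = proj₂ (proj₂ (proj₂ sub))
        bu′ : Below (e (node y′)) u′
        bu′ = proj₁ (proj₂ (proj₂ sub))
        u′<t′ : u′ <ᴸ t′
        u′<t′ = ⊕-cancel-< (cnf p′) u′ t′
                  (subst (_<ᴸ (cnf p′ ⊕ t′)) cy′ (subst (cnf y′ <ᴸ_) ct′ (proj₂ (proj₂ middle))))
        result : Reply (just (p , p′)) (just (x , x′)) y′
        result with <ᴸ⇒Split u′ t′ u′<t′ (Below⇒Desc u′ bu′)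
        ... | split g′ s′ h′ v′ u≡ refl bs with split-reply t g′ s′ h′ v′ bt bt′ bs m
        ...   | u , h , v , bu , mu , bhv , mhv , assoc =
          y , colour , edge
          , same (h ∷ v) (h′ ∷ v′) refl (trans (sym py) n′) tt tt bhv (Below-suffix g′ h′ v′ bt′)
              (trans ct (assoc (cnf p)))
              (trans ct′ (trans (sym (⊕-assoc-split (cnf p′) g′ s′ h′ v′ (Below⇒Desc (g′ List.++ h′ ∷ v′) bt′) bs))
                (cong (_⊕ (h′ ∷ v′)) (sym (trans cy′ (cong (cnf p′ ⊕_) u≡))))))
              mhv
          , col
          where
          y : Elem f
          y = elem (node x) (cnf p ⊕ u) (node-ok x)
                (⊕-Below (cnf p) u (subst (λ q → Below (e q) (cnf p)) n (cnf-ok p)) bu)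
          colour : Colour (suc δ) (y , y′)
          colour = subst (λ q → e (node x) ~[ suc δ ] e q) (trans (sym n′) py) col
          mu′ : u ~*[ δ ] u′
          mu′ = subst (u ~*[ δ ]_) (sym u≡) mu
          edge : Edge δ (just (p , p′)) (y , y′)
          edge = same u u′ n py (~*-nonempty mu′ (proj₁ (proj₂ sub))) (proj₁ (proj₂ sub)) bu bu′ refl cy′ mu′

      node-link : ∀ p (p′ : Elem f′) (y : Elem f) y′ nxt → node p ≡ node y → node p′ ≡ node y′ →
                  (∀ x x′ → nxt ≡ just (x , x′) → ¬ (node p′ ≡ node x′)) →
                  Link (suc δ) (just (p , p′)) nxt → Link (suc δ) (just (y , y′)) nxt
      node-link p p′ y y′ nothing n n′ h k = tt
      node-link p p′ y y′ (just (x , x′)) n n′ h (new a b c , col) =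
        new (subst (_<ᴵ node x) n a) (subst (_<ᴵ node x′) n′ b) c , col
      node-link p p′ y y′ (just (x , x′)) n n′ h (same t t′ _ a _ _ _ _ _ _ _ , col) = ⊥-elim (h x x′ refl a)

      -- Inside the block of p′ only the end of the block bounds y′. The truncated distance fits
      -- into the block of p because the two exponents agree at level δ + 1.
      reply-prev : ∀ p (p′ : Elem f′) nxt → Colour (suc δ) (p , p′) → Link {f} (suc δ) (just (p , p′)) nxt →
                   (∀ x x′ → nxt ≡ just (x , x′) → ¬ (node p′ ≡ node x′)) →
                   ∀ y′ → node p′ ≡ node y′ → cnf p′ <ᴸ cnf y′ → Reply (just (p , p′)) nxt y′
      reply-prev p p′ nxt col lk h y′ n lt′ with subtract-Below (cnf p′) (cnf y′) lt′ (cnf-ok y′)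
      ... | u′ , ne , bu′ , cy′ =
        y , subst (λ q → e (node p) ~[ suc δ ] e q) n col
        , same u u′ refl n (~*-nonempty mu ne) ne bu bu′ refl cy′ mu
        , node-link p p′ y y′ nxt refl n h lk
        where
        u  = map (min cut) u′
        mu = map-min-~ cut u′ cut≥
        bu : Below (e (node p)) u
        bu = min-Below cut u′ (min-< cut cut≤ (subst (λ q → e (node p) ~[ suc δ ] e q) n col)) bu′
        y : Elem f
        y = elem (node p) (cnf p ⊕ u) (node-ok p) (⊕-Below (cnf p) u (cnf-ok p) bu)

      -- The start of the block takes the role of the preceding point, and the position of x′ that
      -- of the distance to be cut.
      reply-next : ∀ (prev : Maybe (Pair f f′)) x x′ → Edge (suc δ) prev (x , x′) → Colour (suc δ) (x , x′) →
                   ∀ y′ → node y′ ≻lo node² prev → node y′ ≡ node x′ → cnf y′ <ᴸ cnf x′ →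
                   Reply prev (just (x , x′)) y′
      reply-next prev x x′ (same t t′ n n′ _ _ _ _ _ _ _) col y′ lo nx lt′ =
        ⊥-elim (<ᴵ-irrefl (node y′) (subst (_<ᴵ node y′) (trans n′ (sym nx)) lo))
      reply-next prev x x′ (new a b m) col y′ lo nx lt′
        with <ᴸ⇒Split (cnf y′) (cnf x′) lt′ (Below⇒Desc (cnf y′) (cnf-ok y′))
      ... | split g′ s′ h′ v′ u≡ t≡ bs
        with split-reply (cnf x) g′ s′ h′ v′ (cnf-ok x) (subst (Below (e (node x′))) t≡ (cnf-ok x′)) bs
               (subst (cnf x ~*[ suc δ ]_) t≡ m)
      ... | u , h , v , bu , mu , bhv , mhv , assoc =
        y , subst (λ q → e (node x) ~[ suc δ ] e q) (sym nx) col
        , new a lo (subst (u ~*[ δ ]_) (sym u≡) mu)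
        , same (h ∷ v) (h′ ∷ v′) refl nx tt tt bhv (Below-suffix g′ h′ v′ bx′)
            (trans (sym (⊕-identityˡ (cnf x))) (trans (assoc []) (cong (_⊕ (h ∷ v)) (⊕-identityˡ u))))
            (trans t≡ (trans (sym (++-⊕ g′ s′ h′ v′ (Below⇒Desc (g′ List.++ h′ ∷ v′) bx′) bs))
              (cong (_⊕ (h′ ∷ v′)) (sym u≡))))
            mhv
        , col
        where
        bx′ : Below (e (node x′)) (g′ List.++ h′ ∷ v′)
        bx′ = subst (Below (e (node x′))) t≡ (cnf-ok x′)
        y : Elem f
        y = elem (node x) u (node-ok x) bu

      -- The gap on the other side is also one between different blocks, hence contains a node of
      -- any wanted colour below `top`; the position in the new block is truncated to fit.
      reply-fresh : ∀ (prev nxt : Maybe (Pair f f′)) → Link (suc δ) prev nxt →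
                    ∀ y′ → node y′ ≻lo node² prev → node y′ ≺hi node² nxt → Reply prev nxt y′
      reply-fresh prev nxt lk y′ lo hi with matchingColour (e (node y′))
      ... | w , mw , w<top with dense-valid f (node¹ prev) (node¹ nxt) w (gap prev nxt lk lo hi) w<top
        where
        gap : ∀ prev nxt → Link (suc δ) prev nxt → node y′ ≻lo node² prev → node y′ ≺hi node² nxt →
              Gap (node¹ prev) (node¹ nxt)
        gap nothing  nothing  _ _ _ = tt
        gap nothing  (just _) _ _ _ = tt
        gap (just _) nothing  _ _ _ = tt
        gap (just _) (just _) (new a b c , _) lo hi = a
        gap (just (p , p′)) (just (x , x′)) (same t t′ n n′ _ _ _ _ _ _ _ , _) lo hi =
          ⊥-elim (<ᴵ-irrefl (node p′) (<ᴵ-trans (node p′) (node y′) (node p′) lo (subst (node y′ <ᴵ_) (sym n′) hi)))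
      ... | q , qlo , qhi , refl , qv = y , mw , new qlo lo (map-min-~ cut (cnf y′) cut≥) , link nxt lk qhi hi
        where
        y : Elem f
        y = elem q (map (min cut) (cnf y′)) qv (min-Below cut (cnf y′) (min-< cut cut≤ mw) (cnf-ok y′))
        link : ∀ nxt → Link (suc δ) prev nxt → q ≺hi node¹ nxt → node y′ ≺hi node² nxt →
               Link (suc δ) (just (y , y′)) nxt
        link nothing  _ _ _ = tt
        link (just (x , x′)) (new a b c , col) qhi hi = new qhi hi c , col
        link (just (x , x′)) (same {p} {p′} t t′ n n′ _ _ _ _ _ _ _ , col) qhi hi =
          ⊥-elim (<ᴵ-irrefl (node p′) (<ᴵ-trans (node p′) (node y′) (node p′) lo (subst (node y′ <ᴵ_) (sym n′) hi)))

      reply : ∀ (prev nxt : Maybe (Pair f f′)) → PrevColour (suc δ) prev → Link (suc δ) prev nxt →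
              ∀ y′ → After prev y′ → Before y′ nxt → Reply prev nxt y′
      reply nothing nothing pc lk y′ lo hi = reply-fresh nothing nothing lk y′ tt tt
      reply nothing (just (x , x′)) pc lk y′ lo (inj₁ hi) = reply-fresh nothing _ lk y′ tt hi
      reply nothing (just (x , x′)) pc (ed , col) y′ lo (inj₂ (n , hi)) = reply-next nothing x x′ ed col y′ tt n hi
      reply (just (p , p′)) nothing pc lk y′ (inj₁ lo) hi = reply-fresh (just (p , p′)) nothing lk y′ lo tt
      reply (just (p , p′)) nothing pc lk y′ (inj₂ (n , lo)) hi = reply-prev p p′ nothing pc lk (λ _ _ ()) y′ n lo
      reply (just (p , p′)) (just (x , x′)) pc lk@(ed , col) y′ lo hi with em {node p′ ≡ node x′}
      ... | yes px = reply-same p p′ x x′ ed col px y′ lo hi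
      ... | no ¬px with lo | hi
      ...   | inj₁ a       | inj₁ b       = reply-fresh _ _ lk y′ a b
      ...   | inj₁ a       | inj₂ (n , b) = reply-next _ x x′ ed col y′ a n b
      ...   | inj₂ (n , a) | _            = reply-prev p p′ _ pc lk (λ { _ _ refl → ¬px }) y′ n a

  -- Finite tuples as ascending lists, and their insertion into a chain

  Above : ∀ {f} → Maybe (Elem f) → Elem f → Set
  Above nothing  y = ⊤
  Above (just p) y = p <ᴱ y

  Ascending : ∀ {f} → Maybe (Elem f) → List (Elem f) → Set
  Ascending p []       = ⊤
  Ascending p (y ∷ ys) = Above p y × Ascending (just y) ys

  -- Repeated points are dropped, which keeps the list strictly ascending; tuples matter only
  -- through membership.
  insert : ∀ {f} → Elem f → List (Elem f) → List (Elem f)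
  insert y [] = y ∷ []
  insert y (x ∷ xs) with cmpᴱ y x
  ... | tri< _ _ _ = y ∷ x ∷ xs
  ... | tri≈ _ _ _ = x ∷ xs
  ... | tri> _ _ _ = x ∷ insert y xs

  insert-Ascending : ∀ {f} p (y : Elem f) xs → Above p y → Ascending p xs → Ascending p (insert y xs)
  insert-Ascending p y [] a b = a , tt
  insert-Ascending p y (x ∷ xs) a (b , c) with cmpᴱ y x
  ... | tri< y<x _ _ = a , y<x , c
  ... | tri≈ _ _ _   = b , c
  ... | tri> _ _ x<y = b , insert-Ascending (just x) y xs x<y c

  insert-new : ∀ {f} (y : Elem f) xs → y ∈ insert y xs
  insert-new y [] = here refl
  insert-new y (x ∷ xs) with cmpᴱ y x
  ... | tri< _ _ _   = here refl
  ... | tri≈ _ refl _ = here refl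
  ... | tri> _ _ _   = there (insert-new y xs)

  insert-old : ∀ {f} (y : Elem f) xs {z} → z ∈ xs → z ∈ insert y xs
  insert-old y (x ∷ xs) m with cmpᴱ y x
  insert-old y (x ∷ xs) m         | tri< _ _ _ = there m
  insert-old y (x ∷ xs) m         | tri≈ _ _ _ = m
  insert-old y (x ∷ xs) (here p)  | tri> _ _ _ = here p
  insert-old y (x ∷ xs) (there m) | tri> _ _ _ = there (insert-old y xs m)

  sort : ∀ {f} → List (Elem f) → List (Elem f)
  sort []       = []
  sort (x ∷ xs) = insert x (sort xs)

  sort-Ascending : ∀ {f} (xs : List (Elem f)) → Ascending nothing (sort xs)
  sort-Ascending []       = tt
  sort-Ascending (x ∷ xs) = insert-Ascending nothing x (sort xs) tt (sort-Ascending xs)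

  sort-∈ : ∀ {f} (xs : List (Elem f)) {x} → x ∈ xs → x ∈ sort xs
  sort-∈ (x ∷ xs) (here refl) = insert-new x (sort xs)
  sort-∈ (x ∷ xs) (there m)   = insert-old x (sort xs) (sort-∈ xs m)

  second : ∀ {f f′} → Maybe (Pair f f′) → Maybe (Elem f′)
  second nothing        = nothing
  second (just (_ , y)) = just y

  Above⇒After : ∀ {f f′} (prev : Maybe (Pair f f′)) y → Above (second prev) y → After prev y
  Above⇒After nothing  y a = tt
  Above⇒After (just _) y a = a

  Extension : ∀ {f f′} → Ord → Maybe (Pair f f′) → List (Pair f f′) → List (Elem f′) → Set
  Extension {f} {f′} δ prev L ns = Σ (List (Pair f f′)) λ L′ → Chain δ prev L′ × (∀ {p} → p ∈ L → p ∈ L′) ×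
    (∀ {n} → n ∈ ns → Σ (Elem f) λ x → (x , n) ∈ L′)

  keep-old : ∀ {f f′ δ prev} {p : Pair f f′} {L ns} → Link δ prev (just p) →
             Extension δ (just p) L ns → Extension δ prev (p ∷ L) ns
  keep-old {p = p} lk (L′ , ch , old , cov) = p ∷ L′ , lk ∷ ch ,
    (λ { (here refl) → here refl ; (there m) → there (old m) }) ,
    (λ m → let (x , q) = cov m in x , there q)

  add-new : ∀ {f f′ δ prev} {x : Elem f} {y : Elem f′} {L ns} → Link δ prev (just (x , y)) →
            Extension δ (just (x , y)) L ns → Extension δ prev L (y ∷ ns)
  add-new {x = x} {y} lk (L′ , ch , old , cov) = (x , y) ∷ L′ , lk ∷ ch , (λ m → there (old m)) ,
    (λ { (here refl) → x , here refl ; (there m) → let (z , q) = cov m in z , there q })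

  Link-weaken : ∀ {f f′ δ prev} {p : Pair f f′} → Link (suc δ) prev (just p) → Link δ prev (just p)
  Link-weaken (ed , col) = Edge-weaken ≤-suc ed , ~-weaken ≤-suc col

  -- New points are answered in increasing order: a reply weakens only the interval to its left.
  mutual
    extend : ∀ {f f′} δ → suc δ <o l → ∀ (prev : Maybe (Pair f f′)) L → PrevColour (suc δ) prev →
             Chain (suc δ) prev L → ∀ ns → Ascending (second prev) ns → Extension δ prev L ns
    extend δ b prev L pc ch []       asc       = L , Chain-weaken ≤-suc ch , id , λ ()
    extend δ b prev L pc ch (y ∷ ns) (a , asc) = place δ b prev L pc ch y ns a asc

    place : ∀ {f f′} δ → suc δ <o l → ∀ (prev : Maybe (Pair f f′)) L → PrevColour (suc δ) prev →
            Chain (suc δ) prev L → ∀ y ns → Above (second prev) y → Ascending (just y) ns →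
            Extension δ prev L (y ∷ ns)
    place δ b prev [] pc ch y ns a asc with reply δ b prev nothing pc tt y (Above⇒After prev y a) tt
    ... | x , col , ed , _ = add-new (ed , ~-weaken ≤-suc col) (extend δ b (just (x , y)) [] col [] ns asc)
    place δ b prev ((x , x′) ∷ L) pc (lk ∷ ch) y ns a asc with cmpᴱ y x′
    ... | tri> _ _ x<y = keep-old (Link-weaken lk) (place δ b (just (x , x′)) L (proj₂ lk) ch y ns x<y asc)
    ... | tri≈ _ refl _ with keep-old {ns = ns} (Link-weaken lk) (extend δ b (just (x , x′)) L (proj₂ lk) ch ns asc)
    ...   | L′ , ch′ , old , cov = L′ , ch′ , old , λ { (here refl) → x , old (here refl) ; (there m) → cov m }
    place δ b prev ((x , x′) ∷ L) pc (lk ∷ ch) y ns a asc | tri< y<x _ _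
      with reply δ b prev (just (x , x′)) pc lk y (Above⇒After prev y a) y<x
    ... | z , col , ed , lk′ =
      add-new (ed , ~-weaken ≤-suc col) (extend δ b (just (z , y)) ((x , x′) ∷ L) col (lk′ ∷ ch) ns asc)

  -- From chains to formulas of level at most l

  Equivalent : ∀ {f f′ n} → Ord → Vector (Elem f) n → Vector (Elem f′) n → Set
  Equivalent {f} {f′} δ ρ ρ′ = Σ (List (Pair f f′)) λ L → Chain δ nothing L × (∀ i → (ρ i , ρ′ i) ∈ L)

  Equivalent-sym : ∀ {f f′ n δ} {ρ : Vector (Elem f) n} {ρ′ : Vector (Elem f′) n} →
                   Equivalent δ ρ ρ′ → Equivalent δ ρ′ ρ
  Equivalent-sym (L , ch , m) = map swap L , Chain-swap ch , λ i → ∈-map⁺ swap (m i)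

  -- One level pays for a whole block of quantifiers, because the sorted tuple is answered in a
  -- single pass of `extend`.
  Equivalent-extend : ∀ {f f′ n k δ β} {ρ : Vector (Elem f) n} {ρ′ : Vector (Elem f′) n} → δ ≤o l → β <o δ →
                      Equivalent δ ρ ρ′ → (σ′ : Vector (Elem f′) k) →
                      Σ (Vector (Elem f) k) λ σ → Equivalent β (σ ++ ρ) (σ′ ++ ρ′)
  Equivalent-extend {β = β} δ≤l β<δ (L , ch , m) σ′
    -- The game needs β + 1, not only β, strictly below l; this is where it uses that l is a limit.
    with extend β (proj₂ isLimit β (≤-trans β<δ δ≤l)) nothing L tt (Chain-weaken β<δ ch)
           (sort (tabulate σ′)) (sort-Ascending (tabulate σ′))
  ... | L′ , ch′ , old , cov = (λ i → proj₁ (c i)) , L′ , ch′ ,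
        ++-rel (λ x x′ → (x , x′) ∈ L′) (λ i → proj₂ (c i)) (λ i → old (m i))
    where
    c : ∀ i → Σ _ λ x → (x , σ′ i) ∈ L′
    c i = cov (sort-∈ (tabulate σ′) (∈-tabulate⁺ i))

  Both< : ∀ {f f′} → Pair f f′ → Pair f f′ → Set
  Both< (x , x′) (y , y′) = (x <ᴱ y) × (x′ <ᴱ y′)

  Both<-trans : ∀ {f f′} (p q s : Pair f f′) → Both< p q → Both< q s → Both< p s
  Both<-trans (p , p′) (q , q′) (s , s′) (a , b) (c , d) =
    <ᴱ-trans {x = p} {q} {s} a c , <ᴱ-trans {x = p′} {q′} {s′} b d

  Edge⇒Both< : ∀ {f f′ δ} {p x : Pair f f′} → Edge δ (just p) x → Both< p x
  Edge⇒Both< (new a b c) = inj₁ a , inj₁ b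
  Edge⇒Both< (same {p} {p′} {x} {x′} t t′ n n′ ne ne′ _ _ c c′ _) =
    inj₂ (n , subst (cnf p <ᴸ_) (sym c) (⊕-mono (cnf p) [] t ne)) ,
    inj₂ (n′ , subst (cnf p′ <ᴸ_) (sym c′) (⊕-mono (cnf p′) [] t′ ne′))

  Chain⇒Both< : ∀ {f f′ δ p} {L : List (Pair f f′)} → Chain δ (just p) L → ∀ {q} → q ∈ L → Both< p q
  Chain⇒Both< ((ed , _) ∷ ch) (here refl) = Edge⇒Both< ed
  Chain⇒Both< {p = p} (_∷_ {x = x} (ed , _) ch) {q} (there m) = Both<-trans p x q (Edge⇒Both< ed) (Chain⇒Both< ch m)

  Chain-compare : ∀ {f f′ δ prev} {L : List (Pair f f′)} → Chain δ prev L → ∀ {p q} → p ∈ L → q ∈ L →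
                  (p ≡ q) ⊎ (Both< p q ⊎ Both< q p)
  Chain-compare (_ ∷ ch) (here refl) (here refl) = inj₁ refl
  Chain-compare (_ ∷ ch) (here refl) (there m)   = inj₂ (inj₁ (Chain⇒Both< ch m))
  Chain-compare (_ ∷ ch) (there m)   (here refl) = inj₂ (inj₂ (Chain⇒Both< ch m))
  Chain-compare (_ ∷ ch) (there m)   (there m′)  = Chain-compare ch m m′

  Equivalent⇒SameAtoms : ∀ {f f′ n δ} {ρ : Vector (Elem f) n} {ρ′ : Vector (Elem f′) n} →
                         Equivalent δ ρ ρ′ → SameAtoms (Block f) (Block f′) ρ ρ′
  Equivalent⇒SameAtoms {ρ = ρ} {ρ′} (L , ch , m) i j = go (ρ i) (ρ′ i) (ρ j) (ρ′ j) (Chain-compare ch (m i) (m j))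
    where
    go : ∀ x x′ y y′ → ((x , x′) ≡ (y , y′)) ⊎ (Both< (x , x′) (y , y′) ⊎ Both< (y , y′) (x , x′)) →
         ((x <ᴱ y) ⇔′ (x′ <ᴱ y′)) × ((x ≡ y) ⇔′ (x′ ≡ y′))
    go x x′ y y′ (inj₁ refl) = ((λ a → ⊥-elim (<ᴱ-irrefl x a)) , (λ a → ⊥-elim (<ᴱ-irrefl x′ a))) ,
                               ((λ _ → refl) , (λ _ → refl))
    go x x′ y y′ (inj₂ (inj₁ (a , b))) = ((λ _ → b) , (λ _ → a)) ,
                               ((λ { refl → ⊥-elim (<ᴱ-irrefl x a) }) , (λ { refl → ⊥-elim (<ᴱ-irrefl x′ b) }))
    go x x′ y y′ (inj₂ (inj₂ (a , b))) =
      ((λ c → ⊥-elim (<ᴱ-irrefl x (<ᴱ-trans {x = x} {y} {x} c a))) ,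
       (λ c → ⊥-elim (<ᴱ-irrefl x′ (<ᴱ-trans {x = x′} {y′} {x′} c b)))) ,
      ((λ { refl → ⊥-elim (<ᴱ-irrefl x a) }) , (λ { refl → ⊥-elim (<ᴱ-irrefl x′ b) }))

  mutual
    -- Equivalence is symmetric, so Π and Σ formulas are preserved at the same level: universal
    -- quantifiers are answered in `Block f`, existential ones in `Block f′`.
    gameΠ : ∀ {f f′ n δ} (φ : PiF δ n) (ρ : Vector (Elem f) n) (ρ′ : Vector (Elem f′) n) → δ ≤o l →
            Equivalent δ ρ ρ′ → satΠ (Block f) φ ρ → satΠ (Block f′) φ ρ′
    gameΠ (qfΠ _ φ)    ρ ρ′ b q s = proj₁ (satQF-⇔ _ _ (Equivalent⇒SameAtoms q) φ) s
    gameΠ (bigAnd fam) ρ ρ′ b q s = λ i → gameAll (fam i) ρ ρ′ b q (s i)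

    gameAll : ∀ {f f′ n δ} (φ : Maybe (AllPart δ n)) (ρ : Vector (Elem f) n) (ρ′ : Vector (Elem f′) n) → δ ≤o l →
              Equivalent δ ρ ρ′ → satMAll (Block f) φ ρ → satMAll (Block f′) φ ρ′
    gameAll nothing ρ ρ′ b q s = tt
    gameAll (just (all β β<δ k ψ)) ρ ρ′ b q s σ′ with Equivalent-extend b β<δ q σ′
    ... | σ , q′ = gameΣ ψ (σ ++ ρ) (σ′ ++ ρ′) (≤-trans (<⇒≤ β<δ) b) q′ (s σ)

    gameΣ : ∀ {f f′ n δ} (φ : SigmaF δ n) (ρ : Vector (Elem f) n) (ρ′ : Vector (Elem f′) n) → δ ≤o l →
            Equivalent δ ρ ρ′ → satΣ (Block f) φ ρ → satΣ (Block f′) φ ρ′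
    gameΣ (qfΣ _ φ)   ρ ρ′ b q s = proj₁ (satQF-⇔ _ _ (Equivalent⇒SameAtoms q) φ) s
    gameΣ (bigOr fam) ρ ρ′ b q (i , s) = i , gameEx (fam i) ρ ρ′ b q s

    gameEx : ∀ {f f′ n δ} (φ : Maybe (ExPart δ n)) (ρ : Vector (Elem f) n) (ρ′ : Vector (Elem f′) n) → δ ≤o l →
             Equivalent δ ρ ρ′ → satMEx (Block f) φ ρ → satMEx (Block f′) φ ρ′
    gameEx (just (ex β β<δ k π)) ρ ρ′ b q (σ , s) with Equivalent-extend b β<δ (Equivalent-sym q) σ
    ... | σ′ , q′ = σ′ , gameΠ π (σ ++ ρ) (σ′ ++ ρ′) (≤-trans (<⇒≤ β<δ) b) (Equivalent-sym q′) s

  -- Transfer of Π_{l+3} formulas from Block true to Block false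

  insert-All : ∀ {f} {P : Elem f → Set} y xs → P y → All P xs → All P (insert y xs)
  insert-All y [] p q = p ∷ q
  insert-All y (x ∷ xs) p (q ∷ s) with cmpᴱ y x
  ... | tri< _ _ _ = p ∷ q ∷ s
  ... | tri≈ _ _ _ = q ∷ s
  ... | tri> _ _ _ = q ∷ insert-All y xs p s

  sort-All : ∀ {f} {P : Elem f → Set} xs → All P xs → All P (sort xs)
  sort-All []       p       = p
  sort-All (x ∷ xs) (p ∷ q) = insert-All x (sort xs) p (sort-All xs q)

  module _ {f f′ : Bool} (g : Elem f′ → Elem f) (Good : Elem f′ → Set)
           (g-cnf : ∀ x → cnf (g x) ≡ cnf x)
           (g-colour : ∀ x → e (node (g x)) ≡ e (node x))
           (g-mono : ∀ x y → Good x → Good y → node x <ᴵ node y → node (g x) <ᴵ node (g y))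
           (g-cong : ∀ x y → node x ≡ node y → node (g x) ≡ node (g y)) where

    graph : Elem f′ → Pair f f′
    graph x = g x , x

    ~*-refl : ∀ {δ} c → c ~*[ δ ] c
    ~*-refl c = PW.refl ~-refl

    graph-Link : ∀ {δ} p x → Good p → Good x → p <ᴱ x → Link δ (just (graph p)) (just (graph x))
    graph-Link p x gp gx (inj₁ q) =
      new (g-mono p x gp gx q) q (subst (_~*[ _ ] cnf x) (sym (g-cnf x)) (~*-refl (cnf x))) , inj₁ (g-colour x)
    graph-Link p x gp gx (inj₂ (n , q)) with subtract-Below (cnf p) (cnf x) q (cnf-ok x)
    ... | t , ne , b , c =
      same t t (g-cong p x n) n ne ne (subst (λ v → Below v t) (sym (g-colour x)) b) b
        (trans (g-cnf x) (trans c (cong (_⊕ t) (sym (g-cnf p))))) c (~*-refl t)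
      , inj₁ (g-colour x)

    graph-Chain-from : ∀ {δ} p ns → Good p → All Good ns → Ascending (just p) ns → Chain δ (just (graph p)) (map graph ns)
    graph-Chain-from p []       gp gs       a       = []
    graph-Chain-from p (x ∷ ns) gp (gx ∷ gs) (a , b) = graph-Link p x gp gx a ∷ graph-Chain-from x ns gx gs b

    graph-Chain : ∀ {δ} ns → All Good ns → Ascending nothing ns → Chain δ nothing (map graph ns)
    graph-Chain []       gs        a       = []
    graph-Chain (x ∷ ns) (gx ∷ gs) (_ , b) =
      (new tt tt (subst (_~*[ _ ] cnf x) (sym (g-cnf x)) (~*-refl (cnf x))) , inj₁ (g-colour x)) ∷ graph-Chain-from x ns gx gs b

    -- A map that keeps colours and positions and is increasing on the blocks involved yields
    -- equivalence at every δ at once: inside a block the distances are equal, and an `Edge` between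
    -- different blocks ignores what lies between them.
    graph-Equivalent : ∀ {δ n} (ρ : Vector (Elem f) n) (ρ′ : Vector (Elem f′) n) →
                       (∀ i → Good (ρ′ i)) → (∀ i → ρ i ≡ g (ρ′ i)) → Equivalent δ ρ ρ′
    graph-Equivalent ρ ρ′ good h =
      map graph ns , graph-Chain ns (sort-All _ (tabulate⁺ good)) (sort-Ascending (tabulate ρ′)) ,
      λ i → subst (λ x → (x , ρ′ i) ∈ map graph ns) (sym (h i)) (∈-map⁺ graph (sort-∈ _ (∈-tabulate⁺ i)))
      where
      ns = sort (tabulate ρ′)

  -- Nodes right of the root but left of a go to the far right of the left subtree, and a goes to the root.
  push : Node → ℕ → Node → Node
  push a N []          = []
  push a N (false ∷ w) = false ∷ w
  push a N (true ∷ w) with cmpᴵ (true ∷ w) a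
  ... | tri< _ _ _ = false ∷ replicate N true List.++ false ∷ w
  ... | tri≈ _ _ _ = []
  ... | tri> _ _ _ = true ∷ w

  -- The colour of `true ∷ w` depends on w alone, and so does that of its image, where the `false`
  -- in front of w restarts the count.
  push-colour : ∀ a N → e a ≡ v₀ → ∀ q → e (push a N q) ≡ e q
  push-colour a N h []          = refl
  push-colour a N h (false ∷ w) = refl
  push-colour a N h (true ∷ w) with cmpᴵ (true ∷ w) a
  ... | tri< _ _ _    = cong (proj₁ enumV) (trailing-++ 0 (replicate N true) w)
  ... | tri≈ _ refl _ = sym h
  ... | tri> _ _ _    = refl

  push-valid : ∀ a N f q → Valid f q → Valid true (push a N q)
  push-valid a N f []          v = tt
  push-valid a N f (false ∷ w) v = tt
  push-valid a N f (true ∷ w)  v with cmpᴵ (true ∷ w) a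
  ... | tri< _ _ _ = tt
  ... | tri≈ _ _ _ = tt
  ... | tri> _ _ _ = v

  -- The bound keeps pushed nodes to the right of all given nodes of the left half. The root is
  -- excluded because `push` sends it to the same place as a; it does not occur in `Block false`.
  Short : ℕ → Node → Set
  Short N []      = ⊥
  Short N (_ ∷ w) = length w ℕ.< N

  push-mono : ∀ a N q q′ → Short N q → Short N q′ → q <ᴵ q′ → push a N q <ᴵ push a N q′
  push-mono a N (false ∷ w) (false ∷ w′) s s′ p = p
  push-mono a N (false ∷ w) (true ∷ w′)  s s′ p with cmpᴵ (true ∷ w′) a
  ... | tri< _ _ _ = short-<-rights w N (false ∷ w′) s
  ... | tri≈ _ _ _ = tt
  ... | tri> _ _ _ = tt
  push-mono a N (true ∷ w) (true ∷ w′) s s′ p with cmpᴵ (true ∷ w) a | cmpᴵ (true ∷ w′) a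
  ... | tri< _ _ _    | tri< _ _ _    = ++-mono-<ᴵ (replicate N true) {false ∷ w} {false ∷ w′} p
  ... | tri< _ _ _    | tri≈ _ _ _    = tt
  ... | tri< _ _ _    | tri> _ _ _    = tt
  ... | tri≈ _ refl _ | tri< c _ _    = ⊥-elim (<ᴵ-irrefl w (<ᴵ-trans w w′ w p c))
  ... | tri≈ _ refl _ | tri≈ _ refl _ = ⊥-elim (<ᴵ-irrefl w p)
  ... | tri≈ _ _ _    | tri> _ _ _    = tt
  ... | tri> _ _ c    | tri< d _ _    = ⊥-elim (<ᴵ-irrefl a (<ᴵ-trans a (true ∷ w) a c (<ᴵ-trans (true ∷ w) (true ∷ w′) a p d)))
  ... | tri> _ _ c    | tri≈ _ refl _ = ⊥-elim (<ᴵ-irrefl w (<ᴵ-trans w w′ w p c))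
  ... | tri> _ _ _    | tri> _ _ _    = p

  pushᴱ : ∀ a N → e a ≡ v₀ → Elem false → Elem true
  pushᴱ a N h x = elem (push a N (node x)) (cnf x) (push-valid a N false (node x) (node-ok x))
                    (subst (λ v → Below v (cnf x)) (sym (push-colour a N h (node x))) (cnf-ok x))

  NotLow : Node → Node → Set
  NotLow a []          = ⊤
  NotLow a (false ∷ w) = ⊤
  NotLow a (true ∷ w)  = ¬ (true ∷ w <ᴵ a)

  push-NotLow : ∀ a N N′ q → NotLow a q → push a N q ≡ push a N′ q
  push-NotLow a N N′ []          n = refl
  push-NotLow a N N′ (false ∷ w) n = refl
  push-NotLow a N N′ (true ∷ w)  n with cmpᴵ (true ∷ w) a
  ... | tri< p _ _ = ⊥-elim (n p)
  ... | tri≈ _ _ _ = refl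
  ... | tri> _ _ _ = refl

  -- The position once the stand-in is chosen: block a of `Block false` corresponds to the root of
  -- `Block true`, and no point named so far lies in a block between the cut and a.
  record Moved {n} (ρ : Vector (Elem true) n) (ρ′ : Vector (Elem false) n) : Set where
    field
      a         : Node
      a-colour  : e a ≡ v₀
      notLow    : ∀ i → NotLow a (node (ρ′ i))
      -- The `0` is arbitrary: by `push-NotLow` the second argument of `push` does not matter on
      -- these nodes.
      same-node : ∀ i → node (ρ i) ≡ push a 0 (node (ρ′ i))
      same-cnf  : ∀ i → cnf (ρ i) ≡ cnf (ρ′ i)

  short : ∀ N (x : Elem false) → length (node x) ℕ.< N → Short N (node x)
  short N x p with node x | node-ok x
  ... | []    | ()
  ... | _ ∷ w | _ = ℕₚ.≤-trans (s≤s (ℕₚ.n≤1+n _)) p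

  Moved-extend : ∀ {n k} {ρ : Vector (Elem true) n} {ρ′} → Moved ρ ρ′ → (σ′ : Vector (Elem false) k) →
                 Σ (Vector (Elem true) k) λ σ → ∀ δ → Equivalent δ (σ ++ ρ) (σ′ ++ ρ′)
  Moved-extend {ρ = ρ} {ρ′} m σ′ with finite-bound (λ i → length (node ((σ′ ++ ρ′) i)))
  ... | N , h = pushᴱ a N a-colour ∘ σ′ , λ δ →
    graph-Equivalent (pushᴱ a N a-colour) (Short N ∘ node) (λ _ → refl) (λ x → push-colour a N a-colour (node x))
      (λ x y → push-mono a N (node x) (node y)) (λ _ _ → cong (push a N)) _ (σ′ ++ ρ′)
      (λ i → short N ((σ′ ++ ρ′) i) (h i))
      (++-rel (λ x x′ → x ≡ pushᴱ a N a-colour x′) {σ = pushᴱ a N a-colour ∘ σ′} {σ′} {ρ} {ρ′} (λ _ → refl)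
        (λ i → Elem-≡ (trans (same-node i) (push-NotLow a 0 N _ (notLow i))) (same-cnf i)))
    where
    open Moved m

  Moved⇒SameAtoms : ∀ {n} {ρ : Vector (Elem true) n} {ρ′} → Moved ρ ρ′ → SameAtoms (Block true) (Block false) ρ ρ′
  Moved⇒SameAtoms m = Equivalent⇒SameAtoms (proj₂ (Moved-extend {k = 0} m ε) zero)

  -- New points between the cut and a are pushed to the far end of the left half by `Moved-extend`.
  -- What remains is a formula of level at most l, so the game takes over.
  Moved-Π : ∀ {n δ} (φ : PiF δ n) (ρ : Vector (Elem true) n) ρ′ → δ ≤o suc l → Moved ρ ρ′ →
            satΠ (Block true) φ ρ → satΠ (Block false) φ ρ′
  Moved-Π (qfΠ _ φ) ρ ρ′ b m s = proj₁ (satQF-⇔ _ _ (Moved⇒SameAtoms m) φ) s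
  Moved-Π {n} {δ} (bigAnd fam) ρ ρ′ b m s = λ i → go (fam i) (s i)
    where
    go : (φ : Maybe (AllPart δ n)) → satMAll (Block true) φ ρ → satMAll (Block false) φ ρ′
    go nothing s = tt
    go (just (all β β<δ k ψ)) s σ′ with Moved-extend m σ′
    ... | σ , q = gameΣ ψ (σ ++ ρ) (σ′ ++ ρ′) (suc-inj-≤ (≤-trans β<δ b)) (q β) (s σ)

  Included : ∀ {n} → Vector (Elem true) n → Vector (Elem false) n → Set
  Included ρ ρ′ = ∀ i → (node (ρ i) ≡ node (ρ′ i)) × (cnf (ρ i) ≡ cnf (ρ′ i))

  pull : Node → Node → Node
  pull a []      = a
  pull a (b ∷ w) = b ∷ w

  -- The N steps to the left put a before every node of the right half with length below N. So no
  -- named node lies between the cut and a, and `push` undoes `pull`.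
  pull-push : ∀ a w′ N q → a ≡ true ∷ replicate N false List.++ w′ → length q ℕ.< N →
              NotLow a (pull a q) × (q ≡ push a 0 (pull a q))
  pull-push _ w′ N []          refl p = <ᴵ-irrefl (replicate N false List.++ w′) , root
    where
    root : [] ≡ push (true ∷ replicate N false List.++ w′) 0 (true ∷ replicate N false List.++ w′)
    root with cmpᴵ (true ∷ replicate N false List.++ w′) (true ∷ replicate N false List.++ w′)
    ... | tri< a _ _ = ⊥-elim (<ᴵ-irrefl (replicate N false List.++ w′) a)
    ... | tri≈ _ _ _ = refl
    ... | tri> _ _ a = ⊥-elim (<ᴵ-irrefl (replicate N false List.++ w′) a)
  pull-push a w′ N (false ∷ w) h    p = tt , refl
  pull-push _ w′ N (true ∷ w)  refl p = notLow , fixed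
    where
    above : replicate N false List.++ w′ <ᴵ w
    above = lefts-<-short w N w′ (ℕₚ.≤-trans (s≤s (ℕₚ.n≤1+n _)) p)
    notLow : ¬ (w <ᴵ replicate N false List.++ w′)
    notLow q = <ᴵ-irrefl w (<ᴵ-trans w (replicate N false List.++ w′) w q above)
    fixed : true ∷ w ≡ push (true ∷ replicate N false List.++ w′) 0 (true ∷ w)
    fixed with cmpᴵ (true ∷ w) (true ∷ replicate N false List.++ w′)
    ... | tri< q _ _ = ⊥-elim (notLow q)
    ... | tri≈ _ r _ = ⊥-elim (<ᴵ-irrefl (true ∷ w) (subst (_<ᴵ true ∷ w) (sym r) above))
    ... | tri> _ _ _ = refl

  Included-extend : ∀ {n k} {ρ : Vector (Elem true) n} {ρ′} → Included ρ ρ′ → (σ : Vector (Elem true) k) →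
                    Σ (Vector (Elem false) k) λ σ′ → Moved (σ ++ ρ) (σ′ ++ ρ′)
  Included-extend {ρ = ρ} {ρ′} inc σ with finite-bound (λ i → length (node ((σ ++ ρ) i)))
  -- Among the nodes far to the left in the right half, one with the colour of the root is taken as
  -- stand-in.
  ... | N , h with coloured (true ∷ replicate N false) v₀
  ...   | w′ , col , _ = pullᴱ ∘ σ , record
    { a = a ; a-colour = col ; notLow = λ i → proj₁ (moved i) ; same-node = λ i → proj₁ (proj₂ (moved i))
    ; same-cnf = λ i → proj₂ (proj₂ (moved i)) }
    where
    a = true ∷ replicate N false List.++ w′
    pull-colour : ∀ q → e (pull a q) ≡ e q
    pull-colour []      = col
    pull-colour (_ ∷ _) = refl
    pull-valid : ∀ q → Valid true q → Valid false (pull a q)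
    pull-valid []          v = subst (_<ᵥ top) (sym col) v₀<top
    pull-valid (false ∷ _) v = tt
    pull-valid (true ∷ _)  v = v
    pullᴱ : Elem true → Elem false
    pullᴱ x = elem (pull a (node x)) (cnf x) (pull-valid (node x) (node-ok x))
                (subst (λ v → Below v (cnf x)) (sym (pull-colour (node x))) (cnf-ok x))
    pull-nonroot : ∀ (x : Elem false) q → q ≡ node x → pull a q ≡ node x
    pull-nonroot x [] p with node x | node-ok x
    pull-nonroot x [] () | _ ∷ _ | _
    pull-nonroot x [] p  | []    | ()
    pull-nonroot x (_ ∷ _) p = p
    moved : ∀ i → NotLow a (node ((pullᴱ ∘ σ ++ ρ′) i)) ×
                  (node ((σ ++ ρ) i) ≡ push a 0 (node ((pullᴱ ∘ σ ++ ρ′) i))) ×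
                  (cnf ((σ ++ ρ) i) ≡ cnf ((pullᴱ ∘ σ ++ ρ′) i))
    moved i with ++-rel (λ x x′ → (pull a (node x) ≡ node x′) × (cnf x ≡ cnf x′)) {σ = σ} {pullᴱ ∘ σ} {ρ} {ρ′}
                   (λ _ → refl , refl) (λ j → pull-nonroot (ρ′ j) (node (ρ j)) (proj₁ (inc j)) , proj₂ (inc j)) i
                | pull-push a w′ N (node ((σ ++ ρ) i)) refl (h i)
    ... | p , c | nl , eq′ = subst (NotLow a) p nl , trans eq′ (cong (push a 0) p) , c

  Included⇒SameAtoms : ∀ {n} {ρ : Vector (Elem true) n} {ρ′} → Included ρ ρ′ → SameAtoms (Block true) (Block false) ρ ρ′
  Included⇒SameAtoms inc = Moved⇒SameAtoms (proj₂ (Included-extend {k = 0} inc ε))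

  Included-Σ : ∀ {n δ} (φ : SigmaF δ n) (ρ : Vector (Elem true) n) ρ′ → δ ≤o suc (suc l) → Included ρ ρ′ →
               satΣ (Block true) φ ρ → satΣ (Block false) φ ρ′
  Included-Σ (qfΣ _ φ) ρ ρ′ b m s = proj₁ (satQF-⇔ _ _ (Included⇒SameAtoms m) φ) s
  Included-Σ {n} {δ} (bigOr fam) ρ ρ′ b m (i , s) = i , go (fam i) s
    where
    go : (φ : Maybe (ExPart δ n)) → satMEx (Block true) φ ρ → satMEx (Block false) φ ρ′
    go (just (ex β β<δ k π)) (σ , s) with Included-extend {ρ = ρ} {ρ′} m σ
    ... | σ′ , q = σ′ , Moved-Π π (σ ++ ρ) (σ′ ++ ρ′) (suc-inj-≤ (≤-trans β<δ b)) q s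

  include : Elem false → Elem true
  include x = elem (node x) (cnf x) (inc (node x) (node-ok x)) (cnf-ok x)
    where
    inc : ∀ q → Valid false q → Valid true q
    inc (false ∷ _) v = tt
    inc (true ∷ _)  v = v

  -- The outermost universal tuple costs nothing: `Block false` is a substructure of `Block true`,
  -- so its points are answered by themselves.
  Included-Π : ∀ {n δ} (φ : PiF δ n) (ρ : Vector (Elem true) n) ρ′ → δ ≤o suc (suc (suc l)) → Included ρ ρ′ →
               satΠ (Block true) φ ρ → satΠ (Block false) φ ρ′
  Included-Π (qfΠ _ φ) ρ ρ′ b m s = proj₁ (satQF-⇔ _ _ (Included⇒SameAtoms m) φ) s
  Included-Π {n} {δ} (bigAnd fam) ρ ρ′ b m s = λ i → go (fam i) (s i)
    where
    go : (φ : Maybe (AllPart δ n)) → satMAll (Block true) φ ρ → satMAll (Block false) φ ρ′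
    go nothing s = tt
    go (just (all β β<δ k ψ)) s σ′ =
      Included-Σ ψ (include ∘ σ′ ++ ρ) (σ′ ++ ρ′) (suc-inj-≤ (≤-trans β<δ b))
        (++-rel (λ x x′ → (node x ≡ node x′) × (cnf x ≡ cnf x′)) {σ = include ∘ σ′} {σ′} {ρ} {ρ′} (λ _ → refl , refl) m) (s (include ∘ σ′))

  -- Definability in the orderings

  Small : ∀ {n} → Fm n → Set
  Small φ = rank φ <o l

  0<l : zero <o l
  0<l = proj₁ isLimit

  Small-neg : ∀ {n} {φ : Fm n} → Small φ → Small (neg φ)
  Small-neg = ⊕ₙ-<limit 1 isLimit

  Small-exi : ∀ {n} {φ : Fm (suc n)} → Small φ → Small (exi φ)
  Small-exi = ⊕ₙ-<limit 2 isLimit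

  Small-∧ : ∀ {n} {φ ψ : Fm n} → Small φ → Small ψ → Small (φ ∧ ψ)
  Small-∧ {φ = φ} {ψ} p q with ≤-or-> (rank φ) (rank ψ)
  ... | inj₁ a = ≤-trans (≤-suc-mono (rank-∧ {φ = φ} {ψ} a ≤-refl)) (⊕ₙ-<limit 2 isLimit q)
  ... | inj₂ a = ≤-trans (≤-suc-mono (rank-∧ {φ = φ} {ψ} ≤-refl (<⇒≤ a))) (⊕ₙ-<limit 2 isLimit p)

  Small-ren : ∀ {n m} (ι : Fin n → Fin m) φ → Small φ → Small (ren ι φ)
  Small-ren ι φ p = ≤-trans (≤-suc-mono (rank-ren ι φ)) p

  Small-⋀ : ∀ {k n} (f : Fin k → Fm n) → (∀ i → Small (f i)) → Small (⋀ f)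
  Small-⋀ {zero}  f h = 0<l
  Small-⋀ {suc k} f h = Small-∧ {φ = f zero} {⋀ (f ∘ suc)} (h zero) (Small-⋀ (f ∘ suc) (h ∘ suc))

  -- ω^v divides (the position in its block of) x.
  IsLim : ∀ {full} → V → Elem full → Set
  IsLim v x = All (_≮ᵥ v) (cnf x)

  Approached : ∀ {full} → V → Elem full → Set
  Approached {full} γ y = ∀ x → x <ᴱ y → Σ (Elem full) λ z → (x <ᴱ z) × (z <ᴱ y) × IsLim γ z

  module _ {full : Bool} where

    start : ∀ q → Valid full q → Elem full
    start q v = elem q [] v tt

    start-between : ∀ {x y : Elem full} → node x <ᴵ node y → Σ (Elem full) λ z → (x <ᴱ z) × (z <ᴱ y) × (cnf z ≡ [])
    start-between {x} {y} p with dense-valid full (just (node x)) (just (node y)) v₀ p v₀<top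
    ... | q , a , b , _ , v = start q v , inj₁ a , inj₁ b , refl

    -- Within the block, x + ω^γ is a multiple of ω^γ beyond x; it stays below y because the
    -- distance from x to y begins with an entry of at least v. If x lies in an earlier block, the
    -- start of a block in between serves.
    IsLim⇒Approached : ∀ {γ v} (y : Elem full) → γ <ᵥ v → IsLim v y → Approached γ y
    IsLim⇒Approached {γ} y γ<v h x (inj₁ p) with start-between {x} {y} p
    ... | z , a , b , c = z , a , b , subst (All (_≮ᵥ γ)) (sym c) []
    IsLim⇒Approached {γ} y γ<v h x (inj₂ (n , p)) with subtract-Below (cnf x) (cnf y) p (cnf-ok y)
    ... | t ∷ ts , ne , bt , c = z , inj₂ (refl , ⊕-mono (cnf x) [] (γ ∷ []) tt)
                              , inj₂ (n , subst (cnf x ⊕ (γ ∷ []) <ᴸ_) (sym c) (⊕-mono (cnf x) _ _ (inj₁ γ<t)))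
                              , ⊕-single-All (cnf x) (Below⇒Desc (cnf x) (cnf-ok x))
      where
      h′ : All (_≮ᵥ _) (t ∷ ts)
      h′ = ⊕-Allʳ (cnf x) (t ∷ ts) (subst (All _) c h)
      γ<t : γ <ᵥ t
      γ<t = <-≤ᵥ γ<v (All.head h′)
      z : Elem full
      z = elem (node x) (cnf x ⊕ (γ ∷ [])) (node-ok x)
            (⊕-Below (cnf x) _ (cnf-ok x) (subst (λ q → γ <ᵥ e q) (sym n) (<ᵥ-trans γ<t (proj₁ bt)) , tt))

    lowestEntry : ∀ v x c → Desc x c → ¬ All (_≮ᵥ v) (x ∷ c) →
                  Σ CNF λ c₀ → Σ V λ γ → (x ∷ c ≡ c₀ List.++ γ ∷ []) × (γ <ᵥ v)
    lowestEntry v x [] d h = [] , x , refl , byContradiction λ ¬p → h (¬p ∷ [])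
    lowestEntry v x (y ∷ c) (p , d) h =
      let (c₀ , γ , q , s) = lowestEntry v y c d λ { (a ∷ as) → h (≮ᵥ-trans p a ∷ a ∷ as) }
      in x ∷ c₀ , γ , cong (x ∷_) q , s

    lowest : ∀ {b} v c → Below b c → ¬ All (_≮ᵥ v) c → Σ CNF λ c₀ → Σ V λ γ → (c ≡ c₀ List.++ γ ∷ []) × (γ <ᵥ v)
    lowest v []      d       h = ⊥-elim (h [])
    lowest v (x ∷ c) (_ , d) h = lowestEntry v x c d h

    -- Such a z extends c₀ by an entry below γ.
    nothing-between : ∀ {γ} c₀ z → c₀ <ᴸ z → z <ᴸ c₀ List.++ γ ∷ [] → ¬ All (_≮ᵥ γ) z
    nothing-between []       (h ∷ z) a (inj₁ q)         (p ∷ _) = p q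
    nothing-between []       (h ∷ []) a (inj₂ (_ , ()))
    nothing-between (x ∷ c₀) (h ∷ z) (inj₁ a) (inj₁ q) p = <ᵥ-irrefl (<ᵥ-trans a q)
    nothing-between (x ∷ c₀) (h ∷ z) (inj₁ a) (inj₂ (refl , _)) p = <ᵥ-irrefl a
    nothing-between (x ∷ c₀) (h ∷ z) (inj₂ (refl , a)) (inj₁ q) p = <ᵥ-irrefl q
    nothing-between (x ∷ c₀) (h ∷ z) (inj₂ (refl , a)) (inj₂ (_ , q)) (_ ∷ p) = nothing-between c₀ z a q p

    c₀<c₀++ : ∀ c₀ {γ} → c₀ <ᴸ c₀ List.++ γ ∷ []
    c₀<c₀++ []       = tt
    c₀<c₀++ (x ∷ c₀) = inj₂ (refl , c₀<c₀++ c₀)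

    -- Otherwise the last entry γ of y is below v, and no multiple of ω^γ lies strictly between y
    -- and the point obtained by deleting that entry.
    Approached⇒IsLim : ∀ v (y : Elem full) → (∀ γ → γ <ᵥ v → Approached γ y) → IsLim v y
    Approached⇒IsLim v y h with em {IsLim v y}
    ... | yes a = a
    ... | no ¬a with lowest v (cnf y) (cnf-ok y) ¬a
    ...   | c₀ , γ , p , q with h γ q x (inj₂ (refl , subst (c₀ <ᴸ_) (sym p) (c₀<c₀++ c₀)))
      where
      x : Elem full
      x = elem (node y) c₀ (node-ok y) (Below-prefix c₀ (γ ∷ []) (subst (Below (e (node y))) p (cnf-ok y)))
    ... | z , inj₁ a , inj₁ b , lz       = ⊥-elim (<ᴵ-irrefl (node y) (<ᴵ-trans (node y) (node z) (node y) a b))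
    ... | z , inj₁ a , inj₂ (b , _) , lz = ⊥-elim (<ᴵ-irrefl (node y) (subst (node y <ᴵ_) b a))
    ... | z , inj₂ (a , _) , inj₁ b , lz = ⊥-elim (<ᴵ-irrefl (node y) (subst (_<ᴵ node y) (sym a) b))
    ... | z , inj₂ (_ , a) , inj₂ (_ , b) , lz = ⊥-elim (nothing-between c₀ (cnf z) a (subst (cnf z <ᴸ_) p b) lz)

    -- z = y + ω^γ
    IsNext : V → Elem full → Elem full → Set
    IsNext γ y z = (node z ≡ node y) × (cnf z ≡ cnf y ⊕ (γ ∷ [])) × (γ <ᵥ e (node y))

    -- The first-order form of `IsNext`. If y + ω^γ is not in the block, no z qualifies: before any
    -- point of a later block there are starts of further blocks, which are multiples of everything.
    FirstLim : V → Elem full → Elem full → Set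
    FirstLim γ y z = (y <ᴱ z) × IsLim γ z × ¬ (Σ (Elem full) λ w → ((y <ᴱ w) × (w <ᴱ z)) × IsLim γ w)

    single-least : ∀ {γ} t ts → t ≮ᵥ γ → (t ∷ ts ≡ γ ∷ []) ⊎ (γ ∷ [] <ᴸ t ∷ ts)
    single-least {γ} t ts p with cmpᵥ γ t
    single-least t ts        p | tri< a _ _    = inj₂ (inj₁ a)
    single-least t ts        p | tri> _ _ a    = ⊥-elim (p a)
    single-least t []        p | tri≈ _ refl _ = inj₁ refl
    single-least t (_ ∷ _)   p | tri≈ _ refl _ = inj₂ (inj₂ (refl , tt))

    FirstLim⇒IsNext : ∀ γ y z → FirstLim γ y z → IsNext γ y z
    FirstLim⇒IsNext γ y z (inj₁ p , lz , h) with start-between {y} {z} p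
    ... | w , a , b , c = ⊥-elim (h (w , (a , b) , subst (All (_≮ᵥ γ)) (sym c) []))
    FirstLim⇒IsNext γ y z (inj₂ (n , p) , lz , h) with subtract-Below (cnf y) (cnf z) p (cnf-ok z)
    ... | t ∷ ts , ne , bt , c = sym n , result (single-least t ts (All.head lt′)) , γ<e
      where
      lt′ : All (_≮ᵥ γ) (t ∷ ts)
      lt′ = ⊕-Allʳ (cnf y) (t ∷ ts) (subst (All _) c lz)
      γ<e : γ <ᵥ e (node y)
      γ<e = subst (λ q → γ <ᵥ e q) (sym n) (≤-<ᵥ (All.head lt′) (proj₁ bt))
      w : Elem full
      w = elem (node y) (cnf y ⊕ (γ ∷ [])) (node-ok y) (⊕-Below (cnf y) (γ ∷ []) (cnf-ok y) (γ<e , tt))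
      result : (t ∷ ts ≡ γ ∷ []) ⊎ (γ ∷ [] <ᴸ t ∷ ts) → cnf z ≡ cnf y ⊕ (γ ∷ [])
      result (inj₁ q) = trans c (cong (cnf y ⊕_) q)
      result (inj₂ q) = ⊥-elim (h (w , (inj₂ (refl , ⊕-mono (cnf y) [] (γ ∷ []) tt) ,
        inj₂ (n , subst (cnf w <ᴸ_) (sym c) (⊕-mono (cnf y) _ _ q))) ,
        ⊕-single-All (cnf y) (Below⇒Desc (cnf y) (cnf-ok y))))

    IsNext⇒FirstLim : ∀ γ y z → IsNext γ y z → FirstLim γ y z
    IsNext⇒FirstLim γ y z (n , c , b) =
      inj₂ (sym n , subst (cnf y <ᴸ_) (sym c) (⊕-mono (cnf y) [] (γ ∷ []) tt)) ,
      subst (All _) (sym c) (⊕-single-All (cnf y) (Below⇒Desc (cnf y) (cnf-ok y))) , none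
      where
      none : ¬ (Σ (Elem full) λ w → ((y <ᴱ w) × (w <ᴱ z)) × IsLim γ w)
      none (w , (inj₁ p , inj₁ q) , lw) =
        <ᴵ-irrefl (node y) (<ᴵ-trans (node y) (node w) (node y) p (subst (node w <ᴵ_) n q))
      none (w , (inj₁ p , inj₂ (q , _)) , lw) = <ᴵ-irrefl (node y) (subst (node y <ᴵ_) (trans q n) p)
      none (w , (inj₂ (p , _) , inj₁ q) , lw) = <ᴵ-irrefl (node w) (subst (node w <ᴵ_) (trans n p) q)
      none (w , (inj₂ (_ , p) , inj₂ (_ , q)) , lw) with subtract-Below (cnf y) (cnf w) p (cnf-ok w)
      ... | t ∷ ts , ne , bt , cw with ⊕-cancel-< (cnf y) (t ∷ ts) (γ ∷ []) (subst (_<ᴸ _) cw (subst (cnf w <ᴸ_) c q))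
                                     | ⊕-Allʳ (cnf y) (t ∷ ts) (subst (All _) cw lw)
      ...   | inj₁ a | k ∷ _ = k a
      none (w , (inj₂ (_ , p) , inj₂ (_ , q)) , lw) | t ∷ [] , ne , bt , cw | inj₂ (_ , ()) | _
      none (w , (inj₂ (_ , p) , inj₂ (_ , q)) , lw) | t ∷ _ ∷ _ , ne , bt , cw | inj₂ (_ , ()) | _

  -- Formulas for divisibility, addition and block starts

  mutual
    -- Recursion along the exponents: ω^v divides y exactly if, for every γ below v, the multiples
    -- of ω^γ are cofinal below y.
    LimF : ∀ v → Acc _<o_ (r v) → Fm 1
    LimF v ac = con λ m → approachF v ac (proj₁ enumV m) em

    approachF : ∀ v → Acc _<o_ (r v) → ∀ γ → Dec (γ <ᵥ v) → Fm 1
    approachF v ac       γ (no _)  = atom tt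
    approachF v (acc rs) γ (yes p) =
      neg (exi (atom (lt zero (suc zero)) ∧ neg (exi
        (atom (and (lt (suc zero) zero) (lt zero (suc (suc zero)))) ∧ ren (λ _ → zero) (LimF γ (rs p))))))

  mutual
    rank-LimF : ∀ v ac → rank (LimF v ac) ≤o (stretch (r v) ⊕ₙ 2)
    rank-LimF v ac = ⊕ₙ-mono 2 (≤-limiting λ m → rank-approachF v ac (proj₁ enumV m) em)

    rank-approachF : ∀ v ac γ dec → rank (approachF v ac γ dec) ≤o stretch (r v)
    rank-approachF v ac       γ (no _)  = ≤-zero
    rank-approachF v (acc rs) γ (yes p) = ≤-trans
      -- Three levels for `neg` and `exi`, two for the conjunction, both again for the inner
      -- formula, and the two of `rank-LimF`: the twelve of `stretch (suc (r γ))`.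
      (⊕ₙ-mono 3 (rank-∧ {φ = atom (lt zero (suc zero))} ≤-zero
        (⊕ₙ-mono 3 (rank-∧ {φ = atom (and (lt (suc zero) zero) (lt zero (suc (suc zero))))} ≤-zero
          (≤-trans (rank-ren (λ _ → zero) (LimF γ (rs p))) (rank-LimF γ (rs p)))))))
      (stretch-mono (suc (r γ)) (r v) (≤⇒⊑ p))

  mutual
    Sat-LimF : ∀ {full} v ac (ρ : Vector (Elem full) 1) → Sat (Block full) (LimF v ac) ρ ⇔′ IsLim v (ρ zero)
    Sat-LimF {full} v ac ρ =
      (λ s → Approached⇒IsLim v (ρ zero) λ γ p → proj₁ (Sat-approachF v ac γ em ρ) (at γ s) p) ,
      (λ h m → proj₂ (Sat-approachF v ac (proj₁ enumV m) em ρ) λ p → IsLim⇒Approached (ρ zero) p h)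
      where
      at : ∀ γ → Sat (Block full) (LimF v ac) ρ → Sat (Block full) (approachF v ac γ em) ρ
      at γ s with proj₂ enumV γ
      ... | m , eq′ = subst (λ γ → Sat (Block full) (approachF v ac γ em) ρ) eq′ (s m)

    Sat-approachF : ∀ {full} v ac γ dec (ρ : Vector (Elem full) 1) →
                    Sat (Block full) (approachF v ac γ dec) ρ ⇔′ (γ <ᵥ v → Approached γ (ρ zero))
    Sat-approachF v ac       γ (no ¬p) ρ = (λ _ p → ⊥-elim (¬p p)) , (λ _ → tt)
    Sat-approachF v (acc rs) γ (yes p) ρ =
      (λ s _ x x<y → byContradiction λ none → s (x , λ
        { zero → x<y
        ; (suc _) → λ { (z , t) → none (z , proj₁ (t 0) , proj₂ (t 0) ,
            proj₁ (Sat-LimF γ (rs p) _) (proj₁ (Sat-ren (λ _ → zero) (LimF γ (rs p))) (t 1))) } })) ,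
      (λ { h (x , t) → let (z , a , b , c) = h p x (t 0) in
           t 1 (z , λ { zero → a , b
                      ; (suc _) → proj₂ (Sat-ren (λ _ → zero) (LimF γ (rs p))) (proj₂ (Sat-LimF γ (rs p) _) c) }) })

  Lim : V → Fm 1
  Lim v = LimF v (<-Acc (r v))

  Sat-Lim : ∀ {full} v (ρ : Vector (Elem full) 1) → Sat (Block full) (Lim v) ρ ⇔′ IsLim v (ρ zero)
  Sat-Lim v = Sat-LimF v (<-Acc (r v))

  Small-Lim : ∀ {v} → v <ᵥ top → Small (Lim v)
  Small-Lim {v} p = ≤-trans (≤-suc-mono (rank-LimF v (<-Acc (r v))))
    (⊕ₙ-<limit 2 isLimit (stretch-<limit (r v) l isLimit (<top⇒<l p)))

  Next : V → Fm 2
  Next γ = atom (lt zero (suc zero)) ∧ ren (λ _ → suc zero) (Lim γ) ∧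
    neg (exi (atom (and (lt (suc zero) zero) (lt zero (suc (suc zero)))) ∧ ren (λ _ → zero) (Lim γ)))

  Small-Next : ∀ {v} → v <ᵥ top → Small (Next v)
  Small-Next {v} p = Small-∧ {φ = atom (lt zero (suc zero))}
    {ren (λ _ → suc zero) (Lim v) ∧ neg (exi (inner ∧ ren (λ _ → zero) (Lim v)))} 0<l
    (Small-∧ {φ = ren (λ _ → suc zero) (Lim v)} {neg (exi (inner ∧ ren (λ _ → zero) (Lim v)))}
      (Small-ren (λ _ → suc zero) (Lim v) (Small-Lim p))
      (⊕ₙ-<limit 3 isLimit (Small-∧ {φ = inner} {ren (λ _ → zero) (Lim v)}
        0<l (Small-ren (λ _ → zero) (Lim v) (Small-Lim p)))))
    where
    inner : Fm 3
    inner = atom (and (lt (suc zero) zero) (lt zero (suc (suc zero))))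

  Sat-Next : ∀ {full} γ (ρ : Vector (Elem full) 2) → Sat (Block full) (Next γ) ρ ⇔′ IsNext γ (ρ zero) (ρ (suc zero))
  Sat-Next {full} γ ρ =
    (λ s → FirstLim⇒IsNext γ (ρ zero) (ρ (suc zero)) (s 0 , proj₁ (Sat-Lim γ _) (proj₁ (Sat-ren (λ _ → suc zero) (Lim γ)) (s 1 0)) ,
      λ { (w , b , lw) → s 1 1 (w , λ { zero → b
                                     ; (suc _) → proj₂ (Sat-ren (λ _ → zero) (Lim γ)) (proj₂ (Sat-Lim γ _) lw) }) })) ,
    (λ n → let (a , b , c) = IsNext⇒FirstLim γ (ρ zero) (ρ (suc zero)) n in λ
      { zero → a
      ; (suc _) → λ
        { zero → proj₂ (Sat-ren (λ _ → suc zero) (Lim γ)) (proj₂ (Sat-Lim γ _) b)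
        ; (suc _) → λ { (w , t) → c (w , t 0 , proj₁ (Sat-Lim γ _) (proj₁ (Sat-ren (λ _ → zero) (Lim γ)) (t 1))) } } })

  -- The second variable is the first plus the ordinal denoted by the word.
  Word : CNF → Fm 2
  Word []      = atom (eq zero (suc zero))
  Word (γ ∷ c) = exi (ren (pick (suc zero) zero) (Next γ) ∧ ren (pick zero (suc (suc zero))) (Word c))

  Small-Word : ∀ c → All (_<ᵥ top) c → Small (Word c)
  Small-Word []      _       = 0<l
  Small-Word (γ ∷ c) (p ∷ h) = Small-exi {φ = ren (pick (suc zero) zero) (Next γ) ∧ ren (pick zero (suc (suc zero))) (Word c)}
    (Small-∧ {φ = ren (pick (suc zero) zero) (Next γ)} {ren (pick zero (suc (suc zero))) (Word c)}
      (Small-ren (pick (suc zero) zero) (Next γ) (Small-Next p)) (Small-ren (pick zero (suc (suc zero))) (Word c) (Small-Word c h)))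

  -- The hypothesis says that the concatenated word is again a normal form, so no summand is
  -- absorbed and adding the entries one by one amounts to appending them.
  Sat-Word : ∀ {full} c (ρ : Vector (Elem full) 2) → Below (e (node (ρ zero))) (cnf (ρ zero) List.++ c) →
             Sat (Block full) (Word c) ρ ⇔′
             ((node (ρ (suc zero)) ≡ node (ρ zero)) × (cnf (ρ (suc zero)) ≡ cnf (ρ zero) List.++ c))
  Sat-Word [] ρ b = (λ p → cong node (sym p) , trans (cong cnf (sym p)) (sym (++-identityʳ _))) ,
                    (λ { (n , p) → Elem-≡ (sym n) (sym (trans p (++-identityʳ _))) })
  Sat-Word {full} (γ ∷ c) ρ b =
    (λ { (z , s) →
      let (n , cz , _) = proj₁ (Sat-Next γ _) (proj₁ (Sat-ren (pick (suc zero) zero) (Next γ)) (s 0))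
          cz′ = trans cz absorbed
          (n′ , cx) = proj₁ (Sat-Word c _ (rest z n cz′)) (proj₁ (Sat-ren (pick zero (suc (suc zero))) (Word c)) (s 1))
      in trans n′ n , trans cx (trans (cong (List._++ c) cz′) (++-assoc y (γ ∷ []) c)) }) ,
    (λ { (n , cx) → z , λ
      { zero → proj₂ (Sat-ren (pick (suc zero) zero) (Next γ)) (proj₂ (Sat-Next γ _) (refl , sym absorbed , γ<e))
      ; (suc _) → proj₂ (Sat-ren (pick zero (suc (suc zero))) (Word c))
          (proj₂ (Sat-Word c _ (rest z refl refl)) (n , trans cx (sym (++-assoc y (γ ∷ []) c)))) } })
    where
    y = cnf (ρ zero)
    d : Desc (e (node (ρ zero))) (y List.++ γ ∷ c)
    d = Below⇒Desc (y List.++ γ ∷ c) b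
    b′ : Below (e (node (ρ zero))) ((y List.++ γ ∷ []) List.++ c)
    b′ = subst (Below _) (sym (++-assoc y (γ ∷ []) c)) b
    γ<e : γ <ᵥ e (node (ρ zero))
    γ<e = proj₁ (Below-suffix y γ c b)
    absorbed : y ⊕ (γ ∷ []) ≡ y List.++ γ ∷ []
    absorbed = trans (cong (_⊕ (γ ∷ [])) (sym (++-identityʳ y)))
      (++-⊕ y [] γ [] (Below⇒Desc (y List.++ γ ∷ []) (Below-prefix (y List.++ γ ∷ []) c b′)) tt)
    z : Elem full
    z = elem (node (ρ zero)) (y List.++ γ ∷ []) (node-ok (ρ zero)) (Below-prefix (y List.++ γ ∷ []) c b′)
    rest : ∀ w → node w ≡ node (ρ zero) → cnf w ≡ y List.++ γ ∷ [] → Below (e (node w)) (cnf w List.++ c)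
    rest w n p = subst (λ q → Below (e q) (cnf w List.++ c)) (sym n) (subst (λ q → Below _ (q List.++ c)) (sym p) b′)

  -- Reads off the exponent of a block by testing whether y + ω^v stays inside. Any point y of the
  -- block serves, since ω^e is closed under addition.
  LongBlock : V → Fm 1
  LongBlock v = exi (ren (pick (suc zero) zero) (Next v))

  Small-LongBlock : ∀ {v} → v <ᵥ top → Small (LongBlock v)
  Small-LongBlock {v} p = Small-exi {φ = ren (pick (suc zero) zero) (Next v)} (Small-ren (pick (suc zero) zero) (Next v) (Small-Next p))

  Sat-LongBlock : ∀ {full} v (ρ : Vector (Elem full) 1) → Sat (Block full) (LongBlock v) ρ ⇔′ (v <ᵥ e (node (ρ zero)))
  Sat-LongBlock {full} v ρ =
    (λ { (z , s) → proj₂ (proj₂ (proj₁ (Sat-Next v _) (proj₁ (Sat-ren (pick (suc zero) zero) (Next v)) s))) }) ,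
    (λ p → z p , proj₂ (Sat-ren (pick (suc zero) zero) (Next v)) (proj₂ (Sat-Next v _) (refl , refl , p)))
    where
    z : v <ᵥ e (node (ρ zero)) → Elem full
    z p = elem (node (ρ zero)) (cnf (ρ zero) ⊕ (v ∷ [])) (node-ok (ρ zero))
            (⊕-Below (cnf (ρ zero)) (v ∷ []) (cnf-ok (ρ zero)) (p , tt))

  StartsBlock : ∀ {full} → Elem full → V → Set
  StartsBlock x v = (cnf x ≡ []) × (e (node x) ≡ v)

  -- A family indexed by v, so that for v below `top` each member has rank below l. The conjunction
  -- over these v, a Π formula of level l, says that the point starts a block of exponent b.
  StartF : V → V → Fm 1
  StartF b v with em {v <ᵥ b}
  ... | yes _ = Lim v ∧ LongBlock v
  ... | no  _ = Lim v ∧ neg (LongBlock v)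

  Small-StartF : ∀ b {v} → v <ᵥ top → Small (StartF b v)
  Small-StartF b {v} p with em {v <ᵥ b}
  ... | yes _ = Small-∧ {φ = Lim v} {LongBlock v} (Small-Lim p) (Small-LongBlock p)
  ... | no  _ = Small-∧ {φ = Lim v} {neg (LongBlock v)} (Small-Lim p) (Small-neg {φ = LongBlock v} (Small-LongBlock p))

  entries<top : ∀ {b} c → Below b c → All (_<ᵥ top) c
  entries<top []      h       = []
  entries<top (x ∷ c) (p , h) = x<top ∷ entries<top c (Desc⇒Below c x<top h)
    where
    x<top = <-≤ᵥ p top-maximal

  StartF⇒ : ∀ {full} b (ρ : Vector (Elem full) 1) → (∀ v → v <ᵥ top → Sat (Block full) (StartF b v) ρ) → StartsBlock (ρ zero) b
  StartF⇒ {full} b ρ h = empty (cnf (ρ zero)) (entries<top _ (cnf-ok (ρ zero))) (λ v p → proj₁ (both v p)) , colour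
    where
    both : ∀ v → v <ᵥ top → IsLim v (ρ zero) × ((v <ᵥ b) ⇔′ (v <ᵥ e (node (ρ zero))))
    both v p with em {v <ᵥ b} | h v p
    ... | yes q | s = proj₁ (Sat-Lim v ρ) (s 0) , (λ _ → proj₁ (Sat-LongBlock v ρ) (s 1)) , (λ _ → q)
    ... | no ¬q | s = proj₁ (Sat-Lim v ρ) (s 0) , (λ q → ⊥-elim (¬q q)) , (λ q → ⊥-elim (s 1 (proj₂ (Sat-LongBlock v ρ) q)))
    empty : ∀ c → All (_<ᵥ top) c → (∀ v → v <ᵥ top → All (_≮ᵥ v) c) → c ≡ []
    empty []      _       k = refl
    -- As l is a limit, there is an exponent strictly between x and `top`, and divisibility by its
    -- power of ω rules out the entry x.
    empty (x ∷ c) (p ∷ _) k with next p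
    ... | w , x<w , w<top = ⊥-elim (All.head (k w w<top) x<w)
    colour : e (node (ρ zero)) ≡ b
    colour with cmpᵥ (e (node (ρ zero))) b
    ... | tri≈ _ p _ = p
    ... | tri< p _ _ = ⊥-elim (<ᵥ-irrefl (proj₁ (proj₂ (both _ (<-≤ᵥ p top-maximal))) p))
    ... | tri> _ _ p = ⊥-elim (<ᵥ-irrefl (proj₂ (proj₂ (both _ (<-≤ᵥ p top-maximal))) p))

  ⇒StartF : ∀ {full} b (ρ : Vector (Elem full) 1) v → StartsBlock (ρ zero) b → Sat (Block full) (StartF b v) ρ
  ⇒StartF b ρ v (c , refl) with em {v <ᵥ b}
  ... | yes q = λ { zero → proj₂ (Sat-Lim v ρ) (subst (All _) (sym c) []) ; (suc _) → proj₂ (Sat-LongBlock v ρ) q }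
  ... | no ¬q = λ { zero → proj₂ (Sat-Lim v ρ) (subst (All _) (sym c) []) ; (suc _) → ¬q ∘ proj₁ (Sat-LongBlock v ρ) }

  -- The two orderings are not isomorphic

  singleton : {X : Set} → X → Vector X 1
  singleton x _ = x

  root : Elem true
  root = start [] tt

  top-left : ∀ {full} q → Valid full q → e q ≡ top → q <ᴵ []
  top-left []          v p = ⊥-elim (<ᵥ-irrefl (subst (v₀ <ᵥ_) (sym p) v₀<top))
  top-left (false ∷ q) v p = tt
  top-left (true ∷ q)  v p = ⊥-elim (<ᵥ-irrefl (subst (_<ᵥ top) p v))

  -- The starts of the blocks ω^top have a least upper bound in Block true (the root), but not in Block false.
  not-isomorphic : ¬ (Block false ≅ Block true)
  not-isomorphic iso = impossible (node x₀) refl (node-ok x₀)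
    where
    open Isomorphic (Block false) (Block true) iso

    x₀ : Elem false
    x₀ = g root

    starts : ∀ x → StartsBlock x top ⇔′ StartsBlock (f x) top
    starts x =
      (λ h → StartF⇒ top (singleton (f x)) λ v p →
        proj₁ (Sat-≅ (Block false) (Block true) iso (StartF top v) (singleton x) _ (λ _ → refl)) (⇒StartF top (singleton x) v h)) ,
      (λ h → StartF⇒ top (singleton x) λ v p →
        proj₂ (Sat-≅ (Block false) (Block true) iso (StartF top v) (singleton x) _ (λ _ → refl)) (⇒StartF top (singleton (f x)) v h))

    f-mono : ∀ {x y} → x <ᴱ y → f x <ᴱ f y
    f-mono {x} {y} = proj₁ (proj₂ iso x y)

    f-reflect : ∀ {x y} → f x <ᴱ f y → x <ᴱ y
    f-reflect {x} {y} = proj₂ (proj₂ iso x y)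

    top-below-root : ∀ z → StartsBlock z top → ¬ (root <ᴱ z)
    top-below-root z (_ , t) (inj₁ p)       = <ᴵ-irrefl [] (<ᴵ-trans [] (node z) [] p (top-left (node z) (node-ok z) t))
    top-below-root z (c , _) (inj₂ (_ , p)) = <ᴸ-irrefl [] (subst ([] <ᴸ_) c p)

    topStart : ∀ full q → q <ᴵ [] → Σ (Elem full) λ z → StartsBlock z top × (q <ᴵ node z) × (node z <ᴵ [])
    topStart full q p with dense (just q) (just []) top p
    ... | q′ , a , b , c , n = start q′ (valid full q′ n (inj₂ b)) , (refl , c) , a , b

    impossible : ∀ q → node x₀ ≡ q → Valid false q → ⊥
    -- In the left half, the preimage of the root is not an upper bound of the starts of blocks
    -- ω^top.
    impossible (false ∷ w) n v with topStart false (false ∷ w) tt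
    ... | z , s , a , _ = top-below-root (f z) (proj₁ (starts z) s)
      (subst (_<ᴱ f z) (f∘g root) (f-mono {x₀} {z} (inj₁ (subst (_<ᴵ node z) (sym n) a))))
    -- In the right half, it is not the least one: y is a smaller upper bound.
    impossible (true ∷ w) n v with dense-valid false (just []) (just (true ∷ w)) v₀ tt v₀<top
    ... | q , a , b , _ , qv with topStart true (node (f y)) (below-root {f y} fy<root)
      where
      y : Elem false
      y = start q qv
      fy<root : f y <ᴱ root
      fy<root = subst (f y <ᴱ_) (f∘g root) (f-mono {y} {x₀} (inj₁ (subst (q <ᴵ_) (sym n) b)))
      below-root : ∀ {z} → z <ᴱ root → node z <ᴵ []
      below-root (inj₁ p) = p
      below-root {elem _ [] _ _} (inj₂ (_ , ()))
      below-root {elem _ (_ ∷ _) _ _} (inj₂ (_ , ()))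
    ...   | z , s , c , _ = contradict (f-reflect {y} {g z} (inj₁ (subst (λ z → node (f y) <ᴵ node z) (sym (f∘g z)) c)))
      where
      y : Elem false
      y = start q qv
      gz-left : node (g z) <ᴵ []
      gz-left = top-left (node (g z)) (node-ok (g z))
        (proj₂ (proj₂ (starts (g z)) (subst (λ z → StartsBlock z top) (sym (f∘g z)) s)))
      contradict : ¬ (y <ᴱ g z)
      contradict (inj₁ p) = <ᴵ-irrefl [] (<ᴵ-trans [] q [] a (<ᴵ-trans q (node (g z)) [] p gz-left))
      contradict (inj₂ (p , _)) = <ᴵ-irrefl [] (<ᴵ-trans [] q [] a (subst (_<ᴵ []) (sym p) gz-left))

  -- Homogeneity of the coloured tree over its root

  NodePairs : Set
  NodePairs = List (Node × Node)

  OrderIso : NodePairs → Set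
  OrderIso P = ∀ {p q} → p ∈ P → q ∈ P → (proj₁ p <ᴵ proj₁ q) ⇔′ (proj₂ p <ᴵ proj₂ q)

  least-above : ∀ (P : NodePairs) q → (∀ {p} → p ∈ P → ¬ (q <ᴵ proj₁ p)) ⊎
    Σ (Node × Node) λ h → (h ∈ P) × (q <ᴵ proj₁ h) × (∀ {p} → p ∈ P → q <ᴵ proj₁ p → ¬ (proj₁ p <ᴵ proj₁ h))
  least-above [] q = inj₁ λ ()
  least-above (p ∷ P) q with em {q <ᴵ proj₁ p} | least-above P q
  ... | no ¬a | inj₁ none = inj₁ λ { (here refl) → ¬a ; (there m) → none m }
  ... | no ¬a | inj₂ (h , hm , hq , hl) = inj₂ (h , there hm , hq ,
          λ { (here refl) a → ⊥-elim (¬a a) ; (there m) a → hl m a })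
  ... | yes a | inj₁ none = inj₂ (p , here refl , a ,
          λ { (here refl) _ → <ᴵ-irrefl (proj₁ p) ; (there m) b → ⊥-elim (none m b) })
  ... | yes a | inj₂ (h , hm , hq , hl) with em {proj₁ p <ᴵ proj₁ h}
  ...   | yes c = inj₂ (p , here refl , a , λ
            { (here refl) _ → <ᴵ-irrefl (proj₁ p)
            ; {p′} (there m) b d → hl m b (<ᴵ-trans (proj₁ p′) (proj₁ p) (proj₁ h) d c) })
  ...   | no ¬c = inj₂ (h , there hm , hq , λ { (here refl) _ → ¬c ; (there m) b → hl m b })

  greatest-below : ∀ (P : NodePairs) q → (∀ {p} → p ∈ P → ¬ (proj₁ p <ᴵ q)) ⊎
    Σ (Node × Node) λ h → (h ∈ P) × (proj₁ h <ᴵ q) × (∀ {p} → p ∈ P → proj₁ p <ᴵ q → ¬ (proj₁ h <ᴵ proj₁ p))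
  greatest-below [] q = inj₁ λ ()
  greatest-below (p ∷ P) q with em {proj₁ p <ᴵ q} | greatest-below P q
  ... | no ¬a | inj₁ none = inj₁ λ { (here refl) → ¬a ; (there m) → none m }
  ... | no ¬a | inj₂ (h , hm , hq , hl) = inj₂ (h , there hm , hq ,
          λ { (here refl) a → ⊥-elim (¬a a) ; (there m) a → hl m a })
  ... | yes a | inj₁ none = inj₂ (p , here refl , a ,
          λ { (here refl) _ → <ᴵ-irrefl (proj₁ p) ; (there m) b → ⊥-elim (none m b) })
  ... | yes a | inj₂ (h , hm , hq , hl) with em {proj₁ h <ᴵ proj₁ p}
  ...   | yes c = inj₂ (p , here refl , a , λ
            { (here refl) _ → <ᴵ-irrefl (proj₁ p)
            ; {p′} (there m) b d → hl m b (<ᴵ-trans (proj₁ h) (proj₁ p) (proj₁ p′) c d) })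
  ...   | no ¬c = inj₂ (h , there hm , hq , λ { (here refl) _ → ¬c ; (there m) b → hl m b })

  ≮<-trans : ∀ u v w → ¬ (v <ᴵ u) → v <ᴵ w → u <ᴵ w
  ≮<-trans u v w n p with cmpᴵ u v
  ... | tri< a _ _    = <ᴵ-trans u v w a p
  ... | tri≈ _ refl _ = p
  ... | tri> _ _ a    = ⊥-elim (n a)

  <≮-trans : ∀ u v w → u <ᴵ v → ¬ (w <ᴵ v) → u <ᴵ w
  <≮-trans u v w p n with cmpᴵ v w
  ... | tri< a _ _    = <ᴵ-trans u v w p a
  ... | tri≈ _ refl _ = p
  ... | tri> _ _ a    = ⊥-elim (n a)

  module _ (P : NodePairs) (iso : OrderIso P) (roots : ([] , []) ∈ P)
           (valid₂ : ∀ {p} → p ∈ P → Valid true (proj₂ p)) (colours : ∀ {p} → p ∈ P → e (proj₂ p) ≡ e (proj₁ p)) where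

    extend-known : ∀ {q q′} → (q , q′) ∈ P → OrderIso ((q , q′) ∷ P)
    extend-known m a b = iso (old a) (old b)
      where
      old : ∀ {p} → p ∈ (_ ∷ P) → p ∈ P
      old (here refl) = m
      old (there k)   = k

    -- The nearest related nodes on both sides of q determine a gap on the other side, and every gap
    -- contains every colour. That P fixes the root makes the choice valid also for the colour
    -- `top`.
    extend-fresh : ∀ q → Valid true q → (∀ {p} → p ∈ P → ¬ (proj₁ p ≡ q)) →
                   Σ Node λ q′ → Valid true q′ × (e q′ ≡ e q) × OrderIso ((q , q′) ∷ P)
    extend-fresh q qv fresh = finish (greatest-below P q) (least-above P q)
      where
      module _ (lo hi : Maybe Node) (gap : Gap lo hi)
               (lower : ∀ {p} → p ∈ P → proj₁ p <ᴵ q → ∀ q′ → q′ ≻lo lo → proj₂ p <ᴵ q′)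
               (upper : ∀ {p} → p ∈ P → q <ᴵ proj₁ p → ∀ q′ → q′ ≺hi hi → q′ <ᴵ proj₂ p) where
        choose : Σ Node λ q′ → Valid true q′ × (e q′ ≡ e q) × OrderIso ((q , q′) ∷ P)
        choose with dense lo hi (e q) gap
        ... | q′ , a , b , c , n = q′ , valid true q′ n side , c , iso′
          where
          side : e q′ <ᵥ top ⊎ q′ <ᴵ []
          side with cmpᵥ (e q′) top
          ... | tri< t _ _ = inj₁ t
          ... | tri> _ _ t = ⊥-elim (top-maximal t)
          -- A node of colour `top` lies left of the root; since the root is paired with itself, the
          -- new node does too.
          ... | tri≈ _ t _ = inj₂ (upper roots (top-left q qv (trans (sym c) t)) q′ b)
          iso′ : OrderIso ((q , q′) ∷ P)
          iso′ (here refl) (here refl) = (λ p → ⊥-elim (<ᴵ-irrefl q p)) , (λ p → ⊥-elim (<ᴵ-irrefl q′ p))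
          iso′ {p} (there m) (there m′) = iso m m′
          iso′ {_} {p} (here refl) (there m) = (λ k → upper m k q′ b) , back′
            where
            back′ : q′ <ᴵ proj₂ p → q <ᴵ proj₁ p
            back′ k with cmpᴵ (proj₁ p) q
            ... | tri< x _ _ = ⊥-elim (<ᴵ-irrefl q′ (<ᴵ-trans q′ (proj₂ p) q′ k (lower m x q′ a)))
            ... | tri≈ _ x _ = ⊥-elim (fresh m x)
            ... | tri> _ _ x = x
          iso′ {p} (there m) (here refl) = (λ k → lower m k q′ a) , back′
            where
            back′ : proj₂ p <ᴵ q′ → proj₁ p <ᴵ q
            back′ k with cmpᴵ (proj₁ p) q
            ... | tri< x _ _ = x
            ... | tri≈ _ x _ = ⊥-elim (fresh m x)
            ... | tri> _ _ x = ⊥-elim (<ᴵ-irrefl q′ (<ᴵ-trans q′ (proj₂ p) q′ (upper m x q′ b) k))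
      finish : _ → _ → Σ Node λ q′ → Valid true q′ × (e q′ ≡ e q) × OrderIso ((q , q′) ∷ P)
      finish (inj₁ nl) (inj₁ nh) = choose nothing nothing tt (λ m x → ⊥-elim (nl m x)) (λ m x → ⊥-elim (nh m x))
      finish (inj₁ nl) (inj₂ (h , hm , hq , hl)) = choose nothing (just (proj₂ h)) tt (λ m x → ⊥-elim (nl m x))
        (λ {p} m x q′ y → <≮-trans q′ (proj₂ h) (proj₂ p) y (hl m x ∘ proj₂ (iso m hm)))
      finish (inj₂ (h , hm , hq , hl)) (inj₁ nh) = choose (just (proj₂ h)) nothing tt
        (λ {p} m x q′ y → ≮<-trans (proj₂ p) (proj₂ h) q′ (hl m x ∘ proj₂ (iso hm m)) y) (λ m x → ⊥-elim (nh m x))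
      finish (inj₂ (h , hm , hq , hl)) (inj₂ (k , km , kq , kl)) =
        choose (just (proj₂ h)) (just (proj₂ k)) (proj₁ (iso hm km) (<ᴵ-trans (proj₁ h) q (proj₁ k) hq kq))
          (λ {p} m x q′ y → ≮<-trans (proj₂ p) (proj₂ h) q′ (hl m x ∘ proj₂ (iso hm m)) y)
          (λ {p} m x q′ y → <≮-trans q′ (proj₂ k) (proj₂ p) y (kl m x ∘ proj₂ (iso m km)))

    extend-iso : ∀ q → Valid true q → Σ Node λ q′ → Valid true q′ × (e q′ ≡ e q) × OrderIso ((q , q′) ∷ P)
    extend-iso q qv with em {Σ Node λ q′ → (q , q′) ∈ P}
    ... | yes (q′ , m) = q′ , valid₂ m , colours m , extend-known m
    ... | no none = extend-fresh q qv λ { m refl → none (_ , m) }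

  -- The Scott sentence

  module _ {n} (C : V → Fm n) (small : ∀ {v} → v <ᵥ top → Small (C v)) where

    conjunct : ∀ v → Dec (v <ᵥ top) → Maybe (AllPart l n)
    conjunct v (yes p) = just (all _ (small p) 0 (tr (C v)))
    conjunct v (no _)  = nothing

    conjunction : PiF l n
    conjunction = bigAnd λ m → conjunct (proj₁ enumV m) em

    sat-conjunction : ∀ S ρ → satΠ S conjunction ρ ⇔′ (∀ v → v <ᵥ top → Sat S (C v) ρ)
    sat-conjunction S ρ = to , λ h m → from (proj₁ enumV m) em (h _)
      where
      use : ∀ v (dec : Dec (v <ᵥ top)) → satMAll S (conjunct v dec) ρ → v <ᵥ top → Sat S (C v) ρ
      use v (yes _) s p = proj₁ (sat-tr (C v) ρ) (s ε)
      use v (no ¬p) s p = ⊥-elim (¬p p)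
      to : satΠ S conjunction ρ → ∀ v → v <ᵥ top → Sat S (C v) ρ
      to s v with proj₂ enumV v
      ... | m , refl = use _ em (s m)
      from : ∀ v (dec : Dec (v <ᵥ top)) → (v <ᵥ top → Sat S (C v) ρ) → satMAll S (conjunct v dec) ρ
      from v (yes p) h σ = proj₂ (sat-tr (C v) ρ) (h p)
      from v (no _)  h   = tt

    module _ (ψ : ℕ → ExPart (suc l) n) where

      failure : ∀ v → Dec (v <ᵥ top) → Maybe (ExPart (suc l) n)
      failure v (yes p) = just (ex _ (≤-trans (small p) ≤-suc) 0 (negΣ (tr (C v))))
      failure v (no _)  = nothing

      disjunct : ℕ × ℕ → Maybe (ExPart (suc l) n)
      disjunct (zero  , m) = failure (proj₁ enumV m) em
      disjunct (suc _ , m) = just (ψ m)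

      -- The premise is the conjunction of all C v, of level l. Its negation is a disjunction of Π
      -- formulas of levels below l and can join the disjunction of the ψ m, whence the level l + 1.
      implication : SigmaF (suc l) n
      implication = bigOr (disjunct ∘ unpair)

      sat-implication : ∀ S ρ → satΣ S implication ρ ⇔′
        ((∀ v → v <ᵥ top → Sat S (C v) ρ) → Σ ℕ λ m → satMEx S (just (ψ m)) ρ)
      sat-implication S ρ = (λ { (i , s) h → to (unpair i) s h }) , from
        where
        refute : ∀ v (dec : Dec (v <ᵥ top)) → satMEx S (failure v dec) ρ → (v <ᵥ top → Sat S (C v) ρ) → ⊥
        refute v (yes p) (_ , s) h = proj₁ (sat-negΣ (tr (C v)) ρ) s (proj₂ (sat-tr (C v) ρ) (h p))
        to : ∀ d → satMEx S (disjunct d) ρ → (∀ v → v <ᵥ top → Sat S (C v) ρ) → Σ ℕ λ m → satMEx S (just (ψ m)) ρ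
        to (zero  , m) s h = ⊥-elim (refute (proj₁ enumV m) em s (h _))
        to (suc _ , m) s h = m , s
        at : ∀ d → satMEx S (disjunct d) ρ → satΣ S implication ρ
        at d s with unpair-surjective d
        ... | i , refl = i , s
        fail : ∀ v (dec : Dec (v <ᵥ top)) → v <ᵥ top → ¬ Sat S (C v) ρ → satMEx S (failure v dec) ρ
        fail v (yes _) p h = ε , proj₂ (sat-negΣ (tr (C v)) ρ) (h ∘ proj₁ (sat-tr (C v) ρ))
        fail v (no ¬p) p h = ⊥-elim (¬p p)
        from : ((∀ v → v <ᵥ top → Sat S (C v) ρ) → Σ ℕ λ m → satMEx S (just (ψ m)) ρ) → satΣ S implication ρ
        from h with em {∀ v → v <ᵥ top → Sat S (C v) ρ}
        ... | yes a = at (1 , proj₁ (h a)) (proj₂ (h a))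
        ... | no ¬a with ¬∀⇒∃¬ ¬a
        ...   | v , ¬b with proj₂ enumV v
        ...     | m , refl = at (0 , m) (fail _ em (byContradiction λ ¬p → ¬b λ p → ⊥-elim (¬p p)) λ s → ¬b λ _ → s)

  A : Set
  A = Elem true

  -- A list of elements is described by two variables for each of them, its block's start and itself,
  -- followed by one variable for the parameter.
  K : List A → ℕ
  K []      = 0
  K (x ∷ b) = suc (suc (K b))

  startOf : A → A
  startOf x = start (node x) (node-ok x)

  env : ∀ b → Vector A (K b + 1)
  env []      _             = root
  env (x ∷ b) zero          = startOf x
  env (x ∷ b) (suc zero)    = x
  env (x ∷ b) (suc (suc i)) = env b i

  Item : A → V → Fm 2
  Item x v = ren (λ _ → zero) (StartF (e (node x)) v) ∧ Word (cnf x)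

  Items : ∀ b → V → Fm (K b + 1)
  Items []      v = atom tt
  Items (x ∷ b) v = ren (pick zero (suc zero)) (Item x v) ∧ ren shift₂ (Items b v)

  literal : ∀ {n} → QF n → Vector A n → Fm n
  literal q ρ with em {satQF (Block true) q ρ}
  ... | yes _ = atom q
  ... | no  _ = atom (neg q)

  Diagram : ∀ b → Fm (K b + 1)
  Diagram b = ⋀ λ i → ⋀ λ j → literal (lt i j) (env b) ∧ literal (eq i j) (env b)

  -- One conjunct of the description of the list b over the parameter. Only the `StartF` parts vary
  -- with v; diagram and words are repeated, so that a single family of formulas of rank below l
  -- suffices.
  Cond : ∀ b → V → Fm (K b + 1)
  Cond b v = Diagram b ∧ Items b v

  Small-Item : ∀ x {v} → v <ᵥ top → Small (Item x v)
  Small-Item x {v} p = Small-∧ {φ = ren (λ _ → zero) (StartF (e (node x)) v)} {Word (cnf x)}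
    (Small-ren (λ _ → zero) (StartF (e (node x)) v) (Small-StartF (e (node x)) p))
    (Small-Word (cnf x) (entries<top (cnf x) (cnf-ok x)))

  Small-Items : ∀ b {v} → v <ᵥ top → Small (Items b v)
  Small-Items []      p = 0<l
  Small-Items (x ∷ b) {v} p = Small-∧ {φ = ren (pick zero (suc zero)) (Item x v)} {ren shift₂ (Items b v)}
    (Small-ren (pick zero (suc zero)) (Item x v) (Small-Item x p)) (Small-ren shift₂ (Items b v) (Small-Items b p))

  Small-literal : ∀ {n} (q : QF n) ρ → Small (literal q ρ)
  Small-literal q ρ with em {satQF (Block true) q ρ}
  ... | yes _ = 0<l
  ... | no  _ = 0<l

  Small-Diagram : ∀ b → Small (Diagram b)
  Small-Diagram b = Small-⋀ (λ i → ⋀ (cell i)) λ i → Small-⋀ (cell i) λ j →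
    Small-∧ {φ = literal (lt i j) (env b)} {literal (eq i j) (env b)} (Small-literal (lt i j) (env b)) (Small-literal (eq i j) (env b))
    where
    cell : ∀ i j → Fm (K b + 1)
    cell i j = literal (lt i j) (env b) ∧ literal (eq i j) (env b)

  Small-Cond : ∀ b {v} → v <ᵥ top → Small (Cond b v)
  Small-Cond b {v} p = Small-∧ {φ = Diagram b} {Items b v} (Small-Diagram b) (Small-Items b p)

  Sat-literal : ∀ S {n} (q : QF n) ρ ρ′ → Sat S (literal q ρ) ρ′ ⇔′ (satQF (Block true) q ρ ⇔′ satQF S q ρ′)
  Sat-literal S q ρ ρ′ with em {satQF (Block true) q ρ}
  ... | yes p = (λ s → (λ _ → s) , (λ _ → p)) , (λ h → proj₁ h p)
  ... | no ¬p = (λ s → (λ p → ⊥-elim (¬p p)) , (λ t → ⊥-elim (s t))) , (λ h → ¬p ∘ proj₂ h)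

  Sat-Diagram : ∀ S b ρ → Sat S (Diagram b) ρ ⇔′ SameAtoms (Block true) S (env b) ρ
  Sat-Diagram S b ρ =
    (λ s i j → let t = proj₁ (Sat-⋀ (cell i)) (proj₁ (Sat-⋀ (λ i → ⋀ (cell i))) s i) j in
      proj₁ (Sat-literal S (lt i j) (env b) ρ) (t 0) , proj₁ (Sat-literal S (eq i j) (env b) ρ) (t 1)) ,
    (λ h → proj₂ (Sat-⋀ (λ i → ⋀ (cell i))) λ i → proj₂ (Sat-⋀ (cell i)) λ j → λ
      { zero → proj₂ (Sat-literal S (lt i j) (env b) ρ) (proj₁ (h i j))
      ; (suc _) → proj₂ (Sat-literal S (eq i j) (env b) ρ) (proj₂ (h i j)) })
    where
    cell : ∀ i j → Fm (K b + 1)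
    cell i j = literal (lt i j) (env b) ∧ literal (eq i j) (env b)

  record Holds (S : Structure) (b : List A) (ρ : Vector (Carrier S) (K b + 1)) : Set where
    constructor holds
    field
      condition-true : ∀ v → v <ᵥ top → Sat S (Cond b v) ρ

  Holds-ext : ∀ S b {ρ ρ′} → (∀ i → ρ i ≡ ρ′ i) → Holds S b ρ → Holds S b ρ′
  Holds-ext S b h (holds s) = holds λ v p → proj₁ (Sat-ext {S} (Cond b v) h) (s v p)

  Holds⇒SameAtoms : ∀ S b ρ → Holds S b ρ → SameAtoms (Block true) S (env b) ρ
  Holds⇒SameAtoms S b ρ (holds h) = proj₁ (Sat-Diagram S b ρ) (h v₀ v₀<top 0)

  ItemOK : A → A → A → Set
  ItemOK x z y = StartsBlock z (e (node x)) × (node y ≡ node z) × (cnf y ≡ cnf x)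

  ItemsOK : ∀ b → Vector A (K b + 1) → Set
  ItemsOK []      ρ = ⊤
  ItemsOK (x ∷ b) ρ = ItemOK x (ρ zero) (ρ (suc zero)) × ItemsOK b (λ i → ρ (suc (suc i)))

  word-bound : ∀ (x z : A) → StartsBlock z (e (node x)) → Below (e (node z)) (cnf z List.++ cnf x)
  word-bound x z (c , d) = subst₂ (λ b w → Below b (w List.++ cnf x)) (sym d) (sym c) (cnf-ok x)

  Sat-Item : ∀ x (ρ : Vector A 2) → (∀ v → v <ᵥ top → Sat (Block true) (Item x v) ρ) ⇔′ ItemOK x (ρ zero) (ρ (suc zero))
  Sat-Item x ρ = to , from
    where
    to : (∀ v → v <ᵥ top → Sat (Block true) (Item x v) ρ) → ItemOK x (ρ zero) (ρ (suc zero))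
    to s = st , proj₁ w , trans (proj₂ w) (cong (List._++ cnf x) (proj₁ st))
      where
      st : StartsBlock (ρ zero) (e (node x))
      st = StartF⇒ (e (node x)) (λ _ → ρ zero) λ v p → proj₁ (Sat-ren (λ _ → zero) (StartF (e (node x)) v)) (s v p 0)
      w = proj₁ (Sat-Word (cnf x) ρ (word-bound x (ρ zero) st)) (s v₀ v₀<top 1)
    from : ItemOK x (ρ zero) (ρ (suc zero)) → ∀ v → v <ᵥ top → Sat (Block true) (Item x v) ρ
    from (st , n , c) v p zero    = proj₂ (Sat-ren (λ _ → zero) (StartF (e (node x)) v)) (⇒StartF (e (node x)) (λ _ → ρ zero) v st)
    from (st , n , c) v p (suc _) = proj₂ (Sat-Word (cnf x) ρ (word-bound x (ρ zero) st))
      (n , trans c (cong (List._++ cnf x) (sym (proj₁ st))))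

  Sat-Items : ∀ b ρ → (∀ v → v <ᵥ top → Sat (Block true) (Items b v) ρ) ⇔′ ItemsOK b ρ
  Sat-Items []      ρ = (λ _ → tt) , (λ _ _ _ → tt)
  Sat-Items (x ∷ b) ρ =
    (λ s → proj₁ (Sat-Item x (ρ ∘ pick zero (suc zero))) (λ v p → proj₁ (Sat-ren (pick zero (suc zero)) (Item x v)) (s v p 0)) ,
           proj₁ (Sat-Items b (λ i → ρ (suc (suc i)))) (λ v p → proj₁ (Sat-ren shift₂ (Items b v)) (s v p 1))) ,
    (λ { (i , is) v p zero → proj₂ (Sat-ren (pick zero (suc zero)) (Item x v)) (proj₂ (Sat-Item x (ρ ∘ pick zero (suc zero))) i v p)
       ; (i , is) v p (suc _) → proj₂ (Sat-ren shift₂ (Items b v)) (proj₂ (Sat-Items b (λ i → ρ (suc (suc i)))) is v p) })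

  nodePairs : ∀ b → Vector A (K b + 1) → NodePairs
  nodePairs []      ρ = ([] , node (ρ zero)) ∷ []
  nodePairs (x ∷ b) ρ = (node x , node (ρ zero)) ∷ nodePairs b (λ i → ρ (suc (suc i)))

  -- The meaning of `Holds` in `Block true` when the parameter is the root: equal positions in
  -- blocks of equal exponent, with the nodes in the same order. The homogeneity of the tree gives
  -- this relation the extension properties `Match-forth` and `Match-back`.
  record Match b (ρ : Vector A (K b + 1)) : Set where
    constructor match
    field
      items : ItemsOK b ρ
      order : OrderIso (nodePairs b ρ)
      last  : ρ (K b ↑ʳ zero) ≡ root

  variable-pair : ∀ b ρ → ItemsOK b ρ → ρ (K b ↑ʳ zero) ≡ root → ∀ i →
                  ((node (env b i) , node (ρ i)) ∈ nodePairs b ρ) × (cnf (env b i) ≡ cnf (ρ i))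
  variable-pair [] ρ is la zero = here refl , cong cnf (sym la)
  variable-pair (x ∷ b) ρ ((st , n , c) , is) la zero          = here refl , sym (proj₁ st)
  variable-pair (x ∷ b) ρ ((st , n , c) , is) la (suc zero)    = here (cong (node x ,_) n) , sym c
  variable-pair (x ∷ b) ρ (i , is)            la (suc (suc j)) =
    let (m , c) = variable-pair b (λ i → ρ (suc (suc i))) is la j in there m , c

  pair-variable : ∀ b ρ → ItemsOK b ρ → ρ (K b ↑ʳ zero) ≡ root → ∀ {p} → p ∈ nodePairs b ρ →
                  Σ (Fin (K b + 1)) λ i → (p ≡ (node (env b i) , node (ρ i))) × (cnf (env b i) ≡ []) × (cnf (ρ i) ≡ [])
  pair-variable [] ρ is la (here refl) = zero , refl , refl , cong cnf la
  pair-variable (x ∷ b) ρ ((st , _) , is) la (here refl) = zero , refl , refl , proj₁ st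
  pair-variable (x ∷ b) ρ (_ , is) la (there m) =
    let (i , h) = pair-variable b (λ i → ρ (suc (suc i))) is la m in suc (suc i) , h

  pair-colour : ∀ b ρ → ItemsOK b ρ → ρ (K b ↑ʳ zero) ≡ root → ∀ {p} → p ∈ nodePairs b ρ →
                (e (proj₂ p) ≡ e (proj₁ p)) × Valid true (proj₁ p) × Valid true (proj₂ p)
  pair-colour [] ρ is la (here refl) = cong (e ∘ node) la , tt , node-ok (ρ zero)
  pair-colour (x ∷ b) ρ ((st , _) , is) la (here refl) = proj₂ st , node-ok x , node-ok (ρ zero)
  pair-colour (x ∷ b) ρ (_ , is) la (there m) = pair-colour b (λ i → ρ (suc (suc i))) is la m

  root-pair : ∀ b ρ → ρ (K b ↑ʳ zero) ≡ root → ([] , []) ∈ nodePairs b ρ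
  root-pair []      ρ la = here (cong (λ x → [] , node x) (sym la))
  root-pair (x ∷ b) ρ la = there (root-pair b (λ i → ρ (suc (suc i))) la)

  OrderIso-≡ : ∀ {P} → OrderIso P → ∀ {p q} → p ∈ P → q ∈ P → (proj₁ p ≡ proj₁ q) ⇔′ (proj₂ p ≡ proj₂ q)
  OrderIso-≡ h {p} {q} m m′ = to , from
    where
    to : proj₁ p ≡ proj₁ q → proj₂ p ≡ proj₂ q
    to eq′ with cmpᴵ (proj₂ p) (proj₂ q)
    ... | tri< a _ _ = ⊥-elim (<ᴵ-irrefl (proj₁ p) (subst (proj₁ p <ᴵ_) (sym eq′) (proj₂ (h m m′) a)))
    ... | tri≈ _ a _ = a
    ... | tri> _ _ a = ⊥-elim (<ᴵ-irrefl (proj₁ p) (subst (_<ᴵ proj₁ p) (sym eq′) (proj₂ (h m′ m) a)))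
    from : proj₂ p ≡ proj₂ q → proj₁ p ≡ proj₁ q
    from eq′ with cmpᴵ (proj₁ p) (proj₁ q)
    ... | tri< a _ _ = ⊥-elim (<ᴵ-irrefl (proj₂ p) (subst (proj₂ p <ᴵ_) (sym eq′) (proj₁ (h m m′) a)))
    ... | tri≈ _ a _ = a
    ... | tri> _ _ a = ⊥-elim (<ᴵ-irrefl (proj₂ p) (subst (_<ᴵ proj₂ p) (sym eq′) (proj₁ (h m′ m) a)))

  Match⇒SameAtoms : ∀ b ρ → Match b ρ → SameAtoms (Block true) (Block true) (env b) ρ
  Match⇒SameAtoms b ρ (match is ord la) i j =
    let (mi , ci) = variable-pair b ρ is la i ; (mj , cj) = variable-pair b ρ is la j
        (lt₁ , lt₂) = ord mi mj ; (eq₁ , eq₂) = OrderIso-≡ ord mi mj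
    in ((λ { (inj₁ a) → inj₁ (lt₁ a) ; (inj₂ (a , c)) → inj₂ (eq₁ a , subst₂ _<ᴸ_ ci cj c) }) ,
        (λ { (inj₁ a) → inj₁ (lt₂ a) ; (inj₂ (a , c)) → inj₂ (eq₂ a , subst₂ _<ᴸ_ (sym ci) (sym cj) c) })) ,
       ((λ a → Elem-≡ (eq₁ (cong node a)) (trans (sym ci) (trans (cong cnf a) cj))) ,
        (λ a → Elem-≡ (eq₂ (cong node a)) (trans ci (trans (cong cnf a) (sym cj)))))

  starts-< : ∀ (x y : A) → cnf x ≡ [] → cnf y ≡ [] → x <ᴱ y → node x <ᴵ node y
  starts-< x y p q (inj₁ a)       = a
  starts-< x y p q (inj₂ (_ , a)) = ⊥-elim (<ᴸ-irrefl [] (subst₂ _<ᴸ_ p q a))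

  Holds⇒Match : ∀ b ρ → ρ (K b ↑ʳ zero) ≡ root → Holds (Block true) b ρ → Match b ρ
  Holds⇒Match b ρ la h = match is order la
    where
    is = proj₁ (Sat-Items b ρ) λ v p → Holds.condition-true h v p 1
    order : OrderIso (nodePairs b ρ)
    order m m′ with pair-variable b ρ is la m | pair-variable b ρ is la m′
    ... | i , refl , c , c′ | j , refl , d , d′ =
      (λ a → starts-< (ρ i) (ρ j) c′ d′ (proj₁ (proj₁ (Holds⇒SameAtoms (Block true) b ρ h i j)) (inj₁ a))) ,
      (λ a → starts-< (env b i) (env b j) c d (proj₂ (proj₁ (Holds⇒SameAtoms (Block true) b ρ h i j)) (inj₁ a)))

  Match⇒Holds : ∀ b ρ → Match b ρ → Holds (Block true) b ρ
  Match⇒Holds b ρ m = holds λ v p → λ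
    { zero    → proj₂ (Sat-Diagram (Block true) b ρ) (Match⇒SameAtoms b ρ m)
    ; (suc _) → proj₂ (Sat-Items b ρ) (Match.items m) v p }

  Match-forth : ∀ b ρ → Match b ρ → ∀ x → Σ A λ z → Σ A λ y → Match (x ∷ b) (z Vector.∷ y Vector.∷ ρ)
  Match-forth b ρ (match is ord la) x
    with extend-iso (nodePairs b ρ) ord (root-pair b ρ la) (λ m → proj₂ (proj₂ (pair-colour b ρ is la m)))
           (λ m → proj₁ (pair-colour b ρ is la m)) (node x) (node-ok x)
  ... | q , qv , c , ord′ = start q qv , elem q (cnf x) qv (subst (λ v → Below v (cnf x)) (sym c) (cnf-ok x)) ,
                            match (((refl , c) , refl , refl) , is) ord′ la

  Match-back : ∀ b ρ → Match b ρ → ∀ y → Σ A λ x → Σ A λ z → Match (x ∷ b) (z Vector.∷ y Vector.∷ ρ)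
  Match-back b ρ (match is ord la) y
    with extend-iso (map swap (nodePairs b ρ)) swapped (∈-map⁺ swap (root-pair b ρ la)) valid₂ colours (node y) (node-ok y)
    where
    swapped : OrderIso (map swap (nodePairs b ρ))
    swapped m m′ with ∈-map⁻ swap m | ∈-map⁻ swap m′
    ... | _ , k , refl | _ , k′ , refl = swap (ord k k′)
    valid₂ : ∀ {p} → p ∈ map swap (nodePairs b ρ) → Valid true (proj₂ p)
    valid₂ m with ∈-map⁻ swap m
    ... | _ , k , refl = proj₁ (proj₂ (pair-colour b ρ is la k))
    colours : ∀ {p} → p ∈ map swap (nodePairs b ρ) → e (proj₂ p) ≡ e (proj₁ p)
    colours m with ∈-map⁻ swap m
    ... | _ , k , refl = sym (proj₁ (pair-colour b ρ is la k))
  ... | q , qv , c , ord′ = elem q (cnf y) qv (subst (λ v → Below v (cnf y)) (sym c) (cnf-ok y)) ,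
    startOf y , match (((refl , sym c) , refl , refl) , is) (λ m m′ → swap (ord′ (flip m) (flip m′))) la
    where
    flip : ∀ {p} → p ∈ ((q , node y) ∷ nodePairs b ρ) → swap p ∈ ((node y , q) ∷ map swap (nodePairs b ρ))
    flip (here refl) = here refl
    flip (there m)   = there (∈-map⁺ swap m)

  pair-++ : ∀ {X : Set} {n} (σ : Vector X 2) (ρ : Vector X n) i →
            (σ zero Vector.∷ σ (suc zero) Vector.∷ ρ) i ≡ (σ ++ ρ) i
  pair-++ σ ρ zero          = refl
  pair-++ σ ρ (suc zero)    = refl
  pair-++ σ ρ (suc (suc i)) = refl

  insert-++ : ∀ {X : Set} {k n} (z : Vector X 1) (σ : Vector X (suc k)) (ρ : Vector X n) i →
              (z zero Vector.∷ σ zero Vector.∷ (σ ∘ suc ++ ρ)) i ≡ (z ++ (σ ++ ρ)) i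
  insert-++ z σ ρ zero          = refl
  insert-++ z σ ρ (suc zero)    = refl
  insert-++ z σ ρ (suc (suc i)) = sym (++-tail σ ρ i)

  opaque
    enumA : Enumeration A
    enumA = Block-countable true

    enumB : Enumeration (List A)
    enumB = enum-List enumA

  -- The new point is `σ zero`, universally quantified. Its counterpart in the ordering is found
  -- through the countable disjunction over m, so only the start of its block needs an existential
  -- quantifier.
  BackStep : ∀ S b → Vector (Carrier S) 1 → Set
  BackStep S b ρ = ∀ (σ : Vector (Carrier S) (suc (K b))) → Holds S b (σ ∘ suc ++ ρ) →
    Σ ℕ λ m → Σ (Vector (Carrier S) 1) λ z →
      Holds S (proj₁ enumA m ∷ b) (z zero Vector.∷ σ zero Vector.∷ (σ ∘ suc ++ ρ))

  ForthStep : ∀ S b → A → Vector (Carrier S) 1 → Set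
  ForthStep S b x ρ = ∀ (σ : Vector (Carrier S) (K b)) → Holds S b (σ ++ ρ) →
    Σ (Vector (Carrier S) 2) λ w → Holds S (x ∷ b) (w zero Vector.∷ w (suc zero) Vector.∷ (σ ++ ρ))

  opaque
    condition : ∀ b → PiF l (K b + 1)
    condition b = conjunction (Cond b) (Small-Cond b)

    baseAxiom : AllPart (suc (suc l)) 1
    -- The trivial premise merely lifts the Π condition of level l to a Σ formula of level l + 1.
    baseAxiom = all (suc l) ≤-refl 0 (implication (λ _ → atom tt) (λ _ → 0<l) λ _ → ex l ≤-refl 0 (condition []))

    forthAxiom : List A → A → AllPart (suc (suc l)) 1
    forthAxiom b x = all (suc l) ≤-refl (K b) (implication (Cond b) (Small-Cond b) λ _ → ex l ≤-refl 2 (condition (x ∷ b)))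

    weakened : ∀ b → V → Fm (suc (K b + 1))
    weakened b v = ren suc (Cond b v)

    Small-weakened : ∀ b {v} → v <ᵥ top → Small (weakened b v)
    Small-weakened b {v} p = Small-ren suc (Cond b v) (Small-Cond b p)

    backAxiom : List A → AllPart (suc (suc l)) 1
    backAxiom b = all (suc l) ≤-refl (suc (K b)) (implication (weakened b) (Small-weakened b) λ m →
      ex l ≤-refl 1 (condition (proj₁ enumA m ∷ b)))

    sat-condition : ∀ S b ρ → satΠ S (condition b) ρ ⇔′ Holds S b ρ
    sat-condition S b ρ = let (to , from) = sat-conjunction (Cond b) (Small-Cond b) S ρ in holds ∘ to , from ∘ Holds.condition-true

    sat-backAxiom : ∀ S b ρ → satMAll S (just (backAxiom b)) ρ ⇔′ BackStep S b ρ
    sat-backAxiom S b ρ = to , from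
      where
      to : satMAll S (just (backAxiom b)) ρ → BackStep S b ρ
      to s σ h with proj₁ (sat-implication (weakened b) (Small-weakened b) _ S (σ ++ ρ)) (s σ)
                     (λ v p → proj₂ (Sat-ren suc (Cond b v))
                       (Holds.condition-true (Holds-ext S b (λ i → sym (++-tail σ ρ i)) h) v p))
      ... | m , z , t = m , z , Holds-ext S (proj₁ enumA m ∷ b) (λ i → sym (insert-++ z σ ρ i))
                                  (proj₁ (sat-condition S (proj₁ enumA m ∷ b) (z ++ (σ ++ ρ))) t)
      from : BackStep S b ρ → satMAll S (just (backAxiom b)) ρ
      from h σ = proj₂ (sat-implication (weakened b) (Small-weakened b) _ S (σ ++ ρ)) λ s →
        let (m , z , t) = h σ (Holds-ext S b (++-tail σ ρ) (holds λ v p → proj₁ (Sat-ren suc (Cond b v)) (s v p)))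
        in m , z , proj₂ (sat-condition S (proj₁ enumA m ∷ b) (z ++ (σ ++ ρ)))
                     (Holds-ext S (proj₁ enumA m ∷ b) (insert-++ z σ ρ) t)

    sat-forthAxiom : ∀ S b x ρ → satMAll S (just (forthAxiom b x)) ρ ⇔′ ForthStep S b x ρ
    sat-forthAxiom S b x ρ = to , from
      where
      to : satMAll S (just (forthAxiom b x)) ρ → ForthStep S b x ρ
      to s σ (holds h) with proj₁ (sat-implication (Cond b) (Small-Cond b) _ S (σ ++ ρ)) (s σ) h
      ... | _ , w , t = w , Holds-ext S (x ∷ b) (λ i → sym (pair-++ w (σ ++ ρ) i))
                              (proj₁ (sat-condition S (x ∷ b) (w ++ (σ ++ ρ))) t)
      from : ForthStep S b x ρ → satMAll S (just (forthAxiom b x)) ρ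
      from h σ = proj₂ (sat-implication (Cond b) (Small-Cond b) _ S (σ ++ ρ)) λ s →
        let (w , t) = h σ (holds s) in 0 , w , proj₂ (sat-condition S (x ∷ b) (w ++ (σ ++ ρ)))
                                         (Holds-ext S (x ∷ b) (pair-++ w (σ ++ ρ)) t)

    sat-baseAxiom : ∀ S (ρ : Vector (Carrier S) 1) → satMAll S (just baseAxiom) ρ ⇔′ Holds S [] ρ
    sat-baseAxiom S ρ =
      (λ s → let (_ , _ , t) = proj₁ (sat-implication (λ _ → atom tt) (λ _ → 0<l) _ S ρ) (s ε) (λ _ _ → tt)
             in proj₁ (sat-condition S [] ρ) t) ,
      (λ h σ → proj₂ (sat-implication (λ _ → atom tt) (λ _ → 0<l) _ S ρ) λ _ →
                 0 , ε , proj₂ (sat-condition S [] ρ) h)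

  axiom : ℕ × ℕ → AllPart (suc (suc l)) 1
  axiom (zero        , _) = baseAxiom
  axiom (suc zero    , n) = backAxiom (proj₁ enumB n)
  axiom (suc (suc _) , n) = forthAxiom (proj₁ enumB (proj₁ (unpair n))) (proj₁ enumA (proj₂ (unpair n)))

  axioms : PiF (suc (suc l)) 1
  axioms = bigAnd λ m → just (axiom (unpair m))

  -- The levels add up as follows: conditions are Π at l, implications between them Σ at l + 1,
  -- their universal closures Π at l + 2, and quantifying the parameter gives Σ at l + 3.
  scottSentence : SigmaF (suc (suc (suc l))) 0
  scottSentence = bigOr λ _ → just (ex (suc (suc l)) ≤-refl 1 axioms)

  axioms-true : satΠ (Block true) axioms (λ _ → root)
  axioms-true m = go (unpair m)
    where
    ρ₁ : Vector A 1
    ρ₁ _ = root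
    go : ∀ d → satMAll (Block true) (just (axiom d)) ρ₁
    go (zero , _) = proj₂ (sat-baseAxiom (Block true) ρ₁) (Match⇒Holds [] ρ₁ (match tt order refl))
      where
      order : OrderIso (([] , []) ∷ [])
      order (here refl) (here refl) = id , id
    go (suc zero , n) = proj₂ (sat-backAxiom (Block true) b ρ₁) reply-back
      where
      b : List A
      b = proj₁ enumB n
      reply-back : BackStep (Block true) b ρ₁
      reply-back σ h with Match-back b (σ ∘ suc ++ ρ₁) (Holds⇒Match b (σ ∘ suc ++ ρ₁) (++-last (σ ∘ suc) ρ₁) h) (σ zero)
      ... | x , z , mt with proj₂ enumA x
      ...   | k , refl = k , (λ _ → z) , Match⇒Holds (x ∷ b) (z Vector.∷ σ zero Vector.∷ (σ ∘ suc ++ ρ₁)) mt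
    go (suc (suc _) , n) = proj₂ (sat-forthAxiom (Block true) b x ρ₁) reply-forth
      where
      b : List A
      b = proj₁ enumB (proj₁ (unpair n))
      x : A
      x = proj₁ enumA (proj₂ (unpair n))
      reply-forth : ForthStep (Block true) b x ρ₁
      reply-forth σ h with Match-forth b (σ ++ ρ₁) (Holds⇒Match b (σ ++ ρ₁) (++-last σ ρ₁) h) x
      ... | z , y , mt = z Vector.∷ y Vector.∷ (λ _ → y) , Match⇒Holds (x ∷ b) (z Vector.∷ y Vector.∷ (σ ++ ρ₁)) mt

  -- Countable models of the axioms

  module _ (M : Structure) (enumM : Enumeration (Carrier M)) (ρ₁ : Vector (Carrier M) 1) (true-in-M : satΠ M axioms ρ₁) where

    at-axiom : ∀ d → satMAll M (just (axiom d)) ρ₁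
    at-axiom d with unpair-surjective d
    ... | m , p = subst (λ d → satMAll M (just (axiom d)) ρ₁) p (true-in-M m)

    backM : ∀ b → satMAll M (just (backAxiom b)) ρ₁
    backM b with proj₂ enumB b
    ... | n , refl = at-axiom (1 , n)

    forthM : ∀ b x → satMAll M (just (forthAxiom b x)) ρ₁
    forthM b x with proj₂ enumB b | proj₂ enumA x
    ... | n , refl | k , refl with unpair-surjective (n , k)
    ...   | m , p = subst (λ q → satMAll M (just (forthAxiom (proj₁ enumB (proj₁ q)) (proj₁ enumA (proj₂ q)))) ρ₁) p (at-axiom (2 , m))

    elementPairs : ∀ b → Vector (Carrier M) (K b) → List (A × Carrier M)
    elementPairs []      τ = []
    elementPairs (x ∷ b) τ = (x , τ (suc zero)) ∷ elementPairs b (λ i → τ (suc (suc i)))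

    Related : List (A × Carrier M) → Set
    Related L = Σ (List A) λ b → Σ (Vector (Carrier M) (K b)) λ τ → Holds M b (τ ++ ρ₁) × (L ≡ elementPairs b τ)

    cons₂-++ : ∀ {k} z y (τ : Vector (Carrier M) k) i →
               (z Vector.∷ y Vector.∷ (τ ++ ρ₁)) i ≡ ((z Vector.∷ y Vector.∷ τ) ++ ρ₁) i
    cons₂-++ z y τ zero          = refl
    cons₂-++ z y τ (suc zero)    = refl
    cons₂-++ z y τ (suc (suc i)) = sym (trans (++-tail (z Vector.∷ y Vector.∷ τ) ρ₁ (suc i)) (++-tail (y Vector.∷ τ) ρ₁ i))

    related-forth : ∀ {L} → Related L → ∀ x → Σ (Carrier M) λ m → Related ((x , m) ∷ L)
    related-forth (b , τ , h , refl) x with proj₁ (sat-forthAxiom M b x ρ₁) (forthM b x) τ h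
    ... | w , t = w (suc zero) , x ∷ b , (w zero Vector.∷ w (suc zero) Vector.∷ τ) ,
                  Holds-ext M (x ∷ b) (cons₂-++ (w zero) (w (suc zero)) τ) t , refl

    related-back : ∀ {L} → Related L → ∀ m → Σ A λ x → Related ((x , m) ∷ L)
    related-back (b , τ , h , refl) y with proj₁ (sat-backAxiom M b ρ₁) (backM b) (y Vector.∷ τ) h
    ... | k , z , t = proj₁ enumA k , proj₁ enumA k ∷ b , (z zero Vector.∷ y Vector.∷ τ) ,
                      Holds-ext M (proj₁ enumA k ∷ b) (cons₂-++ (z zero) y τ) t , refl

    pair-index : ∀ b (τ : Vector (Carrier M) (K b)) {x m} → (x , m) ∈ elementPairs b τ →
                 Σ (Fin (K b + 1)) λ i → (env b i ≡ x) × ((τ ++ ρ₁) i ≡ m)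
    pair-index (x ∷ b) τ (here refl) = suc zero , refl , refl
    pair-index (x ∷ b) τ (there m) = let (i , p , q) = pair-index b (λ i → τ (suc (suc i))) m in
      suc (suc i) , p , trans (trans (++-tail τ ρ₁ (suc i)) (++-tail (τ ∘ suc) ρ₁ i)) q

    related-atoms : ∀ {L} → Related L → ∀ {x m x′ m′} → (x , m) ∈ L → (x′ , m′) ∈ L →
                    ((x <ᴱ x′) ⇔′ _≺_ M m m′) × ((x ≡ x′) ⇔′ (m ≡ m′))
    related-atoms (b , τ , h , refl) p q with pair-index b τ p | pair-index b τ q
    ... | i , refl , refl | j , refl , refl = Holds⇒SameAtoms M b (τ ++ ρ₁) h i j

    models-isomorphic : M ≅ Block true
    models-isomorphic = BackAndForth.isomorphism (Block true) M enumA enumM Related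
      ([] , ε , Holds-ext M [] (λ i → refl) (proj₁ (sat-baseAxiom M ρ₁) (at-axiom (0 , 0))) , refl)
      related-forth related-back related-atoms

  -- Scott sentence complexity of the ordering

  scott : HasΣScott (suc (suc (suc l))) (Block true)
  scott = scottSentence , λ M enumM →
    (λ { (_ , σ , s) → models-isomorphic M enumM (σ ++ ε) s }) ,
    (λ iso → proj₂ (Isomorphic.satΣ-≅ M (Block true) iso scottSentence ε ε λ ()) (0 , (λ _ → root) ,
      proj₁ (Isomorphic.satΠ-≅ (Block true) (Block true) (≅-refl (Block true)) axioms (λ _ → root) _ λ { zero → refl }) axioms-true))

  complexity : ScottComplexityΣ (suc (suc (suc l))) (Block true)
  complexity = scott , noΠ , noDΣ
    where
    noΠ : ¬ HasΠScott (suc (suc (suc l))) (Block true)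
    noΠ (φ , h) = not-isomorphic (proj₁ (h (Block false) (Block-countable false))
      (Included-Π φ ε ε ≤-refl (λ ()) (proj₂ (h (Block true) (Block-countable true)) (≅-refl (Block true)))))
    noDΣ : ∀ β → β <o suc (suc (suc l)) → ¬ HasDΣScott β (Block true)
    noDΣ β p ((φ , ψ) , h) with proj₂ (h (Block true) (Block-countable true)) (≅-refl (Block true))
    -- For β at most l + 2 both conjuncts pass from `Block true` to `Block false`, since Σ and Π
    -- formulas of these levels are preserved in this direction.
    ... | s , t = not-isomorphic (proj₁ (h (Block false) (Block-countable false))
      (Included-Σ φ ε ε (suc-inj-≤ p) (λ ()) s , Included-Π ψ ε ε (<⇒≤ p) (λ ()) t))

mainTheorem6 : ExcludedMiddle 0ℓ → (l : Ord) → IsLimit l →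
    Σ Structure λ A → Countable A × IsLinearOrdering A × ScottComplexityΣ (suc (suc (suc l))) A
mainTheorem6 em l isLimit = Block true , Block-countable true , Block-linear true , complexity
  where
  open Construction em l isLimit (exponents em l)
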